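{- Let $R$ be a commutative ring and let $\mathcal{F}\colon\mathbf{MCob}\to R\mathbf{Mod}$ be an MTQFT with $V=\mathcal{F}(1)$ such that $\mathcal{F}(m^2)=\mathcal{F}(\mu\circ\Delta)$. Let $V$ be $\mathcal{G}$-graded for a finitely generated abelian group $\mathcal{G}$ with chosen generators $g_1,\dots,g_m$, and let $s\in\mathbb{Z}^m$ be a shift. Then for every perfect matching graph $\Gamma_M$ with trivalent underlying graph, $(C^{i,*}(\Gamma_M),\partial^i)$ is a chain complex of $R$-modules, i.e. $\partial^{i+1}\circ\partial^i=0$ for all $i$.
   Context: **Ribbon graphs.** Graphs are finite undirected multigraphs, connected with nonempty edge set. An (oriented) ribbon graph is a graph $G$ embedded in an oriented compact surface with boundary that deformation retracts onto $G$; equivalently, $G$ with a cyclic order of the half-edges at each vertex. It is represented by a ribbon diagram: a drawing of $G$ in the plane with vertices as dots and edges as curves that may cross, inducing the given cyclic orders counterclockwise. A perfect matching of $G$ is a set $M$ of edges such that each vertex is incident to exactly one edge in $M$ (matching edges have two distinct endpoints). A perfect matching graph $\Gamma_M$ is a ribbon graph with a perfect matching $M=\{e_1,\dots,e_\ell\}$ of its underlying graph. Trivalent: every vertex has degree 3. **Smoothings and states.** Draw a matching edge $e$ vertically, with the two other half-edges at its top vertex going up-left and up-right, and the two other half-edges at its bottom vertex going down-left and down-right. The 0-smoothing deletes $e$ and its endpoints and joins up-left with down-left and up-right with down-right; the 1-smoothing joins up-left with down-right and up-right with down-left (the strands cross). For $\alpha\in\{0,1\}^\ell$, the state $\Gamma_\alpha$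 is the collection of (immersed) circles obtained by applying the $\alpha_i$-smoothing at each $e_i$; $k_\alpha$ is its number of circles and $|\alpha|=\sum\alpha_i$. **MTQFTs.** $R\mathbf{Mod}$ is the symmetric monoidal category of finite-rank free $R$-modules. $\mathbf{MCob}$ is the symmetric monoidal category whose objects are nonnegative integers (numbers of circles with fixed orientation) and whose morphisms are diffeomorphism classes of possibly nonorientable two-dimensional cobordisms; it is presented as a symmetric monoidal category by generators $\mu\colon2\to1$, $\eta\colon0\to1$, $\Delta\colon1\to2$, $\epsilon\colon1\to0$, $m\colon1\to1$ ($m$ is a cylinder connected-summed with $\mathbb{RP}^2$), with the relations of a commutative Frobenius algebra for $(\mu,\eta,\Delta,\epsilon)$ together with $\mu\circ(m\otimes1)=m\circ\mu=\mu\circ(1\otimes m)$ and $m^3=\mu\circ\Delta\circ m$. An MTQFT is a symmetric monoidal functor $\mathcal{F}\colon\mathbf{MCob}\to R\mathbf{Mod}$. Write $\mu_V=\mathcal{F}(\mu)$, $\Delta_V=\mathcal{F}(\Delta)$, $m_V=\mathcal{F}(m)$. **Complex.** For $s=(s_1,\dots,s_m)$ the shift is $(V\{s\})_g=V_{g'}$, where $g=g_1^{p_1}\cdots g_m^{p_m}$ and $g'=g_1^{p_1-s_1}\cdots g_m^{p_m-s_m}$ (same underlying $R$-module). $V_\alpha=V^{\otimes k_\alpha}\{s|\alpha|\}$, with tensor factors indexed by the circles of $\Gamma_\alpha$. Put $C^{i,*}(\Gamma_M)=\bigoplus_{|\alpha|=i}V_\alpha$ for $0\le i\le\ell$ and $0$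 otherwise. If $\alpha'$ is obtained from $\alpha$ by changing one entry $0$ to $1$, then $\partial_{\alpha\alpha'}\colon V_\alpha\to V_{\alpha'}$ is $\mu_V$ if two circles merge, $\Delta_V$ if one circle splits into two, and $m_V$ if one circle is changed into one circle, on the affected tensor factors, and the identity on all other factors. For $v\in V_\alpha\subset C^{i,*}(\Gamma_M)$, $\partial^i(v)=\sum_{\alpha'}(-1)^{f_{\alpha\alpha'}}\partial_{\alpha\alpha'}(v)$, where the sum is over all such $\alpha'$ and $f_{\alpha\alpha'}$ is the number of entries 1 to the left of the entry where $\alpha,\alpha'$ differ. -}

module Defs where

open import Algebra.Bundles using (AbelianGroup; CommutativeMonoid; CommutativeRing)
open import Algebra.Module.Bundles using (Module)
open import Algebra.Module.Construct.TensorUnit using (⟨module⟩)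
open import Algebra.Module.Structures.Biased using (IsModuleFromLeft)
import Algebra.Definitions.RawMonoid as RawMonoidDefinitions
import Algebra.Module.Morphism.Structures as ModuleMorphismStructures
import Algebra.Properties.Semiring.Exp as Exp
open import Data.Bool.Base using (Bool; true; false; not)
import Data.Bool.Properties as Bool
open import Data.Empty using (⊥-elim)
open import Data.Fin.Base using (Fin; zero; suc)
import Data.Fin.Properties as Fin
open import Data.Fin.Subset using (∣_∣)
open import Data.Integer.Base as ℤ using (ℤ; +_; -[1+_])
open import Data.List.Base as List
  using (List; []; _∷_; allFin; cartesianProduct; deduplicate; filter; foldr; length)
open import Data.List.Membership.Propositional using (_∈_)
open import Data.List.Membership.Propositional.Properties
  using (∈-allFin; ∈-cartesianProduct⁺; ∈-filter⁺; ∈-filter⁻)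
open import Data.List.Relation.Unary.All using (All)
open import Data.List.Relation.Unary.AllPairs using (AllPairs)
open import Data.List.Relation.Unary.Any using (here; there)
open import Data.Nat.Base as ℕ using (ℕ; zero; suc; _+_; NonZero)
open import Data.Nat.Properties using (+-assoc; +-identityʳ)
open import Data.Product using (Σ; ∃; ∃!; _×_; _,_; proj₁; proj₂)
open import Data.Product.Properties using (≡-dec)
open import Data.Sum.Base using (_⊎_; inj₁; inj₂; [_,_])
open import Data.Vec.Base using (Vec; []; _∷_; lookup; _[_]≔_)
open import Data.Vec.Properties using (lookup∘updateAt′)
open import Function.Base using (_∘_; id)
open import Function.Bundles using (Func)
open import Function.Definitions using (Injective)
open import Level using (Level; _⊔_) renaming (suc to lsuc)
open import Relation.Binary.Bundles using (Setoid)
open import Relation.Binary.Construct.Closure.Equivalence as EqC using (EqClosure)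
open import Relation.Binary.Construct.Closure.ReflexiveTransitive using (Star; ε; _◅_; _◅◅_)
open import Relation.Binary.Construct.Closure.Symmetric using (SymClosure; fwd; bwd)
open import Relation.Binary.Core using (Rel)
open import Relation.Binary.Definitions using (Decidable; DecidableEquality)
open import Relation.Binary.PropositionalEquality
  as ≡ using (_≡_; _≢_; refl; sym; trans; subst)
open import Relation.Nullary using (¬_; Dec; yes; no)
open import Relation.Nullary.Decidable using (map′; _⊎-dec_; _×-dec_)

module LinearAlgebra {c ℓ} (R : CommutativeRing c ℓ) where

  open CommutativeRing R using (_≈_; 0#; 1#) renaming
    ( Carrier to K; _+_ to _+ᴷ_; _*_ to _*ᴷ_; -_ to -ᴷ_; refl to ≈-refl )

  module _ {m₁ ℓm₁ m₂ ℓm₂} (M : Module R m₁ ℓm₁) (N : Module R m₂ ℓm₂) where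

    private
      module M = Module M
      module N = Module N

    open ModuleMorphismStructures.ModuleMorphisms M.rawModule N.rawModule
      using (IsModuleHomomorphism)

    record LinearMap : Set (c ⊔ m₁ ⊔ ℓm₁ ⊔ m₂ ⊔ ℓm₂) where
      field
        ⟦_⟧                  : M.Carrierᴹ → N.Carrierᴹ
        isModuleHomomorphism : IsModuleHomomorphism ⟦_⟧

      open IsModuleHomomorphism isModuleHomomorphism public
        using (⟦⟧-cong; +ᴹ-homo; *ₗ-homo; 0ᴹ-homo; -ᴹ-homo)

  open LinearMap using (⟦_⟧) public
  open LinearMap using (⟦⟧-cong; +ᴹ-homo; *ₗ-homo; 0ᴹ-homo; -ᴹ-homo)

  module _ {m₁ ℓm₁ m₂ ℓm₂} {M : Module R m₁ ℓm₁} {N : Module R m₂ ℓm₂} where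

    private
      module M = Module M
      module N = Module N

    linear : (f : M.Carrierᴹ → N.Carrierᴹ) →
             (∀ {x y} → x M.≈ᴹ y → f x N.≈ᴹ f y) →
             (∀ x y → f (x M.+ᴹ y) N.≈ᴹ f x N.+ᴹ f y) →
             (∀ r x → f (r M.*ₗ x) N.≈ᴹ r N.*ₗ f x) →
             LinearMap M N
    linear f f-cong f-+ f-* = record
      { ⟦_⟧ = f
      ; isModuleHomomorphism = record
        { isBimoduleHomomorphism = record
          { +ᴹ-isGroupHomomorphism = record
            { isMonoidHomomorphism = record
              { isMagmaHomomorphism = record
                { isRelHomomorphism = record { cong = f-cong }
                ; homo = f-+
                }
              ; ε-homo = f-0
              }
            ; ⁻¹-homo = f-neg
            }
          ; *ₗ-homo = f-*
          ; *ᵣ-homo = λ r x → N.≈ᴹ-trans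
              (f-cong (M.≈ᴹ-sym (M.*ₗ-*ᵣ-coincident r x)))
              (N.≈ᴹ-trans (f-* r x) (N.*ₗ-*ᵣ-coincident r (f x)))
          }
        }
      }
      where
      f-0 : f M.0ᴹ N.≈ᴹ N.0ᴹ
      f-0 = N.≈ᴹ-trans (f-cong (M.≈ᴹ-sym (M.*ₗ-zeroˡ M.0ᴹ)))
              (N.≈ᴹ-trans (f-* 0# M.0ᴹ) (N.*ₗ-zeroˡ _))
      f-neg : ∀ x → f (M.-ᴹ x) N.≈ᴹ N.-ᴹ f x
      f-neg x = N.uniqueʳ‿-ᴹ (f x) (f (M.-ᴹ x))
        (N.≈ᴹ-trans (N.≈ᴹ-sym (f-+ x (M.-ᴹ x)))
          (N.≈ᴹ-trans (f-cong (M.-ᴹ‿inverseʳ x)) f-0))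

    infix 4 _≋_
    _≋_ : Rel (LinearMap M N) (m₁ ⊔ ℓm₂)
    f ≋ g = ∀ x → ⟦ f ⟧ x N.≈ᴹ ⟦ g ⟧ x

    zeroᴸ : LinearMap M N
    zeroᴸ = linear (λ _ → N.0ᴹ) (λ _ → N.≈ᴹ-refl)
      (λ _ _ → N.≈ᴹ-sym (N.+ᴹ-identityˡ N.0ᴹ))
      (λ r _ → N.≈ᴹ-sym (N.*ₗ-zeroʳ r))

    infixl 6 _+ᴸ_
    infixr 7 _·ᴸ_

    _+ᴸ_ : LinearMap M N → LinearMap M N → LinearMap M N
    f +ᴸ g = linear (λ x → ⟦ f ⟧ x N.+ᴹ ⟦ g ⟧ x)
      (λ e → N.+ᴹ-cong (⟦⟧-cong f e) (⟦⟧-cong g e))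
      (λ x y → N.≈ᴹ-trans (N.+ᴹ-cong (+ᴹ-homo f x y) (+ᴹ-homo g x y)) (interchange _ _ _ _))
      (λ r x → N.≈ᴹ-trans (N.+ᴹ-cong (*ₗ-homo f r x) (*ₗ-homo g r x))
                 (N.≈ᴹ-sym (N.*ₗ-distribˡ r _ _)))
      where
      open import Algebra.Properties.CommutativeSemigroup
        (CommutativeMonoid.commutativeSemigroup N.+ᴹ-commutativeMonoid) using (interchange)

    _·ᴸ_ : K → LinearMap M N → LinearMap M N
    r ·ᴸ f = linear (λ x → r N.*ₗ ⟦ f ⟧ x)
      (λ e → N.*ₗ-cong ≈-refl (⟦⟧-cong f e))
      (λ x y → N.≈ᴹ-trans (N.*ₗ-cong ≈-refl (+ᴹ-homo f x y)) (N.*ₗ-distribˡ r _ _))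
      (λ s x → N.≈ᴹ-trans (N.*ₗ-cong ≈-refl (*ₗ-homo f s x)) (N.*ₗ-comm r s _))

    ∑ᴸ : ∀ {n} → (Fin n → LinearMap M N) → LinearMap M N
    ∑ᴸ {zero}  f = zeroᴸ
    ∑ᴸ {suc n} f = f zero +ᴸ ∑ᴸ (f ∘ suc)

  infixr 9 _∘ᴸ_
  _∘ᴸ_ : ∀ {m₁ ℓm₁ m₂ ℓm₂ m₃ ℓm₃}
         {L : Module R m₁ ℓm₁} {M : Module R m₂ ℓm₂} {N : Module R m₃ ℓm₃} →
         LinearMap M N → LinearMap L M → LinearMap L N
  _∘ᴸ_ {N = N} f g = linear (⟦ f ⟧ ∘ ⟦ g ⟧)
    (⟦⟧-cong f ∘ ⟦⟧-cong g)
    (λ x y → ≈ᴹ-trans (⟦⟧-cong f (+ᴹ-homo g x y)) (+ᴹ-homo f _ _))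
    (λ r x → ≈ᴹ-trans (⟦⟧-cong f (*ₗ-homo g r x)) (*ₗ-homo f r _))
    where open Module N

  IsChainComplex : ∀ {m ℓm} (C : ℤ → Module R m ℓm) →
                   (∀ i → LinearMap (C i) (C (ℤ.suc i))) → Set (m ⊔ ℓm)
  IsChainComplex C ∂ = ∀ i → ∂ (ℤ.suc i) ∘ᴸ ∂ i ≋ zeroᴸ

  record FiniteRankFree {m ℓm} (M : Module R m ℓm) : Set (c ⊔ ℓ ⊔ m ⊔ ℓm) where
    open Module M
    open RawMonoidDefinitions +ᴹ-rawMonoid using (sum)
    field
      rank        : ℕ
      basis       : Fin rank → Carrierᴹ
      coords      : Carrierᴹ → Fin rank → K
      expansion   : ∀ x → sum (λ i → coords x i *ₗ basis i) ≈ᴹ x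
      independent : ∀ (r : Fin rank → K) → sum (λ i → r i *ₗ basis i) ≈ᴹ 0ᴹ → ∀ i → r i ≈ 0#

  -- The module with generators X and relations _▹_.  Both tensor products
  -- and direct sums are instances.

  infixl 6 _+ₜ_
  infixr 8 -ₜ_
  infixr 7 _·ₜ_

  data Term {x} (X : Set x) : Set (c ⊔ x) where
    gen  : X → Term X
    0ₜ   : Term X
    _+ₜ_ : Term X → Term X → Term X
    -ₜ_  : Term X → Term X
    _·ₜ_ : K → Term X → Term X

  module _ {x r} {X : Set x} (_▹_ : Rel (Term X) r) where

    infix 4 _~_
    data _~_ : Rel (Term X) (c ⊔ ℓ ⊔ x ⊔ r) where
      relation    : ∀ {s t} → s ▹ t → s ~ t
      ~-refl      : ∀ {s} → s ~ s
      ~-sym       : ∀ {s t} → s ~ t → t ~ s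
      ~-trans     : ∀ {s t u} → s ~ t → t ~ u → s ~ u
      +-cong      : ∀ {s s′ t t′} → s ~ s′ → t ~ t′ → s +ₜ t ~ s′ +ₜ t′
      neg-cong    : ∀ {s t} → s ~ t → -ₜ s ~ -ₜ t
      ·-cong      : ∀ {a b s t} → a ≈ b → s ~ t → a ·ₜ s ~ b ·ₜ t
      assoc       : ∀ s t u → (s +ₜ t) +ₜ u ~ s +ₜ (t +ₜ u)
      comm        : ∀ s t → s +ₜ t ~ t +ₜ s
      identityˡ   : ∀ s → 0ₜ +ₜ s ~ s
      inverseˡ    : ∀ s → (-ₜ s) +ₜ s ~ 0ₜ
      ·-distribˡ  : ∀ a s t → a ·ₜ (s +ₜ t) ~ a ·ₜ s +ₜ a ·ₜ t
      ·-distribʳ  : ∀ s a b → (a +ᴷ b) ·ₜ s ~ a ·ₜ s +ₜ b ·ₜ s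
      ·-assoc     : ∀ a b s → (a *ᴷ b) ·ₜ s ~ a ·ₜ (b ·ₜ s)
      ·-identityˡ : ∀ s → 1# ·ₜ s ~ s
      ·-zeroˡ     : ∀ s → 0# ·ₜ s ~ 0ₜ
      ·-zeroʳ     : ∀ a → a ·ₜ 0ₜ ~ 0ₜ

    Presented : Module R (c ⊔ x) (c ⊔ ℓ ⊔ x ⊔ r)
    Presented = record
      { Carrierᴹ = Term X
      ; _≈ᴹ_ = _~_
      ; _+ᴹ_ = _+ₜ_
      ; _*ₗ_ = _·ₜ_
      ; _*ᵣ_ = λ t a → a ·ₜ t
      ; 0ᴹ = 0ₜ
      ; -ᴹ_ = -ₜ_
      ; isModule = IsModuleFromLeft.isModule {commutativeRing = R} (record
        { isLeftModule = record
          { isLeftSemimodule = record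
            { +ᴹ-isCommutativeMonoid = record
              { isMonoid = record
                { isSemigroup = record
                  { isMagma = record
                    { isEquivalence = record { refl = ~-refl ; sym = ~-sym ; trans = ~-trans }
                    ; ∙-cong = +-cong
                    }
                  ; assoc = assoc
                  }
                ; identity = identityˡ , λ s → ~-trans (comm s 0ₜ) (identityˡ s)
                }
              ; comm = comm
              }
            ; isPreleftSemimodule = record
              { *ₗ-cong = ·-cong
              ; *ₗ-zeroˡ = ·-zeroˡ
              ; *ₗ-distribʳ = ·-distribʳ
              ; *ₗ-identityˡ = ·-identityˡ
              ; *ₗ-assoc = ·-assoc
              ; *ₗ-zeroʳ = ·-zeroʳ
              ; *ₗ-distribˡ = ·-distribˡ
              }
            }
          ; -ᴹ‿cong = neg-cong
          ; -ᴹ‿inverse = inverseˡ , λ s → ~-trans (comm s (-ₜ s)) (inverseˡ s)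
          }
        })
      }

  module _ {x m ℓm} {X : Set x} (N : Module R m ℓm) where

    open Module N

    evaluate : (X → Carrierᴹ) → Term X → Carrierᴹ
    evaluate f (gen x)  = f x
    evaluate f 0ₜ       = 0ᴹ
    evaluate f (s +ₜ t) = evaluate f s +ᴹ evaluate f t
    evaluate f (-ₜ s)   = -ᴹ evaluate f s
    evaluate f (a ·ₜ s) = a *ₗ evaluate f s

    evaluate-cong : ∀ {r} {_▹_ : Rel (Term X) r} (f : X → Carrierᴹ) →
                    (∀ {s t} → s ▹ t → evaluate f s ≈ᴹ evaluate f t) →
                    ∀ {s t} → _~_ _▹_ s t → evaluate f s ≈ᴹ evaluate f t
    evaluate-cong {_▹_ = _▹_} f f-▹ = go
      where
      go : ∀ {s t} → _~_ _▹_ s t → evaluate f s ≈ᴹ evaluate f t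
      go (relation p)       = f-▹ p
      go ~-refl             = ≈ᴹ-refl
      go (~-sym p)          = ≈ᴹ-sym (go p)
      go (~-trans p q)      = ≈ᴹ-trans (go p) (go q)
      go (+-cong p q)       = +ᴹ-cong (go p) (go q)
      go (neg-cong p)       = -ᴹ‿cong (go p)
      go (·-cong a p)       = *ₗ-cong a (go p)
      go (assoc s t u)      = +ᴹ-assoc _ _ _
      go (comm s t)         = +ᴹ-comm _ _
      go (identityˡ s)      = +ᴹ-identityˡ _
      go (inverseˡ s)       = -ᴹ‿inverseˡ _
      go (·-distribˡ a s t) = *ₗ-distribˡ _ _ _
      go (·-distribʳ s a b) = *ₗ-distribʳ _ _ _
      go (·-assoc a b s)    = *ₗ-assoc _ _ _
      go (·-identityˡ s)    = *ₗ-identityˡ _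
      go (·-zeroˡ s)        = *ₗ-zeroˡ _
      go (·-zeroʳ a)        = *ₗ-zeroʳ _

    lift : ∀ {r} {_▹_ : Rel (Term X) r} (f : X → Carrierᴹ) →
           (∀ {s t} → s ▹ t → evaluate f s ≈ᴹ evaluate f t) →
           LinearMap (Presented _▹_) N
    lift f f-▹ = linear (evaluate f) (evaluate-cong f f-▹)
      (λ _ _ → ≈ᴹ-refl) (λ _ _ → ≈ᴹ-refl)

    lift-ext : ∀ {r} {_▹_ : Rel (Term X) r} (f g : LinearMap (Presented _▹_) N) →
               (∀ x → ⟦ f ⟧ (gen x) ≈ᴹ ⟦ g ⟧ (gen x)) → f ≋ g
    lift-ext f g e (gen x)  = e x
    lift-ext f g e 0ₜ       = ≈ᴹ-trans (0ᴹ-homo f) (≈ᴹ-sym (0ᴹ-homo g))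
    lift-ext f g e (s +ₜ t) = ≈ᴹ-trans (+ᴹ-homo f s t)
      (≈ᴹ-trans (+ᴹ-cong (lift-ext f g e s) (lift-ext f g e t)) (≈ᴹ-sym (+ᴹ-homo g s t)))
    lift-ext f g e (-ₜ s)   = ≈ᴹ-trans (-ᴹ-homo f s)
      (≈ᴹ-trans (-ᴹ‿cong (lift-ext f g e s)) (≈ᴹ-sym (-ᴹ-homo g s)))
    lift-ext f g e (a ·ₜ s) = ≈ᴹ-trans (*ₗ-homo f a s)
      (≈ᴹ-trans (*ₗ-cong ≈-refl (lift-ext f g e s)) (≈ᴹ-sym (*ₗ-homo g a s)))

  module _ {m₁ ℓm₁ m₂ ℓm₂} (M : Module R m₁ ℓm₁) (N : Module R m₂ ℓm₂) where

    private
      module M = Module M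
      module N = Module N

    data Bilinear : Rel (Term (M.Carrierᴹ × N.Carrierᴹ)) (c ⊔ m₁ ⊔ ℓm₁ ⊔ m₂ ⊔ ℓm₂) where
      ⊗-cong : ∀ {x x′ y y′} → x M.≈ᴹ x′ → y N.≈ᴹ y′ → Bilinear (gen (x , y)) (gen (x′ , y′))
      +ˡ     : ∀ x x′ y → Bilinear (gen (x M.+ᴹ x′ , y)) (gen (x , y) +ₜ gen (x′ , y))
      +ʳ     : ∀ x y y′ → Bilinear (gen (x , y N.+ᴹ y′)) (gen (x , y) +ₜ gen (x , y′))
      ·ˡ     : ∀ a x y → Bilinear (gen (a M.*ₗ x , y)) (a ·ₜ gen (x , y))
      ·ʳ     : ∀ a x y → Bilinear (gen (x , a N.*ₗ y)) (a ·ₜ gen (x , y))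

    infixl 7 _⊗_
    _⊗_ : Module R (c ⊔ m₁ ⊔ m₂) (c ⊔ ℓ ⊔ m₁ ⊔ ℓm₁ ⊔ m₂ ⊔ ℓm₂)
    _⊗_ = Presented Bilinear

  infixr 7 _⊗ₑ_
  pattern _⊗ₑ_ x y = gen (x , y)

  -- The tensor product of copies of V indexed by the elements of I: families
  -- of vectors, one for each element of I, modulo linearity in each coordinate.

  module _ {i ℓi m ℓm} (I : Setoid i ℓi) (V : Module R m ℓm) where

    private
      module I = Setoid I
      module V = Module V

    Tuple : Set (i ⊔ ℓi ⊔ m ⊔ ℓm)
    Tuple = Func I V.≈ᴹ-setoid

    open Func

    SameOff : I.Carrier → Tuple → Tuple → Set (i ⊔ ℓi ⊔ ℓm)
    SameOff k f g = ∀ j → ¬ (j I.≈ k) → to f j V.≈ᴹ to g j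

    data Multilinear : Rel (Term Tuple) (c ⊔ i ⊔ ℓi ⊔ m ⊔ ℓm) where
      ⨂-cong : ∀ {f g} → (∀ j → to f j V.≈ᴹ to g j) → Multilinear (gen f) (gen g)
      ⨂-+    : ∀ k {f g h} → SameOff k h f → SameOff k h g →
               to h k V.≈ᴹ to f k V.+ᴹ to g k → Multilinear (gen h) (gen f +ₜ gen g)
      ⨂-·    : ∀ k a {f h} → SameOff k h f →
               to h k V.≈ᴹ a V.*ₗ to f k → Multilinear (gen h) (a ·ₜ gen f)

    ⨂ : Module R (c ⊔ i ⊔ ℓi ⊔ m ⊔ ℓm) (c ⊔ ℓ ⊔ i ⊔ ℓi ⊔ m ⊔ ℓm)
    ⨂ = Presented Multilinear

  module _ {i m ℓm} {I : Set i} (M : I → Module R m ℓm) where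

    private module M k = Module (M k)

    data SummandLinear : Rel (Term (Σ I M.Carrierᴹ)) (c ⊔ i ⊔ m ⊔ ℓm) where
      ⨁-cong : ∀ k {x y} → M._≈ᴹ_ k x y → SummandLinear (gen (k , x)) (gen (k , y))
      ⨁-+    : ∀ k x y → SummandLinear (gen (k , M._+ᴹ_ k x y)) (gen (k , x) +ₜ gen (k , y))
      ⨁-·    : ∀ k a x → SummandLinear (gen (k , M._*ₗ_ k a x)) (a ·ₜ gen (k , x))

    ⨁ : Module R (c ⊔ i ⊔ m) (c ⊔ ℓ ⊔ i ⊔ m ⊔ ℓm)
    ⨁ = Presented SummandLinear

    inclusion : ∀ k → LinearMap (M k) ⨁
    inclusion k = linear (λ x → gen (k , x))
      (relation ∘ ⨁-cong k) (λ x y → relation (⨁-+ k x y)) (λ a x → relation (⨁-· k a x))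

    cotuple : ∀ {n ℓn} {N : Module R n ℓn} → (∀ k → LinearMap (M k) N) → LinearMap ⨁ N
    cotuple {N = N} f = lift N (λ (k , x) → ⟦ f k ⟧ x) λ where
      (⨁-cong k x≈y) → ⟦⟧-cong (f k) x≈y
      (⨁-+ k x y)    → +ᴹ-homo (f k) x y
      (⨁-· k a x)    → *ₗ-homo (f k) a x

infixr 9 _∘ᶜ_
infixr 8 _⊞_

data Cob : ℕ → ℕ → Set where
  idᶜ  : ∀ a → Cob a a
  _∘ᶜ_ : ∀ {a b d} → Cob b d → Cob a b → Cob a d
  _⊞_  : ∀ {a b a′ b′} → Cob a b → Cob a′ b′ → Cob (a + a′) (b + b′)
  σ    : ∀ a b → Cob (a + b) (b + a)
  μᶜ   : Cob 2 1
  ηᶜ   : Cob 0 1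
  Δᶜ   : Cob 1 2
  ϵᶜ   : Cob 1 0
  mᶜ   : Cob 1 1

-- Disjoint union is strictly associative and unital; as + on ℕ is so only
-- propositionally, the structural isomorphisms are the identities transported
-- along these equations.
castᶜ : ∀ {a b} → a ≡ b → Cob a b
castᶜ {a} refl = idᶜ a

α⇒ : ∀ a b d → Cob ((a + b) + d) (a + (b + d))
α⇒ a b d = castᶜ (+-assoc a b d)

ρ⇒ : ∀ a → Cob (a + 0) a
ρ⇒ a = castᶜ (+-identityʳ a)

infix 4 _≈ᶜ_
data _≈ᶜ_ : ∀ {a b} → Rel (Cob a b) Level.zero where
  ≈ᶜ-refl  : ∀ {a b} {f : Cob a b} → f ≈ᶜ f
  ≈ᶜ-sym   : ∀ {a b} {f g : Cob a b} → f ≈ᶜ g → g ≈ᶜ f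
  ≈ᶜ-trans : ∀ {a b} {f g h : Cob a b} → f ≈ᶜ g → g ≈ᶜ h → f ≈ᶜ h
  ∘-cong   : ∀ {a b d} {f f′ : Cob b d} {g g′ : Cob a b} →
             f ≈ᶜ f′ → g ≈ᶜ g′ → f ∘ᶜ g ≈ᶜ f′ ∘ᶜ g′
  ⊞-cong   : ∀ {a b a′ b′} {f f′ : Cob a b} {g g′ : Cob a′ b′} →
             f ≈ᶜ f′ → g ≈ᶜ g′ → f ⊞ g ≈ᶜ f′ ⊞ g′

  ∘-assoc     : ∀ {a b d e} (f : Cob d e) (g : Cob b d) (h : Cob a b) →
                (f ∘ᶜ g) ∘ᶜ h ≈ᶜ f ∘ᶜ (g ∘ᶜ h)
  ∘-identityˡ : ∀ {a b} (f : Cob a b) → idᶜ b ∘ᶜ f ≈ᶜ f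
  ∘-identityʳ : ∀ {a b} (f : Cob a b) → f ∘ᶜ idᶜ a ≈ᶜ f

  ⊞-id        : ∀ a b → idᶜ a ⊞ idᶜ b ≈ᶜ idᶜ (a + b)
  ⊞-∘         : ∀ {a b d a′ b′ d′} (f : Cob b d) (g : Cob a b) (f′ : Cob b′ d′) (g′ : Cob a′ b′) →
                (f ∘ᶜ g) ⊞ (f′ ∘ᶜ g′) ≈ᶜ (f ⊞ f′) ∘ᶜ (g ⊞ g′)
  ⊞-assoc     : ∀ {a a′ b b′ d d′} (f : Cob a a′) (g : Cob b b′) (h : Cob d d′) →
                α⇒ a′ b′ d′ ∘ᶜ ((f ⊞ g) ⊞ h) ≈ᶜ (f ⊞ (g ⊞ h)) ∘ᶜ α⇒ a b d
  ⊞-identityˡ : ∀ {a b} (f : Cob a b) → idᶜ 0 ⊞ f ≈ᶜ f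
  ⊞-identityʳ : ∀ {a b} (f : Cob a b) → ρ⇒ b ∘ᶜ (f ⊞ idᶜ 0) ≈ᶜ f ∘ᶜ ρ⇒ a

  σ-natural    : ∀ {a a′ b b′} (f : Cob a a′) (g : Cob b b′) →
                 σ a′ b′ ∘ᶜ (f ⊞ g) ≈ᶜ (g ⊞ f) ∘ᶜ σ a b
  σ-involutive : ∀ a b → σ b a ∘ᶜ σ a b ≈ᶜ idᶜ (a + b)
  σ-hexagon    : ∀ a b d →
                 α⇒ b d a ∘ᶜ σ a (b + d) ∘ᶜ α⇒ a b d ≈ᶜ
                 (idᶜ b ⊞ σ a d) ∘ᶜ α⇒ b a d ∘ᶜ (σ a b ⊞ idᶜ d)

  μ-assoc    : μᶜ ∘ᶜ (μᶜ ⊞ idᶜ 1) ≈ᶜ μᶜ ∘ᶜ (idᶜ 1 ⊞ μᶜ)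
  μ-unit     : μᶜ ∘ᶜ (ηᶜ ⊞ idᶜ 1) ≈ᶜ idᶜ 1
  μ-comm     : μᶜ ∘ᶜ σ 1 1 ≈ᶜ μᶜ
  Δ-assoc    : (Δᶜ ⊞ idᶜ 1) ∘ᶜ Δᶜ ≈ᶜ (idᶜ 1 ⊞ Δᶜ) ∘ᶜ Δᶜ
  Δ-counitˡ  : (ϵᶜ ⊞ idᶜ 1) ∘ᶜ Δᶜ ≈ᶜ idᶜ 1
  Δ-counitʳ  : (idᶜ 1 ⊞ ϵᶜ) ∘ᶜ Δᶜ ≈ᶜ idᶜ 1
  frobeniusˡ : (μᶜ ⊞ idᶜ 1) ∘ᶜ (idᶜ 1 ⊞ Δᶜ) ≈ᶜ Δᶜ ∘ᶜ μᶜ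
  frobeniusʳ : (idᶜ 1 ⊞ μᶜ) ∘ᶜ (Δᶜ ⊞ idᶜ 1) ≈ᶜ Δᶜ ∘ᶜ μᶜ

  m-μˡ : μᶜ ∘ᶜ (mᶜ ⊞ idᶜ 1) ≈ᶜ mᶜ ∘ᶜ μᶜ
  m-μʳ : mᶜ ∘ᶜ μᶜ ≈ᶜ μᶜ ∘ᶜ (idᶜ 1 ⊞ mᶜ)
  m³   : mᶜ ∘ᶜ mᶜ ∘ᶜ mᶜ ≈ᶜ μᶜ ∘ᶜ Δᶜ ∘ᶜ mᶜ

-- A strong symmetric monoidal functor to finite-rank free modules.  The
-- coherence axioms are stated on pure tensors, which generate.
record MTQFT {c ℓ} (R : CommutativeRing c ℓ) v ℓv : Set (c ⊔ ℓ ⊔ lsuc (v ⊔ ℓv)) where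
  open LinearAlgebra R
  open CommutativeRing R using () renaming (Carrier to K)

  field
    obj  : ℕ → Module R v ℓv
    free : ∀ a → FiniteRankFree (obj a)
    hom  : ∀ {a b} → Cob a b → LinearMap (obj a) (obj b)

  ∣obj∣ : ℕ → Set v
  ∣obj∣ a = Module.Carrierᴹ (obj a)

  infix 4 _≈ᴹ_
  _≈ᴹ_ : ∀ {a} → Rel (∣obj∣ a) ℓv
  _≈ᴹ_ {a} = Module._≈ᴹ_ (obj a)

  infixr 7 _*ₗ_
  _*ₗ_ : ∀ {a} → K → ∣obj∣ a → ∣obj∣ a
  _*ₗ_ {a} = Module._*ₗ_ (obj a)

  field
    hom-cong : ∀ {a b} {f g : Cob a b} → f ≈ᶜ g → hom f ≋ hom g
    hom-id   : ∀ a x → ⟦ hom (idᶜ a) ⟧ x ≈ᴹ x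
    hom-∘    : ∀ {a b d} (f : Cob b d) (g : Cob a b) → hom (f ∘ᶜ g) ≋ hom f ∘ᴸ hom g

    φ     : ∀ a b → LinearMap (obj a ⊗ obj b) (obj (a + b))
    φ⁻¹   : ∀ a b → LinearMap (obj (a + b)) (obj a ⊗ obj b)
    φ-φ⁻¹ : ∀ a b x → ⟦ φ a b ⟧ (⟦ φ⁻¹ a b ⟧ x) ≈ᴹ x
    φ⁻¹-φ : ∀ a b t → Module._≈ᴹ_ (obj a ⊗ obj b) (⟦ φ⁻¹ a b ⟧ (⟦ φ a b ⟧ t)) t

    φ₀      : LinearMap (⟨module⟩ {R = R}) (obj 0)
    φ₀⁻¹    : LinearMap (obj 0) (⟨module⟩ {R = R})
    φ₀-φ₀⁻¹ : ∀ x → ⟦ φ₀ ⟧ (⟦ φ₀⁻¹ ⟧ x) ≈ᴹ x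
    φ₀⁻¹-φ₀ : ∀ r → CommutativeRing._≈_ R (⟦ φ₀⁻¹ ⟧ (⟦ φ₀ ⟧ r)) r

    φ-natural : ∀ {a a′ b b′} (f : Cob a a′) (g : Cob b b′) (x : ∣obj∣ a) (y : ∣obj∣ b) →
                ⟦ hom (f ⊞ g) ⟧ (⟦ φ a b ⟧ (x ⊗ₑ y)) ≈ᴹ ⟦ φ a′ b′ ⟧ (⟦ hom f ⟧ x ⊗ₑ ⟦ hom g ⟧ y)
    φ-assoc   : ∀ a b d (x : ∣obj∣ a) (y : ∣obj∣ b) (z : ∣obj∣ d) →
                ⟦ hom (α⇒ a b d) ⟧ (⟦ φ (a + b) d ⟧ (⟦ φ a b ⟧ (x ⊗ₑ y) ⊗ₑ z)) ≈ᴹ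
                ⟦ φ a (b + d) ⟧ (x ⊗ₑ ⟦ φ b d ⟧ (y ⊗ₑ z))
    φ-unitˡ   : ∀ a (r : K) (x : ∣obj∣ a) → ⟦ φ 0 a ⟧ (⟦ φ₀ ⟧ r ⊗ₑ x) ≈ᴹ r *ₗ x
    φ-unitʳ   : ∀ a (r : K) (x : ∣obj∣ a) → ⟦ hom (ρ⇒ a) ⟧ (⟦ φ a 0 ⟧ (x ⊗ₑ ⟦ φ₀ ⟧ r)) ≈ᴹ r *ₗ x
    φ-σ       : ∀ a b (x : ∣obj∣ a) (y : ∣obj∣ b) →
                ⟦ hom (σ a b) ⟧ (⟦ φ a b ⟧ (x ⊗ₑ y)) ≈ᴹ ⟦ φ b a ⟧ (y ⊗ₑ x)

  V : Module R v ℓv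
  V = obj 1

  μⱽ : LinearMap (V ⊗ V) V
  μⱽ = hom μᶜ ∘ᴸ φ 1 1

  Δⱽ : LinearMap V (V ⊗ V)
  Δⱽ = φ⁻¹ 1 1 ∘ᴸ hom Δᶜ

  mⱽ : LinearMap V V
  mⱽ = hom mᶜ

module Monomials {a ℓ} (G : AbelianGroup a ℓ) where

  open AbelianGroup G
  open RawMonoidDefinitions rawMonoid renaming (_×_ to _times_; sum to ∏)

  infixr 8 _^ᶻ_
  _^ᶻ_ : Carrier → ℤ → Carrier
  g ^ᶻ (+ n)    = n times g
  g ^ᶻ -[1+ n ] = (suc n times g) ⁻¹

  monomial : ∀ {n} → (Fin n → Carrier) → (Fin n → ℤ) → Carrier
  monomial g p = ∏ (λ i → g i ^ᶻ p i)

record FinGenAbelianGroup a ℓ : Set (lsuc (a ⊔ ℓ)) where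
  field
    abelianGroup : AbelianGroup a ℓ

  open AbelianGroup abelianGroup
  open Monomials abelianGroup

  field
    rank      : ℕ
    generator : Fin rank → Carrier
    generates : ∀ g → ∃ λ p → g ≈ monomial generator p

module Graded {c ℓ a ℓa} (R : CommutativeRing c ℓ) (𝒢 : FinGenAbelianGroup a ℓa) where

  open LinearAlgebra R
  open FinGenAbelianGroup 𝒢 using (abelianGroup; rank; generator)
  open Monomials abelianGroup using (monomial)
  open AbelianGroup abelianGroup using (_∙_; _⁻¹) renaming
    ( Carrier to ∣𝒢∣; _≈_ to _≈ᵍ_; ε to 1ᵍ; refl to ≈ᵍ-refl; sym to ≈ᵍ-sym; trans to ≈ᵍ-trans
    ; setoid to 𝒢-setoid; ∙-congʳ to ∙ᵍ-congʳ )

  record Components {m ℓm} (M : Module R m ℓm) p : Set (c ⊔ a ⊔ ℓa ⊔ m ⊔ ℓm ⊔ lsuc p) where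
    open Module M
    field
      _∈[_]     : Carrierᴹ → ∣𝒢∣ → Set p
      ∈-resp    : ∀ {x y g h} → x ≈ᴹ y → g ≈ᵍ h → x ∈[ g ] → y ∈[ h ]
      0-closed  : ∀ {g} → 0ᴹ ∈[ g ]
      +-closed  : ∀ {x y g} → x ∈[ g ] → y ∈[ g ] → (x +ᴹ y) ∈[ g ]
      *ₗ-closed : ∀ r {x g} → x ∈[ g ] → (r *ₗ x) ∈[ g ]

  -- M is the internal direct sum of its components.
  record IsGrading {m ℓm p} {M : Module R m ℓm} (G : Components M p) :
                   Set (a ⊔ ℓa ⊔ m ⊔ ℓm ⊔ p) where
    open Module M
    open Components G

    sumᴹ : List (∣𝒢∣ × Carrierᴹ) → Carrierᴹ
    sumᴹ = foldr (λ (_ , x) s → x +ᴹ s) 0ᴹ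

    Homogeneous : List (∣𝒢∣ × Carrierᴹ) → Set (a ⊔ m ⊔ p)
    Homogeneous = All (λ (g , x) → x ∈[ g ])

    field
      spanning    : ∀ x → ∃ λ xs → Homogeneous xs × x ≈ᴹ sumᴹ xs
      independent : ∀ xs → Homogeneous xs → AllPairs (λ (g , _) (h , _) → ¬ (g ≈ᵍ h)) xs →
                    sumᴹ xs ≈ᴹ 0ᴹ → All (λ (_ , x) → x ≈ᴹ 0ᴹ) xs

  -- Only the components are recorded; that they decompose the module is the
  -- separate predicate IsGrading.
  record GradedModule m ℓm p : Set (c ⊔ ℓ ⊔ a ⊔ ℓa ⊔ lsuc (m ⊔ ℓm ⊔ p)) where
    field
      module′    : Module R m ℓm
      components : Components module′ p

  module _ {m ℓm q} (M : Module R m ℓm) (Gen : Module.Carrierᴹ M → ∣𝒢∣ → Set q) where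

    open Module M

    data Span (g : ∣𝒢∣) : Carrierᴹ → Set (c ⊔ a ⊔ ℓa ⊔ m ⊔ ℓm ⊔ q) where
      span-gen  : ∀ {x h} → h ≈ᵍ g → Gen x h → Span g x
      span-resp : ∀ {x y} → x ≈ᴹ y → Span g x → Span g y
      span-0    : Span g 0ᴹ
      span-+    : ∀ {x y} → Span g x → Span g y → Span g (x +ᴹ y)
      span-*    : ∀ r {x} → Span g x → Span g (r *ₗ x)

    private
      regrade : ∀ {g h x} → g ≈ᵍ h → Span g x → Span h x
      regrade e (span-gen e′ p)  = span-gen (≈ᵍ-trans e′ e) p
      regrade e (span-resp e′ p) = span-resp e′ (regrade e p)
      regrade e span-0           = span-0
      regrade e (span-+ p q)     = span-+ (regrade e p) (regrade e q)
      regrade e (span-* r p)     = span-* r (regrade e p)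

    spanned : Components M (c ⊔ a ⊔ ℓa ⊔ m ⊔ ℓm ⊔ q)
    spanned = record
      { _∈[_]     = λ x g → Span g x
      ; ∈-resp    = λ x≈y g≈h p → span-resp x≈y (regrade g≈h p)
      ; 0-closed  = span-0
      ; +-closed  = span-+
      ; *ₗ-closed = λ r → span-* r
      }

  open Components

  -- The shift M{s}.  For g = ∏ gᵢ^pᵢ the degree ∏ gᵢ^(pᵢ - sᵢ) is g ∙ (∏ gᵢ^sᵢ)⁻¹.
  _⟨_⟩ : ∀ {m ℓm p} {M : Module R m ℓm} → Components M p → (Fin rank → ℤ) → Components M p
  G ⟨ s ⟩ = record
    { _∈[_]     = λ x g → _∈[_] G x (g ∙ monomial generator s ⁻¹)
    ; ∈-resp    = λ x≈y g≈h → ∈-resp G x≈y (∙ᵍ-congʳ g≈h)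
    ; 0-closed  = 0-closed G
    ; +-closed  = +-closed G
    ; *ₗ-closed = λ r → *ₗ-closed G r
    }

  -- The degree of a tensor of homogeneous vectors is the product of their
  -- degrees over a list of representatives of the classes of I.
  module _ {i ℓi} (I : Setoid i ℓi) (reps : List (Setoid.Carrier I))
           {m ℓm p} {V : Module R m ℓm} (G : Components V p) where

    open Func

    HomogeneousTensor : Term (Tuple I V) → ∣𝒢∣ → Set (c ⊔ i ⊔ ℓi ⊔ a ⊔ ℓa ⊔ m ⊔ ℓm ⊔ p)
    HomogeneousTensor t g = ∃ λ f → ∃ λ (d : Func I 𝒢-setoid) →
      t ≡ gen f × (∀ k → _∈[_] G (to f k) (to d k)) ×
      g ≈ᵍ foldr (λ k h → to d k ∙ h) 1ᵍ reps

    ⨂-components : Components (⨂ I V) _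
    ⨂-components = spanned (⨂ I V) HomogeneousTensor

  module _ {i m ℓm p} {I : Set i} {M : I → Module R m ℓm} (G : ∀ k → Components (M k) p) where

    HomogeneousSummand : Module.Carrierᴹ (⨁ M) → ∣𝒢∣ → Set (c ⊔ i ⊔ m ⊔ p)
    HomogeneousSummand t g = ∃ λ k → ∃ λ x → t ≡ gen (k , x) × _∈[_] (G k) x g

    ⨁-components : Components (⨁ M) _
    ⨁-components = spanned (⨁ M) HomogeneousSummand

record Multigraph : Set where
  field
    order size : ℕ
    -- The two ends of an edge; their labelling by Bool carries no meaning.
    end        : Fin size → Bool → Fin order

  Vertex Edge HalfEdge : Set
  Vertex   = Fin order
  Edge     = Fin size
  HalfEdge = Edge × Bool

  vertex : HalfEdge → Vertex
  vertex (e , b) = end e b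

  opposite : HalfEdge → HalfEdge
  opposite (e , b) = e , not b

  _≟ʰ_ : DecidableEquality HalfEdge
  _≟ʰ_ = ≡-dec Fin._≟_ Bool._≟_

  Incident : Vertex → Edge → Set
  Incident v e = ∃ λ b → end e b ≡ v

  Adjacent : Rel Vertex Level.zero
  Adjacent u v = ∃ λ h → vertex h ≡ u × vertex (opposite h) ≡ v

  Connected : Set
  Connected = ∀ u v → Star Adjacent u v

  degree : Vertex → ℕ
  degree v = length (filter (λ h → vertex h Fin.≟ v)
                            (cartesianProduct (allFin size) (true ∷ false ∷ [])))

record RibbonGraph : Set where
  field
    graph     : Multigraph

  open Multigraph graph public

  field
    connected : Connected
    nonempty  : NonZero size

    -- The next half-edge counterclockwise around the same vertex.
    next        : HalfEdge → HalfEdge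
    next-vertex : ∀ h → vertex (next h) ≡ vertex h
    next-cyclic : ∀ h h′ → vertex h ≡ vertex h′ → Star (λ x y → next x ≡ y) h h′

record PerfectMatching (G : Multigraph) : Set where
  open Multigraph G
  field
    ∣M∣            : ℕ
    edge           : Fin ∣M∣ → Edge
    edge-injective : Injective _≡_ _≡_ edge
    distinct-ends  : ∀ i → end (edge i) true ≢ end (edge i) false
    perfect        : ∀ v → ∃! _≡_ λ i → Incident v (edge i)

record PerfectMatchingGraph : Set where
  field
    ribbonGraph     : RibbonGraph
    perfectMatching : PerfectMatching (RibbonGraph.graph ribbonGraph)

  open RibbonGraph ribbonGraph public
  open PerfectMatching perfectMatching public

  Trivalent : Set
  Trivalent = ∀ v → degree v ≡ 3

module EqClosureDecidable {ℓa} {A : Set ℓa} (_≟_ : DecidableEquality A)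
                          (elements : List A) (complete : ∀ x → x ∈ elements) where

  private
    Pairs : List (A × A) → Rel A ℓa
    Pairs ps x y = (x , y) ∈ ps

    Extend : (a b : A) → Rel A ℓa → Rel A ℓa
    Extend a b _∼_ x y = x ∼ y ⊎ ((x ∼ a × b ∼ y) ⊎ (x ∼ b × a ∼ y))

    extend-sound : ∀ {a b ps x y} → Extend a b (EqClosure (Pairs ps)) x y →
                   EqClosure (Pairs ((a , b) ∷ ps)) x y
    extend-sound {a} {b} {ps} = λ where
        (inj₁ p)              → weaken p
        (inj₂ (inj₁ (p , q))) → weaken p ◅◅ fwd (here refl) ◅ weaken q
        (inj₂ (inj₂ (p , q))) → weaken p ◅◅ bwd (here refl) ◅ weaken q
      where
      weaken : ∀ {x y} → EqClosure (Pairs ps) x y → EqClosure (Pairs ((a , b) ∷ ps)) x y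
      weaken = EqC.map there

    extend-complete : ∀ {a b ps x y} → EqClosure (Pairs ((a , b) ∷ ps)) x y →
                      Extend a b (EqClosure (Pairs ps)) x y
    extend-complete {a} {b} {ps} = λ where
        ε       → inj₁ ε
        (s ◅ p) → step s (extend-complete p)
      where
      _∼_ = EqClosure (Pairs ps)
      symᴱ = EqC.symmetric (Pairs ps)

      viaAB : ∀ {y} → Extend a b _∼_ b y → Extend a b _∼_ a y
      viaAB (inj₁ p)              = inj₂ (inj₁ (ε , p))
      viaAB (inj₂ (inj₁ (p , q))) = inj₂ (inj₁ (ε , q))
      viaAB (inj₂ (inj₂ (p , q))) = inj₁ q

      viaBA : ∀ {y} → Extend a b _∼_ a y → Extend a b _∼_ b y
      viaBA (inj₁ p)              = inj₂ (inj₂ (ε , p))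
      viaBA (inj₂ (inj₁ (p , q))) = inj₁ q
      viaBA (inj₂ (inj₂ (p , q))) = inj₂ (inj₂ (ε , q))

      prepend : ∀ {x y z} → x ∼ y → Extend a b _∼_ y z → Extend a b _∼_ x z
      prepend r (inj₁ p)              = inj₁ (r ◅◅ p)
      prepend r (inj₂ (inj₁ (p , q))) = inj₂ (inj₁ (r ◅◅ p , q))
      prepend r (inj₂ (inj₂ (p , q))) = inj₂ (inj₂ (r ◅◅ p , q))

      step : ∀ {x y z} → SymClosure (Pairs ((a , b) ∷ ps)) x y →
             Extend a b _∼_ y z → Extend a b _∼_ x z
      step (fwd (here refl)) = viaAB
      step (bwd (here refl)) = viaBA
      step (fwd (there p))   = prepend (fwd p ◅ ε)
      step (bwd (there p))   = prepend (bwd p ◅ ε)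

    pairs-decidable : ∀ ps → Decidable (EqClosure (Pairs ps))
    pairs-decidable []             x y = map′ (λ { refl → ε }) only-refl (x ≟ y)
      where
      only-refl : ∀ {x y} → EqClosure (Pairs []) x y → x ≡ y
      only-refl ε            = refl
      only-refl (fwd () ◅ _)
      only-refl (bwd () ◅ _)
    pairs-decidable ((a , b) ∷ ps) x y =
      map′ extend-sound extend-complete
        (x ∼? y ⊎-dec ((x ∼? a ×-dec b ∼? y) ⊎-dec (x ∼? b ×-dec a ∼? y)))
      where _∼?_ = pairs-decidable ps

  eqClosure? : ∀ {r} {_∼_ : Rel A r} → Decidable _∼_ → Decidable (EqClosure _∼_)
  eqClosure? {_∼_ = _∼_} ∼? x y =
    map′ (EqC.map (proj₂ ∘ ∈-filter⁻ related? {xs = cartesianProduct elements elements})) (EqC.map listed) (pairs-decidable pairs x y)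
    where
    related? = λ (p : A × A) → ∼? (proj₁ p) (proj₂ p)
    pairs = filter related? (cartesianProduct elements elements)
    listed : ∀ {x y} → x ∼ y → (x , y) ∈ pairs
    listed r = ∈-filter⁺ related? (∈-cartesianProduct⁺ (complete _) (complete _)) r

-- The half-edges other than e at its two vertices, with e drawn vertically.
data Corner : Set where
  ↖ ↗ ↙ ↘ : Corner

-- Smoothing b c c′: the b-smoothing joins the corners c and c′.
data Smoothing : Bool → Corner → Corner → Set where
  0-left  : Smoothing false ↖ ↙
  0-right : Smoothing false ↗ ↘
  1-left  : Smoothing true ↖ ↘
  1-right : Smoothing true ↗ ↙

State : ℕ → Set
State = Vec Bool

corners : List Corner
corners = ↖ ∷ ↗ ∷ ↙ ∷ ↘ ∷ []

∈-corners : ∀ c → c ∈ corners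
∈-corners ↖ = here refl
∈-corners ↗ = there (here refl)
∈-corners ↙ = there (there (here refl))
∈-corners ↘ = there (there (there (here refl)))

_≟ᶜ_ : DecidableEquality Corner
↖ ≟ᶜ ↖ = yes refl
↖ ≟ᶜ ↗ = no λ ()
↖ ≟ᶜ ↙ = no λ ()
↖ ≟ᶜ ↘ = no λ ()
↗ ≟ᶜ ↖ = no λ ()
↗ ≟ᶜ ↗ = yes refl
↗ ≟ᶜ ↙ = no λ ()
↗ ≟ᶜ ↘ = no λ ()
↙ ≟ᶜ ↖ = no λ ()
↙ ≟ᶜ ↗ = no λ ()
↙ ≟ᶜ ↙ = yes refl
↙ ≟ᶜ ↘ = no λ ()
↘ ≟ᶜ ↖ = no λ ()
↘ ≟ᶜ ↗ = no λ ()
↘ ≟ᶜ ↙ = no λ ()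
↘ ≟ᶜ ↘ = yes refl

smoothing? : ∀ b c c′ → Dec (Smoothing b c c′)
smoothing? false ↖ ↖ = no λ ()
smoothing? false ↖ ↗ = no λ ()
smoothing? false ↖ ↙ = yes 0-left
smoothing? false ↖ ↘ = no λ ()
smoothing? false ↗ ↖ = no λ ()
smoothing? false ↗ ↗ = no λ ()
smoothing? false ↗ ↙ = no λ ()
smoothing? false ↗ ↘ = yes 0-right
smoothing? true  ↖ ↖ = no λ ()
smoothing? true  ↖ ↗ = no λ ()
smoothing? true  ↖ ↙ = no λ ()
smoothing? true  ↖ ↘ = yes 1-left
smoothing? true  ↗ ↖ = no λ ()
smoothing? true  ↗ ↗ = no λ ()
smoothing? true  ↗ ↙ = yes 1-right
smoothing? true  ↗ ↘ = no λ ()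
smoothing? _     ↙ _ = no λ ()
smoothing? _     ↘ _ = no λ ()

module States (Γ : PerfectMatchingGraph) where

  open PerfectMatchingGraph Γ

  -- In a trivalent graph every half-edge outside the matching is a corner of
  -- exactly one matching edge.
  End : Set
  End = Fin ∣M∣ × Corner

  _≟ᴱ_ : DecidableEquality End
  _≟ᴱ_ = ≡-dec Fin._≟_ _≟ᶜ_

  ends : List End
  ends = cartesianProduct (allFin ∣M∣) corners

  ∈-ends : ∀ x → x ∈ ends
  ∈-ends (i , c) = ∈-cartesianProduct⁺ (∈-allFin i) (∈-corners c)

  top bottom : Fin ∣M∣ → HalfEdge
  top    i = edge i , true
  bottom i = edge i , false

  -- Counterclockwise from the matching edge, one meets ↗ before ↖ at the top
  -- vertex and ↙ before ↘ at the bottom vertex.  Exchanging top and bottom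
  -- rotates the picture by a half-turn, which preserves both smoothings.
  halfEdge : End → HalfEdge
  halfEdge (i , ↗) = next (top i)
  halfEdge (i , ↖) = next (next (top i))
  halfEdge (i , ↙) = next (bottom i)
  halfEdge (i , ↘) = next (next (bottom i))

  data Join (α : State ∣M∣) : Rel End Level.zero where
    along   : ∀ {x y} → halfEdge x ≡ opposite (halfEdge y) → Join α x y
    through : ∀ i {c c′} → Smoothing (lookup α i) c c′ → Join α (i , c) (i , c′)

  join? : ∀ α → Decidable (Join α)
  join? α x@(i , c) y@(j , c′) with halfEdge x ≟ʰ opposite (halfEdge y)
  ... | yes e = yes (along e)
  ... | no ¬e with i Fin.≟ j
  ...   | no i≢j   = no λ { (along e) → ¬e e ; (through _ _) → i≢j refl }
  ...   | yes refl with smoothing? (lookup α i) c c′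
  ...     | yes s = yes (through i s)
  ...     | no ¬s = no λ { (along e) → ¬e e ; (through _ s) → ¬s s }

  -- The elements of this setoid are the circles of the state Γ_α.
  Circles : State ∣M∣ → Setoid Level.zero Level.zero
  Circles α = EqC.setoid (Join α)

  _⊢_≈_ : State ∣M∣ → Rel End Level.zero
  α ⊢ x ≈ y = EqClosure (Join α) x y

  ≈? : ∀ α → Decidable (α ⊢_≈_)
  ≈? α = EqClosureDecidable.eqClosure? _≟ᴱ_ ends ∈-ends (join? α)

  -- One end on each circle; the length of this list is k_α.
  circles : State ∣M∣ → List End
  circles α = deduplicate (≈? α) ends

  AgreeOff : Fin ∣M∣ → Rel (State ∣M∣) Level.zero
  AgreeOff j α α′ = ∀ i → i ≢ j → lookup α i ≡ lookup α′ i

  agree-sym : ∀ {j} α α′ → AgreeOff j α α′ → AgreeOff j α′ α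
  agree-sym _ _ agree i i≢j = sym (agree i i≢j)

  -- Each of the two strands at the j-th matching edge contains exactly one of
  -- the corners ↖ and ↗, whichever smoothing is applied.
  Touches : State ∣M∣ → Fin ∣M∣ → End → Set
  Touches α j x = α ⊢ x ≈ (j , ↖) ⊎ α ⊢ x ≈ (j , ↗)

  touches-resp : ∀ {α j x y} → α ⊢ x ≈ y → Touches α j y → Touches α j x
  touches-resp x≈y = [ inj₁ ∘ (x≈y ◅◅_) , inj₂ ∘ (x≈y ◅◅_) ]

  touches-corner : ∀ α j c → Touches α j (j , c)
  touches-corner α j ↖ = inj₁ ε
  touches-corner α j ↗ = inj₂ ε
  touches-corner α j ↙ with lookup α j in eq
  ... | false = inj₁ (bwd (through j (subst (λ b → Smoothing b ↖ ↙) (sym eq) 0-left)) ◅ ε)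
  ... | true  = inj₂ (bwd (through j (subst (λ b → Smoothing b ↗ ↙) (sym eq) 1-right)) ◅ ε)
  touches-corner α j ↘ with lookup α j in eq
  ... | false = inj₂ (bwd (through j (subst (λ b → Smoothing b ↗ ↘) (sym eq) 0-right)) ◅ ε)
  ... | true  = inj₁ (bwd (through j (subst (λ b → Smoothing b ↖ ↘) (sym eq) 1-left)) ◅ ε)

  transfer-join : ∀ {j α α′ x y} → AgreeOff j α α′ → SymClosure (Join α) x y →
                  Touches α′ j x ⊎ SymClosure (Join α′) x y
  transfer-join agree (fwd (along e)) = inj₂ (fwd (along e))
  transfer-join agree (bwd (along e)) = inj₂ (bwd (along e))
  transfer-join {j} {α′ = α′} agree (fwd (through i {c} s)) with i Fin.≟ j
  ... | yes refl = inj₁ (touches-corner α′ j c)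
  ... | no i≢j   = inj₂ (fwd (through i (subst (λ b → Smoothing b c _) (agree i i≢j) s)))
  transfer-join {j} {α′ = α′} agree (bwd (through i {_} {c} s)) with i Fin.≟ j
  ... | yes refl = inj₁ (touches-corner α′ j c)
  ... | no i≢j   = inj₂ (bwd (through i (subst (λ b → Smoothing b _ c) (agree i i≢j) s)))

  transfer-touches : ∀ {j α α′ x} → AgreeOff j α α′ → Touches α j x → Touches α′ j x
  transfer-touches {j} {α} {α′} agree =
    [ (λ p → go p (inj₁ ε)) , (λ p → go p (inj₂ ε)) ]
    where
    go : ∀ {x y} → α ⊢ x ≈ y → Touches α′ j y → Touches α′ j x
    go ε       t = t
    go (s ◅ p) t with transfer-join agree s
    ... | inj₁ t′ = t′
    ... | inj₂ s′ = touches-resp (s′ ◅ ε) (go p t)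

  transfer-≈ : ∀ {j α α′ x y} → AgreeOff j α α′ → ¬ Touches α′ j x → α ⊢ x ≈ y → α′ ⊢ x ≈ y
  transfer-≈ agree ¬t ε       = ε
  transfer-≈ {α′ = α′} agree ¬t (s ◅ p) with transfer-join agree s
  ... | inj₁ t  = ⊥-elim (¬t t)
  ... | inj₂ s′ = s′ ◅ transfer-≈ agree
                    (¬t ∘ touches-resp (s′ ◅ ε)) p

module Cube {c ℓ v ℓv} (R : CommutativeRing c ℓ) (𝓕 : MTQFT R v ℓv) (Γ : PerfectMatchingGraph) where

  open CommutativeRing R using (semiring; 1#; -_) renaming (refl to ≈-refl)
  open Exp semiring using (_^_)
  open LinearAlgebra R
  open LinearMap
  open MTQFT 𝓕 using (V; μⱽ; Δⱽ; mⱽ)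
  open PerfectMatchingGraph Γ
  open States Γ
  open Func

  private
    module V = Module V
    module V⊗V = Module (V ⊗ V)

  TupleOn : State ∣M∣ → Set (v ⊔ ℓv)
  TupleOn α = Tuple (Circles α) V

  -- V^⊗k_α with tensor factors indexed by the circles of Γ_α.
  V^ : State ∣M∣ → Module R (c ⊔ v ⊔ ℓv) (c ⊔ ℓ ⊔ v ⊔ ℓv)
  V^ α = ⨂ (Circles α) V

  module _ {j : Fin ∣M∣} {α α′ : State ∣M∣} (agree : AgreeOff j α α′) where

    module W = Module (V^ α′)

    pick : ∀ {p q} {P : Set p} {Q : Set q} → Dec P → Dec Q → (x y z : V.Carrierᴹ) → V.Carrierᴹ
    pick (yes _) _       x y z = x
    pick (no _)  (yes _) x y z = y
    pick (no _)  (no _)  x y z = z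

    untouched : ∀ {x y} → ¬ Touches α′ j x → α′ ⊢ x ≈ y → α ⊢ x ≈ y
    untouched ¬t = transfer-≈ (agree-sym α α′ agree) (¬t ∘ transfer-touches agree)

    -- Put a on the circle through ↖, put b on the circle through ↗ if that is
    -- another circle, and leave the vectors on the remaining circles unchanged.
    place : V.Carrierᴹ → V.Carrierᴹ → TupleOn α → TupleOn α′
    to (place a b f) x = pick (≈? α′ x (j , ↖)) (≈? α′ x (j , ↗)) a b (to f x)
    cong (place a b f) {x} {y} x≈y
      with ≈? α′ x (j , ↖) | ≈? α′ y (j , ↖) | ≈? α′ x (j , ↗) | ≈? α′ y (j , ↗)
    ... | yes _ | yes _ | _     | _     = V.≈ᴹ-refl
    ... | yes p | no ¬p | _     | _     = ⊥-elim (¬p (EqC.symmetric _ x≈y ◅◅ p))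
    ... | no ¬p | yes p | _     | _     = ⊥-elim (¬p (x≈y ◅◅ p))
    ... | no _  | no _  | yes _ | yes _ = V.≈ᴹ-refl
    ... | no _  | no _  | yes q | no ¬q = ⊥-elim (¬q (EqC.symmetric _ x≈y ◅◅ q))
    ... | no _  | no _  | no ¬q | yes q = ⊥-elim (¬q (x≈y ◅◅ q))
    ... | no ¬p | no _  | no ¬q | no _  = cong f (untouched [ ¬p , ¬q ] x≈y)

    place-↖ : ∀ a b f {x} → α′ ⊢ x ≈ (j , ↖) → to (place a b f) x V.≈ᴹ a
    place-↖ a b f {x} p with ≈? α′ x (j , ↖)
    ... | yes _ = V.≈ᴹ-refl
    ... | no ¬p = ⊥-elim (¬p p)

    place-↗ : ∀ a b f {x} → ¬ α′ ⊢ x ≈ (j , ↖) → α′ ⊢ x ≈ (j , ↗) → to (place a b f) x V.≈ᴹ b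
    place-↗ a b f {x} ¬p q with ≈? α′ x (j , ↖) | ≈? α′ x (j , ↗)
    ... | yes p | _     = ⊥-elim (¬p p)
    ... | no _  | yes _ = V.≈ᴹ-refl
    ... | no _  | no ¬q = ⊥-elim (¬q q)

    place-off : ∀ a b f {x} → ¬ Touches α′ j x → to (place a b f) x V.≈ᴹ to f x
    place-off a b f {x} ¬t with ≈? α′ x (j , ↖) | ≈? α′ x (j , ↗)
    ... | yes p | _     = ⊥-elim (¬t (inj₁ p))
    ... | no _  | yes q = ⊥-elim (¬t (inj₂ q))
    ... | no _  | no _  = V.≈ᴹ-refl

    place-≈ : ∀ {a a′ b b′} f f′ x →
              (α′ ⊢ x ≈ (j , ↖) → a V.≈ᴹ a′) →
              (¬ α′ ⊢ x ≈ (j , ↖) → α′ ⊢ x ≈ (j , ↗) → b V.≈ᴹ b′) →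
              (¬ Touches α′ j x → to f x V.≈ᴹ to f′ x) →
              to (place a b f) x V.≈ᴹ to (place a′ b′ f′) x
    place-≈ f f′ x on-↖ on-↗ off with ≈? α′ x (j , ↖) | ≈? α′ x (j , ↗)
    ... | yes p | _     = on-↖ p
    ... | no ¬p | yes q = on-↗ ¬p q
    ... | no ¬p | no ¬q = off [ ¬p , ¬q ]

    touches? : ∀ x → Dec (Touches α j x)
    touches? x = ≈? α x (j , ↖) ⊎-dec ≈? α x (j , ↗)

    away : ∀ {k f h} → Touches α j k → SameOff (Circles α) V k h f →
           ∀ x → ¬ Touches α′ j x → to h x V.≈ᴹ to f x
    away t same x ¬t =
      same x (λ x≈k → ¬t (transfer-touches agree (touches-resp x≈k t)))

    elsewhere : ∀ {k f h} → SameOff (Circles α) V k h f →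
                ∀ x → ¬ α′ ⊢ x ≈ k → ¬ Touches α′ j x → to h x V.≈ᴹ to f x
    elsewhere same x x≉k ¬t = same x (x≉k ∘ transfer-≈ agree ¬t)

    missing : ∀ {k f h} c → ¬ Touches α j k → SameOff (Circles α) V k h f →
              to h (j , c) V.≈ᴹ to f (j , c)
    missing c ¬t same =
      same (j , c) (λ c≈k → ¬t (touches-resp (EqC.symmetric _ c≈k) (touches-corner α j c)))

    -- The map which puts w f on a single new circle.
    module _ (joined : α′ ⊢ (j , ↖) ≈ (j , ↗))
             (w : TupleOn α → V.Carrierᴹ)
             (w-cong : ∀ f g → to f (j , ↖) V.≈ᴹ to g (j , ↖) →
                       to f (j , ↗) V.≈ᴹ to g (j , ↗) → w f V.≈ᴹ w g)
             (w-+ : ∀ k f g h → Touches α j k →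
                    SameOff (Circles α) V k h f → SameOff (Circles α) V k h g →
                    to h k V.≈ᴹ to f k V.+ᴹ to g k → w h V.≈ᴹ w f V.+ᴹ w g)
             (w-· : ∀ k r f h → Touches α j k → SameOff (Circles α) V k h f →
                    to h k V.≈ᴹ r V.*ₗ to f k → w h V.≈ᴹ r V.*ₗ w f)
             where

      put : TupleOn α → TupleOn α′
      put f = place (w f) (w f) f

      put-touching : ∀ {k f h} → Touches α j k → SameOff (Circles α) V k h f →
                     SameOff (Circles α′) V (j , ↖) (put h) (put f)
      put-touching {f = f} {h} t same x x≉↖ = place-≈ h f x
        (λ p → ⊥-elim (x≉↖ p))
        (λ _ q → ⊥-elim (x≉↖ (q ◅◅ EqC.symmetric _ joined)))
        (away {f = f} {h} t same x)

      put-missing : ∀ {k f h} → ¬ Touches α j k → SameOff (Circles α) V k h f →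
                    SameOff (Circles α′) V k (put h) (put f)
      put-missing {f = f} {h} ¬t same x x≉k = place-≈ h f x (λ _ → w≈) (λ _ _ → w≈)
        (elsewhere {f = f} {h} same x x≉k)
        where w≈ = w-cong h f (missing {f = f} {h} ↖ ¬t same) (missing {f = f} {h} ↗ ¬t same)

      put-↖ : ∀ f → to (put f) (j , ↖) V.≈ᴹ w f
      put-↖ f = place-↖ (w f) (w f) f ε

      at-missing : ∀ {k} → ¬ Touches α j k → ∀ f → to (put f) k V.≈ᴹ to f k
      at-missing ¬t f = place-off (w f) (w f) f (¬t ∘ transfer-touches (agree-sym α α′ agree))

      putOne : LinearMap (V^ α) (V^ α′)
      putOne = lift (V^ α′) (gen ∘ put) respects
        where
        respects : ∀ {s t} → Multilinear (Circles α) V s t →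
                   evaluate (V^ α′) (gen ∘ put) s W.≈ᴹ evaluate (V^ α′) (gen ∘ put) t
        respects (⨂-cong {f} {g} f≈g) = relation (⨂-cong λ x →
          place-≈ f g x (λ _ → w≈) (λ _ _ → w≈) (λ _ → f≈g x))
          where w≈ = w-cong f g (f≈g (j , ↖)) (f≈g (j , ↗))
        respects (⨂-+ k {f} {g} {h} hf hg h≈) with touches? k
        ... | yes t = relation (⨂-+ (j , ↖)
                (put-touching {f = f} {h} t hf) (put-touching {f = g} {h} t hg)
                (V.≈ᴹ-trans (put-↖ h) (V.≈ᴹ-trans (w-+ k f g h t hf hg h≈)
                  (V.≈ᴹ-sym (V.+ᴹ-cong (put-↖ f) (put-↖ g))))))
        ... | no ¬t = relation (⨂-+ k
                (put-missing {f = f} {h} ¬t hf) (put-missing {f = g} {h} ¬t hg)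
                (V.≈ᴹ-trans (at-missing ¬t h) (V.≈ᴹ-trans h≈
                  (V.≈ᴹ-sym (V.+ᴹ-cong (at-missing ¬t f) (at-missing ¬t g))))))
        respects (⨂-· k r {f} {h} hf h≈) with touches? k
        ... | yes t = relation (⨂-· (j , ↖) r (put-touching {f = f} {h} t hf)
                (V.≈ᴹ-trans (put-↖ h) (V.≈ᴹ-trans (w-· k r f h t hf h≈)
                  (V.≈ᴹ-sym (V.*ₗ-cong ≈-refl (put-↖ f))))))
        ... | no ¬t = relation (⨂-· k r (put-missing {f = f} {h} ¬t hf)
                (V.≈ᴹ-trans (at-missing ¬t h) (V.≈ᴹ-trans h≈
                  (V.≈ᴹ-sym (V.*ₗ-cong ≈-refl (at-missing ¬t f))))))

    mergeMap : ¬ α ⊢ (j , ↖) ≈ (j , ↗) → α′ ⊢ (j , ↖) ≈ (j , ↗) → LinearMap (V^ α) (V^ α′)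
    mergeMap apart joined = putOne joined w
      (λ f g p q → ⟦⟧-cong μⱽ (relation (⊗-cong p q))) w-+ w-·
      where
      w : TupleOn α → V.Carrierᴹ
      w f = ⟦ μⱽ ⟧ (to f (j , ↖) ⊗ₑ to f (j , ↗))
      w-+ : ∀ k f g h → Touches α j k →
            SameOff (Circles α) V k h f → SameOff (Circles α) V k h g →
            to h k V.≈ᴹ to f k V.+ᴹ to g k → w h V.≈ᴹ w f V.+ᴹ w g
      w-+ k f g h (inj₁ p) hf hg h≈ = V.≈ᴹ-trans
        (⟦⟧-cong μⱽ (V⊗V.≈ᴹ-trans
          (relation (⊗-cong (V.≈ᴹ-trans (cong h p⁻¹) (V.≈ᴹ-trans h≈ (V.+ᴹ-cong (cong f p) (cong g p)))) V.≈ᴹ-refl))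
          (V⊗V.≈ᴹ-trans (relation (+ˡ _ _ _))
            (V⊗V.+ᴹ-cong (relation (⊗-cong V.≈ᴹ-refl (hf _ ↗≉k)))
                         (relation (⊗-cong V.≈ᴹ-refl (hg _ ↗≉k)))))))
        (+ᴹ-homo μⱽ _ _)
        where
        p⁻¹ = EqC.symmetric _ p
        ↗≉k : ¬ α ⊢ (j , ↗) ≈ k
        ↗≉k q = apart (EqC.symmetric _ (q ◅◅ p))
      w-+ k f g h (inj₂ p) hf hg h≈ = V.≈ᴹ-trans
        (⟦⟧-cong μⱽ (V⊗V.≈ᴹ-trans
          (relation (⊗-cong V.≈ᴹ-refl (V.≈ᴹ-trans (cong h p⁻¹) (V.≈ᴹ-trans h≈ (V.+ᴹ-cong (cong f p) (cong g p))))))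
          (V⊗V.≈ᴹ-trans (relation (+ʳ _ _ _))
            (V⊗V.+ᴹ-cong (relation (⊗-cong (hf _ ↖≉k) V.≈ᴹ-refl))
                         (relation (⊗-cong (hg _ ↖≉k) V.≈ᴹ-refl))))))
        (+ᴹ-homo μⱽ _ _)
        where
        p⁻¹ = EqC.symmetric _ p
        ↖≉k : ¬ α ⊢ (j , ↖) ≈ k
        ↖≉k q = apart (q ◅◅ p)
      w-· : ∀ k r f h → Touches α j k → SameOff (Circles α) V k h f →
            to h k V.≈ᴹ r V.*ₗ to f k → w h V.≈ᴹ r V.*ₗ w f
      w-· k r f h (inj₁ p) hf h≈ = V.≈ᴹ-trans
        (⟦⟧-cong μⱽ (V⊗V.≈ᴹ-trans
          (relation (⊗-cong (V.≈ᴹ-trans (cong h (EqC.symmetric _ p))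
                              (V.≈ᴹ-trans h≈ (V.*ₗ-cong ≈-refl (cong f p))))
                            (hf _ (λ q → apart (EqC.symmetric _ (q ◅◅ p))))))
          (relation (·ˡ _ _ _))))
        (*ₗ-homo μⱽ _ _)
      w-· k r f h (inj₂ p) hf h≈ = V.≈ᴹ-trans
        (⟦⟧-cong μⱽ (V⊗V.≈ᴹ-trans
          (relation (⊗-cong (hf _ (λ q → apart (q ◅◅ p)))
                            (V.≈ᴹ-trans (cong h (EqC.symmetric _ p))
                              (V.≈ᴹ-trans h≈ (V.*ₗ-cong ≈-refl (cong f p))))))
          (relation (·ʳ _ _ _))))
        (*ₗ-homo μⱽ _ _)

    to-↖ : α ⊢ (j , ↖) ≈ (j , ↗) → ∀ {k} → Touches α j k → α ⊢ k ≈ (j , ↖)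
    to-↖ joined = [ id , _◅◅ EqC.symmetric _ joined ]

    at-↖-+ : ∀ {k} (f g h : TupleOn α) → α ⊢ k ≈ (j , ↖) → to h k V.≈ᴹ to f k V.+ᴹ to g k →
             to h (j , ↖) V.≈ᴹ to f (j , ↖) V.+ᴹ to g (j , ↖)
    at-↖-+ f g h p h≈ = V.≈ᴹ-trans (cong h (EqC.symmetric _ p))
      (V.≈ᴹ-trans h≈ (V.+ᴹ-cong (cong f p) (cong g p)))

    at-↖-· : ∀ {k} r (f h : TupleOn α) → α ⊢ k ≈ (j , ↖) → to h k V.≈ᴹ r V.*ₗ to f k →
             to h (j , ↖) V.≈ᴹ r V.*ₗ to f (j , ↖)
    at-↖-· r f h p h≈ = V.≈ᴹ-trans (cong h (EqC.symmetric _ p))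
      (V.≈ᴹ-trans h≈ (V.*ₗ-cong ≈-refl (cong f p)))

    oneToOneMap : α ⊢ (j , ↖) ≈ (j , ↗) → α′ ⊢ (j , ↖) ≈ (j , ↗) → LinearMap (V^ α) (V^ α′)
    oneToOneMap before after = putOne after (λ f → ⟦ mⱽ ⟧ (to f (j , ↖)))
      (λ f g p _ → ⟦⟧-cong mⱽ p)
      (λ k f g h t _ _ h≈ → V.≈ᴹ-trans (⟦⟧-cong mⱽ (at-↖-+ f g h (to-↖ before t) h≈)) (+ᴹ-homo mⱽ _ _))
      (λ k r f h t _ h≈ → V.≈ᴹ-trans (⟦⟧-cong mⱽ (at-↖-· r f h (to-↖ before t) h≈)) (*ₗ-homo mⱽ _ _))

    module _ (apart : ¬ α′ ⊢ (j , ↖) ≈ (j , ↗)) where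

      ↗≉↖ : ∀ {x} → α′ ⊢ x ≈ (j , ↗) → ¬ α′ ⊢ x ≈ (j , ↖)
      ↗≉↖ q p = apart (EqC.symmetric _ p ◅◅ q)

      -- a ⊗ b goes to the tensor with a on the circle through ↖, b on the
      -- circle through ↗ and the vectors of f on the remaining circles.
      insert : TupleOn α → LinearMap (V ⊗ V) (V^ α′)
      insert f = lift (V^ α′) (λ (a , b) → gen (place a b f)) respects
        where
        off-↖ : ∀ {a a′ b} → SameOff (Circles α′) V (j , ↖) (place a b f) (place a′ b f)
        off-↖ x x≉↖ = place-≈ f f x (λ p → ⊥-elim (x≉↖ p)) (λ _ _ → V.≈ᴹ-refl) (λ _ → V.≈ᴹ-refl)

        off-↗ : ∀ {a b b′} → SameOff (Circles α′) V (j , ↗) (place a b f) (place a b′ f)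
        off-↗ x x≉↗ = place-≈ f f x (λ _ → V.≈ᴹ-refl) (λ _ q → ⊥-elim (x≉↗ q)) (λ _ → V.≈ᴹ-refl)

        at-↖ : ∀ a b → to (place a b f) (j , ↖) V.≈ᴹ a
        at-↖ a b = place-↖ a b f ε

        at-↗ : ∀ a b → to (place a b f) (j , ↗) V.≈ᴹ b
        at-↗ a b = place-↗ a b f (↗≉↖ ε) ε

        respects : ∀ {s t} → Bilinear V V s t →
                   evaluate (V^ α′) (λ (a , b) → gen (place a b f)) s W.≈ᴹ
                   evaluate (V^ α′) (λ (a , b) → gen (place a b f)) t
        respects (⊗-cong p q) = relation (⨂-cong λ x →
          place-≈ f f x (λ _ → p) (λ _ _ → q) (λ _ → V.≈ᴹ-refl))
        respects (+ˡ a a′ b)  = relation (⨂-+ (j , ↖) off-↖ off-↖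
          (V.≈ᴹ-trans (at-↖ _ b) (V.≈ᴹ-sym (V.+ᴹ-cong (at-↖ a b) (at-↖ a′ b)))))
        respects (+ʳ a b b′)  = relation (⨂-+ (j , ↗) off-↗ off-↗
          (V.≈ᴹ-trans (at-↗ a _) (V.≈ᴹ-sym (V.+ᴹ-cong (at-↗ a b) (at-↗ a b′)))))
        respects (·ˡ r a b)   = relation (⨂-· (j , ↖) r off-↖
          (V.≈ᴹ-trans (at-↖ _ b) (V.≈ᴹ-sym (V.*ₗ-cong ≈-refl (at-↖ a b)))))
        respects (·ʳ r a b)   = relation (⨂-· (j , ↗) r off-↗
          (V.≈ᴹ-trans (at-↗ a _) (V.≈ᴹ-sym (V.*ₗ-cong ≈-refl (at-↗ a b)))))

      insert-cong : ∀ f g → (∀ x → ¬ Touches α′ j x → to f x V.≈ᴹ to g x) → insert f ≋ insert g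
      insert-cong f g f≈g = lift-ext (V^ α′) (insert f) (insert g) λ _ →
        relation (⨂-cong λ x → place-≈ f g x (λ _ → V.≈ᴹ-refl) (λ _ _ → V.≈ᴹ-refl) (f≈g x))

      insert-off : ∀ {k a b} f h → SameOff (Circles α) V k h f →
                   SameOff (Circles α′) V k (place a b h) (place a b f)
      insert-off f h same x x≉k = place-≈ h f x (λ _ → V.≈ᴹ-refl) (λ _ _ → V.≈ᴹ-refl)
        (elsewhere {f = f} {h} same x x≉k)

      insert-at : ∀ {k} → ¬ Touches α j k → ∀ a b f → to (place a b f) k V.≈ᴹ to f k
      insert-at ¬t a b f = place-off a b f (¬t ∘ transfer-touches (agree-sym α α′ agree))

      splitMap : α ⊢ (j , ↖) ≈ (j , ↗) → LinearMap (V^ α) (V^ α′)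
      splitMap joined = lift (V^ α′) w respects
        where
        Δ↖ : TupleOn α → V⊗V.Carrierᴹ
        Δ↖ f = ⟦ Δⱽ ⟧ (to f (j , ↖))

        w : TupleOn α → W.Carrierᴹ
        w f = ⟦ insert f ⟧ (Δ↖ f)

        Δ↖-missing : ∀ {k} f h → ¬ Touches α j k → SameOff (Circles α) V k h f → Δ↖ h V⊗V.≈ᴹ Δ↖ f
        Δ↖-missing f h ¬t hf = ⟦⟧-cong Δⱽ (missing {f = f} {h} ↖ ¬t hf)

        respects : ∀ {s t} → Multilinear (Circles α) V s t →
                   evaluate (V^ α′) w s W.≈ᴹ evaluate (V^ α′) w t
        respects (⨂-cong {f} {g} f≈g) = W.≈ᴹ-trans
          (⟦⟧-cong (insert f) (⟦⟧-cong Δⱽ (f≈g (j , ↖))))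
          (insert-cong f g (λ x _ → f≈g x) (Δ↖ g))
        respects (⨂-+ k {f} {g} {h} hf hg h≈) with touches? k
        ... | yes t = W.≈ᴹ-trans
                (⟦⟧-cong (insert h) {Δ↖ h} {Δ↖ f V⊗V.+ᴹ Δ↖ g}
                  (V⊗V.≈ᴹ-trans (⟦⟧-cong Δⱽ (at-↖-+ f g h (to-↖ joined t) h≈)) (+ᴹ-homo Δⱽ _ _)))
                (W.+ᴹ-cong (insert-cong h f (away {f = f} {h} t hf) (Δ↖ f))
                           (insert-cong h g (away {f = g} {h} t hg) (Δ↖ g)))
        ... | no ¬t = W.≈ᴹ-trans
                (lift-ext (V^ α′) (insert h) (insert f +ᴸ insert g)
                  (λ (a , b) → relation (⨂-+ k (insert-off f h hf) (insert-off g h hg)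
                    (V.≈ᴹ-trans (insert-at ¬t a b h) (V.≈ᴹ-trans h≈
                      (V.≈ᴹ-sym (V.+ᴹ-cong (insert-at ¬t a b f) (insert-at ¬t a b g)))))))
                  (Δ↖ h))
                (W.+ᴹ-cong (⟦⟧-cong (insert f) {Δ↖ h} {Δ↖ f} (Δ↖-missing f h ¬t hf))
                           (⟦⟧-cong (insert g) {Δ↖ h} {Δ↖ g} (Δ↖-missing g h ¬t hg)))
        respects (⨂-· k r {f} {h} hf h≈) with touches? k
        ... | yes t = W.≈ᴹ-trans
                (⟦⟧-cong (insert h) {Δ↖ h} {r V⊗V.*ₗ Δ↖ f}
                  (V⊗V.≈ᴹ-trans (⟦⟧-cong Δⱽ (at-↖-· r f h (to-↖ joined t) h≈)) (*ₗ-homo Δⱽ _ _)))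
                (W.*ₗ-cong ≈-refl (insert-cong h f (away {f = f} {h} t hf) (Δ↖ f)))
        ... | no ¬t = W.≈ᴹ-trans
                (lift-ext (V^ α′) (insert h) (r ·ᴸ insert f)
                  (λ (a , b) → relation (⨂-· k r (insert-off f h hf)
                    (V.≈ᴹ-trans (insert-at ¬t a b h) (V.≈ᴹ-trans h≈
                      (V.≈ᴹ-sym (V.*ₗ-cong ≈-refl (insert-at ¬t a b f)))))))
                  (Δ↖ h))
                (W.*ₗ-cong ≈-refl (⟦⟧-cong (insert f) {Δ↖ h} {Δ↖ f} (Δ↖-missing f h ¬t hf)))

    -- The circles through the matching edge number one or two according to
    -- whether ↖ and ↗ are connected.  For trivalent Γ, changing the smoothing
    -- at an edge met by two circles always joins them into one, so the last
    -- clause never applies to an edge of the cube.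
    changeMap : Dec (α ⊢ (j , ↖) ≈ (j , ↗)) → Dec (α′ ⊢ (j , ↖) ≈ (j , ↗)) →
                LinearMap (V^ α) (V^ α′)
    changeMap (no two)  (yes one) = mergeMap two one
    changeMap (yes one) (no two)  = splitMap two one
    changeMap (yes p)   (yes q)   = oneToOneMap p q
    changeMap (no _)    (no _)    = zeroᴸ

    edgeMap : LinearMap (V^ α) (V^ α′)
    edgeMap = changeMap (≈? α (j , ↖) (j , ↗)) (≈? α′ (j , ↖) (j , ↗))

  raise : State ∣M∣ → Fin ∣M∣ → State ∣M∣
  raise α j = α [ j ]≔ true

  raise-agree : ∀ α j → AgreeOff j α (raise α j)
  raise-agree α j i i≢j = sym (lookup∘updateAt′ i j i≢j α)

  onesBefore : ∀ {n} → State n → Fin n → ℕ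
  onesBefore (b ∷ α)     zero    = 0
  onesBefore (true ∷ α)  (suc j) = suc (onesBefore α j)
  onesBefore (false ∷ α) (suc j) = onesBefore α j

  ∣raise∣ : ∀ {n} (α : State n) j → lookup α j ≡ false → ∣ α [ j ]≔ true ∣ ≡ suc ∣ α ∣
  ∣raise∣ (false ∷ α) zero    refl = refl
  ∣raise∣ (true ∷ α)  (suc j) eq   = ≡.cong suc (∣raise∣ α j eq)
  ∣raise∣ (false ∷ α) (suc j) eq   = ∣raise∣ α j eq

  -- Empty unless 0 ≤ i ≤ ∣M∣, so that the direct sum over it vanishes there.
  StatesOfWeight : ℤ → Set
  StatesOfWeight i = Σ (State ∣M∣) λ α → + ∣ α ∣ ≡ i

  C : ℤ → Module R (c ⊔ v ⊔ ℓv) (c ⊔ ℓ ⊔ v ⊔ ℓv)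
  C i = ⨁ λ ((α , _) : StatesOfWeight i) → V^ α

  raise-weight : ∀ {i} ((α , _) : StatesOfWeight i) j → lookup α j ≡ false →
                 StatesOfWeight (ℤ.suc i)
  raise-weight (α , p) j eq =
    raise α j , trans (≡.cong +_ (∣raise∣ α j eq)) (≡.cong ℤ.suc p)

  component : ∀ {i} (s : StatesOfWeight i) (j : Fin ∣M∣) (b : Bool) → lookup (proj₁ s) j ≡ b →
              LinearMap (V^ (proj₁ s)) (C (ℤ.suc i))
  component s       j true  _  = zeroᴸ
  component (α , p) j false eq =
    ((- 1#) ^ onesBefore α j) ·ᴸ (inclusion _ (raise-weight (α , p) j eq) ∘ᴸ edgeMap (raise-agree α j))

  ∂ : ∀ i → LinearMap (C i) (C (ℤ.suc i))
  ∂ i = cotuple _ λ (α , p) → ∑ᴸ λ j → component (α , p) j (lookup α j) refl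

  module _ {a ℓa : Level} (𝒢 : FinGenAbelianGroup a ℓa) where

    open Graded R 𝒢

    module _ {p : Level} (G : Components V p) (s : Fin (FinGenAbelianGroup.rank 𝒢) → ℤ) where

      -- V^⊗k_α {s∣α∣}
      V-graded : ∀ α → GradedModule _ _ _
      V-graded α = record
        { module′    = V^ α
        ; components = ⨂-components (Circles α) (circles α) G ⟨ (λ i → s i ℤ.* + ∣ α ∣) ⟩
        }

      C-graded : ∀ i → GradedModule _ _ _
      C-graded i = record
        { module′    = C i
        ; components = ⨁-components λ ((α , _) : StatesOfWeight i) →
                         GradedModule.components (V-graded α)
        }

{-# OPTIONS --safe #-}

-- The sign rule makes the two ways around a face of the cube of states cancel
-- once the face commutes, so the theorem is about faces.
--
-- Let g assign a vector to every end of a strand.  Multiplying the vectors that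
-- lie on a common circle of Γ_α gives a pure tensor π α g of V^⊗k_α, and all
-- pure tensors arise in this way.  In these terms the edge map at the matching
-- edge j sends π α g to π α′ g, up to a factor on the ends u = (j, ↖) and
-- u′ = (j, ↗): nothing if two circles merge; κ = m(1) at u if one circle
-- becomes one circle; and the copairing Δ(1) = ∑ₖ bₖ ⊗ cₖ, with bₖ at u and
-- cₖ at u′, if one circle splits.
--
-- Whether ↖ and ↗ are joined at the edges i and j, in the four states of a face,
-- determines the factors along both paths.  If these differ, then in the last
-- state either i and j meet a single circle, and only the product of all
-- factors counts (∑ₖ bₖ cₖ = κ² being the hypothesis m² = μΔ); or they meet the
-- same two circles, and the two paths differ by moving a copairing from i to j.

module Submission where

open import Defs
open import Algebra.Bundles using (CommutativeMonoid; CommutativeRing)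
open import Algebra.Module.Bundles using (Module)
import Algebra.Properties.CommutativeMonoid.Sum as Sum
import Algebra.Properties.Ring as RingProperties
import Algebra.Properties.Semiring.Exp as Exp
open import Axiom.UniquenessOfIdentityProofs using (module Decidable⇒UIP)
open import Data.Bool.Base using (Bool; true; false; if_then_else_; _xor_)
import Data.Bool.Properties as Bool
open import Data.Empty using (⊥-elim)
open import Data.Fin.Base as Fin using (Fin; zero; suc)
import Data.Fin.Properties as Fin
open import Data.Integer.Base as ℤ using (ℤ)
import Data.Integer.Properties as ℤ
open import Data.List.Base
  using (List; []; _∷_; _++_; allFin; cartesianProduct; filter; foldr; head; length; map)
open import Data.List.Membership.Propositional using (_∈_)
open import Data.List.Membership.Propositional.Properties
  using (∈-allFin; ∈-cartesianProduct⁺; ∈-filter⁺; ∈-filter⁻; ∈-∃++)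
open import Data.List.Properties using (filter-≐)
open import Data.List.Relation.Binary.Permutation.Propositional as Perm
  using (_↭_; prep; swap; ↭-sym)
open import Data.List.Relation.Binary.Permutation.Propositional.Properties
  using (shift; ∈-resp-↭; ↭-length)
import Data.List.Relation.Binary.Permutation.Setoid.Properties as PermSetoid
open import Data.List.Relation.Unary.All as All using (All; []; _∷_)
open import Data.List.Relation.Unary.AllPairs using ([]; _∷_)
open import Data.List.Relation.Unary.Any using (here; there)
open import Data.List.Relation.Unary.Unique.Propositional using (Unique)
import Data.List.Relation.Unary.Unique.Propositional.Properties as Unique
open import Data.Maybe.Base using (Maybe; just)
open import Data.Maybe.Properties using (just-injective) renaming (≡-dec to Maybe-≡-dec)
open import Data.Nat.Base as ℕ using (ℕ; zero; suc; s≤s; z≤n)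
import Data.Nat.Properties as ℕ
open import Data.Product using (∃; _×_; _,_; proj₁; proj₂)
open import Data.Sum.Base using (_⊎_; inj₁; inj₂; [_,_])
open import Data.Vec.Base using (_∷_; lookup; _[_]≔_)
open import Data.Vec.Properties using (lookup∘update; lookup∘update′; []≔-commutes)
open import Function.Base using (_∘_; id)
open import Function.Bundles using (Func; mk⇔)
open import Relation.Binary.Bundles using (Setoid)
import Relation.Binary.Construct.Closure.Equivalence as EqC
open import Relation.Binary.Construct.Closure.ReflexiveTransitive using (Star; ε; _◅_; _◅◅_)
open import Relation.Binary.Construct.Closure.Symmetric using (fwd)
open import Relation.Binary.Definitions using (DecidableEquality; tri<; tri≈; tri>)
open import Relation.Binary.PropositionalEquality as ≡
  using (_≡_; _≢_; refl; sym; trans; subst)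
import Relation.Binary.Reasoning.Setoid as SetoidReasoning
open import Relation.Nullary using (Dec; yes; no; does; ¬_)
open import Relation.Nullary.Decidable using (_×-dec_; does-≡; does-⇔; dec-true; dec-false)

-- Products over lists

-- The circles of different states are classes of different equivalence relations, so vectors
-- indexed by them cannot be compared directly. The ends are the same in all states: one decoration
-- is multiplied out in each state separately, and an edge map then acts on it without mention of
-- the circles that it leaves alone. This reduces a face to eight truth values: whether ↖ and ↗ of
-- `i`, and those of `j`, are joined in each of its four states.
--
-- Two inputs have to be derived. Cocommutativity of `Δᶜ` is not among the relations; the symmetry
-- of the copairing, needed when the corners of `i` and `j` are matched crosswise, comes from the
-- counit and the commutativity of the product. And `changeMap` has a clause with value zero for two
-- circles that stay two. A parity count rules it out: in a trivalent graph every edge outside the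
-- matching joins two corners, so the ends come in pairs.

Unique-resp-↭ : ∀ {a} {A : Set a} {xs ys : List A} → xs ↭ ys → Unique xs → Unique ys
Unique-resp-↭ {A = A} = PermSetoid.Unique-resp-↭ (≡.setoid A) ∘ Perm.↭⇒↭ₛ

module ListProduct {c ℓ} (M : CommutativeMonoid c ℓ) where

  open CommutativeMonoid M renaming (refl to ≈-refl; sym to ≈-sym; trans to ≈-trans; ε to 1#)
  open import Algebra.Properties.CommutativeSemigroup commutativeSemigroup using (interchange; x∙yz≈y∙xz)

  ∏ : ∀ {a} {A : Set a} → List A → (A → Carrier) → Carrier
  ∏ xs f = foldr (λ x p → f x ∙ p) 1# xs

  ∏-++ : ∀ {a} {A : Set a} (xs ys : List A) f → ∏ (xs ++ ys) f ≈ ∏ xs f ∙ ∏ ys f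
  ∏-++ []       ys f = ≈-sym (identityˡ _)
  ∏-++ (x ∷ xs) ys f = ≈-trans (∙-congˡ (∏-++ xs ys f)) (≈-sym (assoc _ _ _))

  -- Takes a bare truth value, so that decisions of equivalent propositions give equal factors
  -- through `does-⇔`, whatever their proofs.
  when : Bool → Carrier → Carrier
  when b x = if b then x else 1#

  when-yes : ∀ {p} {P : Set p} (P? : Dec P) {x} → P → when (does P?) x ≈ x
  when-yes (yes _) p = ≈-refl
  when-yes (no ¬p) p = ⊥-elim (¬p p)

  when-no : ∀ {p} {P : Set p} (P? : Dec P) {x} → ¬ P → when (does P?) x ≈ 1#
  when-no (yes p) ¬p = ⊥-elim (¬p p)
  when-no (no _)  ¬p = ≈-refl

  when-cong : ∀ b {x y} → x ≈ y → when b x ≈ when b y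
  when-cong true  e = e
  when-cong false e = ≈-refl

  when-∙ : ∀ b x y → when b (x ∙ y) ≈ when b x ∙ when b y
  when-∙ true  x y = ≈-refl
  when-∙ false x y = ≈-sym (identityˡ 1#)

  when-ε : ∀ b → when b 1# ≈ 1#
  when-ε true  = ≈-refl
  when-ε false = ≈-refl

  -- The form in which merges and splits enter: the ends of the one circle are the disjoint union of
  -- the ends of the two, so its product is the product of theirs.
  when-⊎ : ∀ {p q s} {P : Set p} {Q : Set q} {S : Set s} (P? : Dec P) (Q? : Dec Q) (S? : Dec S) →
           (P → Q ⊎ S) → (Q → P) → (S → P) → (Q → ¬ S) → ∀ x →
           when (does P?) x ≈ when (does Q?) x ∙ when (does S?) x
  when-⊎ P? (yes q) (yes s) split from₁ from₂ disjoint x = ⊥-elim (disjoint q s)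
  when-⊎ P? (yes q) (no ¬s) split from₁ from₂ disjoint x = ≈-trans (when-yes P? (from₁ q)) (≈-sym (identityʳ x))
  when-⊎ P? (no ¬q) (yes s) split from₁ from₂ disjoint x = ≈-trans (when-yes P? (from₂ s)) (≈-sym (identityˡ x))
  when-⊎ P? (no ¬q) (no ¬s) split from₁ from₂ disjoint x = ≈-trans
    (when-no P? (λ p → [ ¬q , ¬s ] (split p))) (≈-sym (identityˡ 1#))

  when-× : ∀ {p q s} {P : Set p} {Q : Set q} {S : Set s} (P? : Dec P) (Q? : Dec Q) (S? : Dec S) →
           (P → Q → S) → (S → P × Q) → ∀ {x y} → (P → x ≈ y) →
           when (does P?) (when (does Q?) x) ≈ when (does S?) y
  when-× (yes p) (yes q) S? to-S from-S x≈y = ≈-trans (x≈y p) (≈-sym (when-yes S? (to-S p q)))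
  when-× (yes p) (no ¬q) S? to-S from-S x≈y = ≈-sym (when-no S? (¬q ∘ proj₂ ∘ from-S))
  when-× (no ¬p) Q?      S? to-S from-S x≈y = ≈-sym (when-no S? (¬p ∘ proj₁ ∘ from-S))

  module _ {a} {A : Set a} where

    ∏-cong : ∀ (xs : List A) {f g} → (∀ x → f x ≈ g x) → ∏ xs f ≈ ∏ xs g
    ∏-cong []       e = ≈-refl
    ∏-cong (x ∷ xs) e = ∙-cong (e x) (∏-cong xs e)

    ∏-∙ : ∀ (xs : List A) f g → ∏ xs (λ x → f x ∙ g x) ≈ ∏ xs f ∙ ∏ xs g
    ∏-∙ []       f g = ≈-sym (identityˡ 1#)
    ∏-∙ (x ∷ xs) f g = ≈-trans (∙-congˡ (∏-∙ xs f g)) (interchange _ _ _ _)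

    ∏-cartesianProduct : ∀ {b} {B : Set b} f (xs : List A) (ys : List B) →
                         ∏ (cartesianProduct xs ys) f ≈ ∏ xs (λ x → ∏ (map (x ,_) ys) f)
    ∏-cartesianProduct f []       ys = ≈-refl
    ∏-cartesianProduct f (x ∷ xs) ys =
      ≈-trans (∏-++ (map (x ,_) ys) _ f) (∙-congˡ (∏-cartesianProduct f xs ys))

    ∏-↭ : ∀ {xs ys : List A} f → xs ↭ ys → ∏ xs f ≈ ∏ ys f
    ∏-↭ f Perm.refl        = ≈-refl
    ∏-↭ f (prep x p)       = ∙-congˡ (∏-↭ f p)
    ∏-↭ f (swap x y p)     = ≈-trans (∙-congˡ (∙-congˡ (∏-↭ f p))) (x∙yz≈y∙xz _ _ _)
    ∏-↭ f (Perm.trans p q) = ≈-trans (∏-↭ f p) (∏-↭ f q)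

    module _ (_≟_ : DecidableEquality A) where

      ∏-absent : ∀ {xs : List A} {x v} → All (x ≢_) xs → ∏ xs (λ y → when (does (y ≟ x)) v) ≈ 1#
      ∏-absent []       = ≈-refl
      ∏-absent (x≢y ∷ p) = ≈-trans (∙-cong (when-no (_ ≟ _) (x≢y ∘ ≡.sym)) (∏-absent p)) (identityˡ 1#)

      ∏-single : ∀ {xs : List A} {x v} → Unique xs → x ∈ xs →
                 ∏ xs (λ y → when (does (y ≟ x)) v) ≈ v
      ∏-single (p ∷ _) (here refl) =
        ≈-trans (∙-cong (when-yes (_ ≟ _) refl) (∏-absent p)) (identityʳ _)
      ∏-single (p ∷ u) (there q)   =
        ≈-trans (∙-cong (when-no (_ ≟ _) (All.lookup p q)) (∏-single u q)) (identityˡ _)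

    -- A fixed-point-free involution splits the list into pairs whose factors cancel. Over `xor`,
    -- with `f` invariant under `a`, this says that an invariant set has an even number of elements.
    ∏-paired : (a : A → A) → (∀ x → a (a x) ≡ x) → (∀ x → a x ≢ x) →
               ∀ f → (∀ x → f x ∙ f (a x) ≈ 1#) →
               ∀ {xs} → Unique xs → (∀ {x} → x ∈ xs → a x ∈ xs) → ∏ xs f ≈ 1#
    ∏-paired a a-invol a-free f cancels u closed = go _ ℕ.≤-refl u closed
      where
      -- `x` and `a x` leave the list together, so the recursion is on a bound for the length and
      -- not on the list.
      go : ∀ n {xs} → length xs ℕ.≤ n → Unique xs → (∀ {x} → x ∈ xs → a x ∈ xs) → ∏ xs f ≈ 1#
      go n {[]} _ _ _ = ≈-refl
      go (suc n) {x ∷ xs} (s≤s len) u@(x∉xs ∷ _) closed with closed (here refl)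
      ... | here ax≡x = ⊥-elim (a-free x ax≡x)
      ... | there ax∈xs with ∈-∃++ ax∈xs
      ...   | ys , zs , refl = ≈-trans (∙-congˡ (∏-↭ f (shift (a x) ys zs)))
                (≈-trans (≈-sym (assoc _ _ _)) (≈-trans (∙-cong (cancels x) (go n len′ u′ closed′)) (identityˡ 1#)))
        where
        perm = shift (a x) ys zs
        len′ : length (ys ++ zs) ℕ.≤ n
        len′ = ℕ.≤-trans (ℕ.n≤1+n _) (ℕ.≤-trans (ℕ.≤-reflexive (≡.sym (↭-length perm))) len)
        uu : Unique (x ∷ a x ∷ ys ++ zs)
        uu = Unique-resp-↭ (prep x perm) u
        u′ : Unique (ys ++ zs)
        u′ with uu
        ... | _ ∷ _ ∷ q = q
        x∉ : ∀ {y} → y ∈ ys ++ zs → x ≢ y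
        x∉ p with uu
        ... | (_ ∷ q) ∷ _ = All.lookup q p
        ax∉ : ∀ {y} → y ∈ ys ++ zs → a x ≢ y
        ax∉ p with uu
        ... | _ ∷ q ∷ _ = All.lookup q p
        closed′ : ∀ {y} → y ∈ ys ++ zs → a y ∈ ys ++ zs
        closed′ {y} y∈ with ∈-resp-↭ (prep x perm) (closed (∈-resp-↭ (prep x (↭-sym perm)) (there (there y∈))))
        ... | here ay≡x             = ⊥-elim (ax∉ y∈ (≡.trans (≡.cong a (≡.sym ay≡x)) (a-invol y)))
        ... | there (here ay≡ax)    = ⊥-elim (x∉ y∈
              (≡.trans (≡.sym (a-invol x)) (≡.trans (≡.cong a (≡.sym ay≡ax)) (a-invol y))))
        ... | there (there p)       = p

-- Circles through the ends of a trivalent graph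

xor-commutativeMonoid : CommutativeMonoid _ _
xor-commutativeMonoid = record { isCommutativeMonoid = record
  { isMonoid = record
    { isSemigroup = record { isMagma = ≡.isMagma _xor_ ; assoc = Bool.xor-assoc }
    ; identity = Bool.xor-identity }
  ; comm = Bool.xor-comm } }

unique-⊆-length : ∀ {a} {A : Set a} {xs ys : List A} → Unique xs →
                  (∀ {x} → x ∈ xs → x ∈ ys) → length xs ℕ.≤ length ys
unique-⊆-length {xs = []} _ _ = z≤n
unique-⊆-length {xs = x ∷ xs} (x∉xs ∷ u) xs⊆ys with ∈-∃++ (xs⊆ys (here refl))
... | ys , zs , refl = ℕ.≤-trans (s≤s (unique-⊆-length u rest))
                         (ℕ.≤-reflexive (sym (↭-length (shift x ys zs))))
  where
  rest : ∀ {y} → y ∈ xs → y ∈ ys ++ zs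
  rest y∈xs with ∈-resp-↭ (shift x ys zs) (xs⊆ys (there y∈xs))
  ... | here refl = ⊥-elim (All.lookup x∉xs y∈xs refl)
  ... | there p   = p

corners-unique : Unique corners
corners-unique = ((λ ()) ∷ (λ ()) ∷ (λ ()) ∷ []) ∷ ((λ ()) ∷ (λ ()) ∷ []) ∷ ((λ ()) ∷ []) ∷ [] ∷ []

module Ends (Γ : PerfectMatchingGraph) where

  open PerfectMatchingGraph Γ
  open States Γ

  ends-unique : Unique ends
  ends-unique = Unique.cartesianProduct⁺ (Unique.allFin⁺ ∣M∣) corners-unique

module TrivalentEnds (Γ : PerfectMatchingGraph) (trivalent : PerfectMatchingGraph.Trivalent Γ) where

  open PerfectMatchingGraph Γ
  open States Γ
  open Ends Γ

  module _ (h : HalfEdge) where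

    private
      around : List HalfEdge
      around = filter (λ h′ → vertex h′ Fin.≟ vertex h)
                      (cartesianProduct (allFin size) (true ∷ false ∷ []))

      around-unique : Unique around
      around-unique = Unique.filter⁺ _ (Unique.cartesianProduct⁺ (Unique.allFin⁺ size)
        (((λ ()) ∷ []) ∷ [] ∷ []))

      ∈-around : ∀ {h′} → vertex h′ ≡ vertex h → h′ ∈ around
      ∈-around {e , b} = ∈-filter⁺ _ (∈-cartesianProduct⁺ (∈-allFin e) (∈-bool b))
        where
        ∈-bool : ∀ b → b ∈ true ∷ false ∷ []
        ∈-bool true  = here refl
        ∈-bool false = there (here refl)

      orbit : (P : HalfEdge → Set) → (∀ {y} → P y → P (next y)) → P h →
              ∀ {h′} → vertex h′ ≡ vertex h → P h′
      orbit P step = λ p eq → go p (next-cyclic h _ (sym eq))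
        where
        go : ∀ {x y} → P x → Star (λ x y → next x ≡ y) x y → P y
        go p ε          = p
        go p (refl ◅ s) = go (step p) s

      -- `next` is transitive around a vertex, so a list that contains `h` and is closed under
      -- `next` contains all three half-edges there. Lists with one and two entries then show that
      -- `h`, `next h` and `next (next h)` are distinct.
      short-orbit : ∀ xs → (∀ {y} → y ∈ xs → next y ∈ xs) → h ∈ xs → 3 ℕ.≤ length xs
      short-orbit xs step h∈xs = subst (ℕ._≤ length xs) (trivalent (vertex h))
        (unique-⊆-length around-unique (λ p →
          orbit (_∈ xs) step h∈xs (proj₂ (∈-filter⁻ _ {xs = cartesianProduct (allFin size) _} p))))

      not-in-pair : next (next h) ∈ h ∷ next h ∷ [] → ∀ {p} {P : Set p} → P
      not-in-pair q with short-orbit (h ∷ next h ∷ [])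
                                    (λ { (here refl) → there (here refl) ; (there (here refl)) → q })
                                    (here refl)
      ... | s≤s (s≤s ())

    next≢ : next h ≢ h
    next≢ eq with short-orbit (h ∷ []) (λ { (here refl) → here eq }) (here refl)
    ... | s≤s ()

    next²≢ : next (next h) ≢ h
    next²≢ eq = not-in-pair (here eq)

    next²≢next : next (next h) ≢ next h
    next²≢next eq = not-in-pair (there (here eq))

    next²-vertex : vertex (next (next h)) ≡ vertex h
    next²-vertex = trans (next-vertex _) (next-vertex h)

    around-three : ∀ h′ → vertex h′ ≡ vertex h → h′ ≢ h → h′ ≢ next h → h′ ≡ next (next h)
    around-three h′ eq h′≢h h′≢nh with h′ ≟ʰ next (next h)
    ... | yes p = p
    ... | no h′≢nnh = ⊥-elim (four≰three (subst (4 ℕ.≤_) (trivalent (vertex h)) (unique-⊆-length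
            ((h′≢h ∷ h′≢nh ∷ h′≢nnh ∷ []) ∷ ((next≢ ∘ sym) ∷ (next²≢ ∘ sym) ∷ []) ∷
             ((next²≢next ∘ sym) ∷ []) ∷ [] ∷ [])
            λ { (here refl)                         → ∈-around eq
              ; (there (here refl))                 → ∈-around refl
              ; (there (there (here refl)))         → ∈-around (next-vertex h)
              ; (there (there (there (here refl)))) → ∈-around next²-vertex })))
      where
      four≰three : ¬ 4 ℕ.≤ 3
      four≰three (s≤s (s≤s (s≤s ())))

  side : Corner → Bool
  side ↖ = true
  side ↗ = true
  side ↙ = false
  side ↘ = false

  tip : Fin ∣M∣ → Bool → HalfEdge
  tip i b = edge i , b

  halfEdge-vertex : ∀ i c → vertex (halfEdge (i , c)) ≡ vertex (tip i (side c))
  halfEdge-vertex i ↖ = next²-vertex (top i)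
  halfEdge-vertex i ↗ = next-vertex (top i)
  halfEdge-vertex i ↙ = next-vertex (bottom i)
  halfEdge-vertex i ↘ = next²-vertex (bottom i)

  halfEdge≢tip : ∀ i c → halfEdge (i , c) ≢ tip i (side c)
  halfEdge≢tip i ↖ = next²≢ (top i)
  halfEdge≢tip i ↗ = next≢ (top i)
  halfEdge≢tip i ↙ = next≢ (bottom i)
  halfEdge≢tip i ↘ = next²≢ (bottom i)

  -- A vertex meets only one matching edge, and the two ends of that edge are distinct vertices.
  -- Comparisons of corners thereby reduce to a single vertex.
  tip-unique : ∀ i b k b′ → vertex (tip i b) ≡ vertex (tip k b′) → (i , b) ≡ (k , b′)
  tip-unique i b k b′ eq
    with trans (sym (matched≡ (b , eq))) (matched≡ (b′ , refl))
    where
    matched≡ : ∀ {j} → Incident (vertex (tip k b′)) (edge j) → _ ≡ j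
    matched≡ = proj₂ (proj₂ (perfect (vertex (tip k b′))))
  ... | refl with b | b′
  ...   | true  | true  = refl
  ...   | false | false = refl
  ...   | true  | false = ⊥-elim (distinct-ends i eq)
  ...   | false | true  = ⊥-elim (distinct-ends i (sym eq))

  halfEdge-unmatched : ∀ x k → proj₁ (halfEdge x) ≢ edge k
  halfEdge-unmatched x@(i , c) k eq = halfEdge≢tip i c (trans half≡
    (≡.cong (λ (i , b) → tip i b) (tip-unique k b i (side c)
      (trans (≡.cong vertex (sym half≡)) (halfEdge-vertex i c)))))
    where
    b = proj₂ (halfEdge x)
    half≡ : halfEdge x ≡ tip k b
    half≡ = ≡.cong (_, b) eq

  halfEdge-injective : ∀ x y → halfEdge x ≡ halfEdge y → x ≡ y
  halfEdge-injective (i , c) (j , c′) eq = same c c′ (≡.cong proj₁ p) (≡.cong proj₂ p) eq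
    where
    p = tip-unique i (side c) j (side c′)
          (trans (sym (halfEdge-vertex i c)) (trans (≡.cong vertex eq) (halfEdge-vertex j c′)))
    same : ∀ c c′ {i j} → i ≡ j → side c ≡ side c′ →
           halfEdge (i , c) ≡ halfEdge (j , c′) → (i , c) ≡ (j , c′)
    same ↖ ↖ refl _ _ = refl
    same ↖ ↗ refl _ q = ⊥-elim (next²≢next (top _) q)
    same ↗ ↖ refl _ q = ⊥-elim (next²≢next (top _) (sym q))
    same ↗ ↗ refl _ _ = refl
    same ↙ ↙ refl _ _ = refl
    same ↙ ↘ refl _ q = ⊥-elim (next²≢next (bottom _) (sym q))
    same ↘ ↙ refl _ q = ⊥-elim (next²≢next (bottom _) q)
    same ↘ ↘ refl _ _ = refl

  halfEdge-surjective : ∀ g → (∀ k → proj₁ g ≢ edge k) → ∃ λ x → halfEdge x ≡ g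
  halfEdge-surjective g unmatched with perfect (vertex g)
  ... | i , (b , eq) , _ with g ≟ʰ next (tip i b)
  halfEdge-surjective g unmatched | i , (true  , eq) , _ | yes p = (i , ↗) , sym p
  halfEdge-surjective g unmatched | i , (false , eq) , _ | yes p = (i , ↙) , sym p
  halfEdge-surjective g unmatched | i , (true  , eq) , _ | no ¬p =
    (i , ↖) , sym (around-three (top i) g (sym eq) (unmatched i ∘ ≡.cong proj₁) ¬p)
  halfEdge-surjective g unmatched | i , (false , eq) , _ | no ¬p =
    (i , ↘) , sym (around-three (bottom i) g (sym eq) (unmatched i ∘ ≡.cong proj₁) ¬p)

  -- Both half-edges of an edge outside the matching lie outside it, so both are corners. With
  -- `halfEdge-injective` this makes `across` a fixed-point-free involution, the pairing behind the
  -- parity count.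
  across-∃ : ∀ x → ∃ λ y → halfEdge y ≡ opposite (halfEdge x)
  across-∃ x = halfEdge-surjective (opposite (halfEdge x)) (halfEdge-unmatched x)

  across : End → End
  across x = proj₁ (across-∃ x)

  across-involutive : ∀ x → across (across x) ≡ x
  across-involutive x = halfEdge-injective _ _ (trans (proj₂ (across-∃ (across x)))
    (trans (≡.cong opposite (proj₂ (across-∃ x))) (≡.cong (proj₁ (halfEdge x) ,_) (Bool.not-involutive _))))

  across-≢ : ∀ x → across x ≢ x
  across-≢ x eq = Bool.not-¬ refl (≡.cong proj₂ (trans (sym (≡.cong halfEdge eq)) (proj₂ (across-∃ x))))

  across-≈ : ∀ α x → α ⊢ across x ≈ x
  across-≈ α x = fwd (along (proj₂ (across-∃ x))) ◅ ε

  through₀ : ∀ α k {c c′ b} → lookup α k ≡ b → Smoothing b c c′ → α ⊢ (k , c) ≈ (k , c′)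
  through₀ α k refl s = fwd (through k s) ◅ ε

  -- Parity of the ends on a common circle

  module _ {j α α′} (agree : AgreeOff j α α′)
           (α-0 : lookup α j ≡ false) (α′-1 : lookup α′ j ≡ true) where

    private
      open ListProduct xor-commutativeMonoid

      u = (j , ↖)
      u′ = (j , ↗)

      S? : ∀ x → Dec (α ⊢ x ≈ u × α′ ⊢ x ≈ u)
      S? x = ≈? α x u ×-dec ≈? α′ x u

      S : End → Bool
      S x = does (S? x)

      S-cong : ∀ {x y} → α ⊢ x ≈ y → α′ ⊢ x ≈ y → S x ≡ S y
      S-cong {x} {y} p q = does-⇔ (mk⇔
        (λ (a , b) → EqC.symmetric _ p ◅◅ a , EqC.symmetric _ q ◅◅ b)
        (λ (a , b) → p ◅◅ a , q ◅◅ b)) (S? x) (S? y)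

      even-across : ∏ ends S ≡ false
      even-across = ∏-paired across across-involutive across-≢ S
        (λ x → trans (≡.cong (S x xor_) (S-cong (across-≈ α x) (across-≈ α′ x))) (Bool.xor-same (S x)))
        ends-unique (λ {x} _ → ∈-ends (across x))

      four : Fin ∣M∣ → Bool
      four k = S (k , ↖) xor (S (k , ↗) xor (S (k , ↙) xor (S (k , ↘) xor false)))

      four-off : ∀ k → k ≢ j → four k ≡ false
      four-off k k≢j with lookup α k in eq
      ... | false
        rewrite S-cong (through₀ α k eq 0-left) (through₀ α′ k (trans (sym (agree k k≢j)) eq) 0-left)
              | S-cong (through₀ α k eq 0-right) (through₀ α′ k (trans (sym (agree k k≢j)) eq) 0-right)
        with S (k , ↙) | S (k , ↘)
      ...   | true  | true  = refl
      ...   | true  | false = refl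
      ...   | false | true  = refl
      ...   | false | false = refl
      four-off k k≢j | true
        rewrite S-cong (through₀ α k eq 1-left) (through₀ α′ k (trans (sym (agree k k≢j)) eq) 1-left)
              | S-cong (through₀ α k eq 1-right) (through₀ α′ k (trans (sym (agree k k≢j)) eq) 1-right)
        with S (k , ↙) | S (k , ↘)
      ...   | true  | true  = refl
      ...   | true  | false = refl
      ...   | false | true  = refl
      ...   | false | false = refl

    -- If both states separated ↖ from ↗, the ends lying on the circle of ↖
    -- in both of them would be paired off by the edges, and at every matching
    -- edge but j also by the strands; at j only ↖ is among them, which
    -- contradicts parity.
    joined-before-or-after : ¬ α ⊢ u ≈ u′ → ¬ α′ ⊢ u ≈ u′ → ∀ {p} {P : Set p} → P
    joined-before-or-after apart apart′ = ⊥-elim (true≢false (trans (sym odd) even-across))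
      where
      true≢false : true ≢ false
      true≢false ()
      -- The corner ↙ is excluded because the 1-smoothing ties it to ↗ in `α′`, and ↘ because the
      -- 0-smoothing ties it to ↗ in `α`.
      four-at : four j ≡ true
      four-at
        rewrite dec-true (S? u) (ε , ε)
              | dec-false (S? u′) (λ (p , _) → apart (EqC.symmetric _ p))
              | dec-false (S? (j , ↙)) (λ (_ , q) → apart′ (EqC.symmetric _ q ◅◅
                  EqC.symmetric _ (through₀ α′ j α′-1 1-right)))
              | dec-false (S? (j , ↘)) (λ (p , _) → apart (EqC.symmetric _ p ◅◅
                  EqC.symmetric _ (through₀ α j α-0 0-right))) = refl
      four≡ : ∀ k → four k ≡ when (does (k Fin.≟ j)) true
      four≡ k with k Fin.≟ j
      ... | yes refl = four-at
      ... | no k≢j   = four-off k k≢j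
      odd : ∏ ends S ≡ true
      odd = trans (∏-cartesianProduct S (allFin ∣M∣) corners) (trans (∏-cong (allFin ∣M∣) four≡)
              (∏-single Fin._≟_ (Unique.allFin⁺ ∣M∣) (∈-allFin j)))

-- The Frobenius algebra V

module ModuleSum {c ℓ m ℓm} {R : CommutativeRing c ℓ} (M : Module R m ℓm) where

  open Module M
  open Sum +ᴹ-commutativeMonoid public using (sum; sum-cong-≋; ∑-comm; ∑-distrib-+; sum-replicate-zero)

  sum-cong : ∀ n {f g : Fin n → Carrierᴹ} → (∀ k → f k ≈ᴹ g k) → sum f ≈ᴹ sum g
  sum-cong n = sum-cong-≋

module _ {c ℓ} {R : CommutativeRing c ℓ} where

  open LinearAlgebra R
  open LinearMap using (⟦⟧-cong; +ᴹ-homo; *ₗ-homo; 0ᴹ-homo; -ᴹ-homo)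

  module _ {m ℓm n ℓn} {M : Module R m ℓm} {N : Module R n ℓn} (f : LinearMap M N) where

    open Module N

    private
      module ΣM = ModuleSum M
      module ΣN = ModuleSum N

    map-sum : ∀ {k} (x : Fin k → Module.Carrierᴹ M) → ⟦ f ⟧ (ΣM.sum x) ≈ᴹ ΣN.sum (⟦ f ⟧ ∘ x)
    map-sum {zero}  x = 0ᴹ-homo f
    map-sum {suc k} x = ≈ᴹ-trans (+ᴹ-homo f _ _) (+ᴹ-congˡ (map-sum (x ∘ suc)))

  module _ {m ℓm n ℓn} (M : Module R m ℓm) (N : Module R n ℓn) where

    private
      module M = Module M
      module N = Module N

    tensorˡ : M.Carrierᴹ → LinearMap N (M ⊗ N)
    tensorˡ x = linear (x ⊗ₑ_) (λ p → relation (⊗-cong M.≈ᴹ-refl p))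
      (λ y y′ → relation (+ʳ x y y′)) (λ r y → relation (·ʳ r x y))

    tensorʳ : N.Carrierᴹ → LinearMap M (M ⊗ N)
    tensorʳ y = linear (_⊗ₑ y) (λ p → relation (⊗-cong p N.≈ᴹ-refl))
      (λ x x′ → relation (+ˡ x x′ y)) (λ r x → relation (·ˡ r x y))

    module _ (free : FiniteRankFree M) where

      open FiniteRankFree free using (rank; basis; coords; expansion)
      open Module (M ⊗ N)
      open ModuleSum (M ⊗ N)
      private module ΣM = ModuleSum M

      -- Bilinearity moves all coefficients to the right factor. Applied to `Δⱽ` of the unit, this
      -- yields a finite copairing, whence the use of finite rank.
      expand-⊗ : ∀ t → ∃ λ (y : Fin rank → N.Carrierᴹ) → t ≈ᴹ sum (λ k → basis k ⊗ₑ y k)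
      expand-⊗ (x ⊗ₑ y) = (λ k → coords x k N.*ₗ y) , (begin
        x ⊗ₑ y                                           ≈⟨ ⟦⟧-cong (tensorʳ y) (M.≈ᴹ-sym (expansion x)) ⟩
        ΣM.sum (λ k → coords x k M.*ₗ basis k) ⊗ₑ y      ≈⟨ map-sum (tensorʳ y) (λ k → coords x k M.*ₗ basis k) ⟩
        sum (λ k → (coords x k M.*ₗ basis k) ⊗ₑ y)
          ≈⟨ sum-cong rank (λ k → ≈ᴹ-trans (relation (·ˡ _ _ _)) (≈ᴹ-sym (relation (·ʳ _ _ _)))) ⟩
        sum (λ k → basis k ⊗ₑ (coords x k N.*ₗ y))       ∎)
        where open SetoidReasoning ≈ᴹ-setoid
      expand-⊗ 0ₜ = (λ _ → N.0ᴹ) , ≈ᴹ-sym (≈ᴹ-trans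
        (sum-cong rank (λ k → 0ᴹ-homo (tensorˡ (basis k)))) (sum-replicate-zero rank))
      expand-⊗ (s +ₜ t) with expand-⊗ s | expand-⊗ t
      ... | y , p | z , q = (λ k → y k N.+ᴹ z k) , ≈ᴹ-trans (+ᴹ-cong p q)
        (≈ᴹ-trans (≈ᴹ-sym (∑-distrib-+ (λ k → basis k ⊗ₑ y k) (λ k → basis k ⊗ₑ z k)))
                  (sum-cong rank (λ k → ≈ᴹ-sym (relation (+ʳ _ _ _)))))
      expand-⊗ (-ₜ s) with expand-⊗ s
      ... | y , p = (λ k → N.-ᴹ y k) , ≈ᴹ-sym (uniqueʳ‿-ᴹ s _ (≈ᴹ-trans (+ᴹ-congʳ p) (≈ᴹ-trans
        (≈ᴹ-sym (∑-distrib-+ (λ k → basis k ⊗ₑ y k) (λ k → basis k ⊗ₑ (N.-ᴹ y k))))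
        (≈ᴹ-trans (sum-cong rank (λ k → ≈ᴹ-trans (+ᴹ-congˡ (-ᴹ-homo (tensorˡ (basis k)) (y k)))
                    (-ᴹ‿inverseʳ _)))
          (sum-replicate-zero rank)))))
      expand-⊗ (r ·ₜ s) with expand-⊗ s
      ... | y , p = (λ k → r N.*ₗ y k) , ≈ᴹ-trans (*ₗ-cong (CommutativeRing.refl R) p)
        (≈ᴹ-trans (map-sum scale (λ k → basis k ⊗ₑ y k))
          (sum-cong rank (λ k → ≈ᴹ-sym (relation (·ʳ _ _ _)))))
        where
        scale : LinearMap (M ⊗ N) (M ⊗ N)
        scale = r ·ᴸ linear (λ t → t) (λ e → e) (λ _ _ → ≈ᴹ-refl) (λ _ _ → ≈ᴹ-refl)

module Frobenius {c ℓ v ℓv} (R : CommutativeRing c ℓ) (𝓕 : MTQFT R v ℓv) where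

  open LinearAlgebra R hiding (·-cong; ·-assoc)
  open LinearMap using (⟦⟧-cong; +ᴹ-homo; *ₗ-homo)
  open MTQFT 𝓕
  open CommutativeRing R using (1#)

  private
    module V = Module V
    module O₀ = Module (obj 0)
    module O₂ = Module (obj 2)
    module O₃ = Module (obj 3)
    module V⊗V = Module (V ⊗ V)

  infixl 7 _·_
  _·_ : V.Carrierᴹ → V.Carrierᴹ → V.Carrierᴹ
  x · y = ⟦ μⱽ ⟧ (x ⊗ₑ y)

  unit : V.Carrierᴹ
  unit = ⟦ hom ηᶜ ⟧ (⟦ φ₀ ⟧ 1#)

  κ : V.Carrierᴹ
  κ = ⟦ mⱽ ⟧ unit

  ·-cong : ∀ {x x′ y y′} → x V.≈ᴹ x′ → y V.≈ᴹ y′ → x · y V.≈ᴹ x′ · y′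
  ·-cong p q = ⟦⟧-cong μⱽ (relation (⊗-cong p q))

  φ-cong : ∀ {a b} {x x′ : ∣obj∣ a} {y y′ : ∣obj∣ b} → x ≈ᴹ x′ → y ≈ᴹ y′ →
           ⟦ φ a b ⟧ (x ⊗ₑ y) ≈ᴹ ⟦ φ a b ⟧ (x′ ⊗ₑ y′)
  φ-cong {a} {b} p q = ⟦⟧-cong (φ a b) (relation (⊗-cong p q))

  -- α⇒ 1 1 1 reduces to idᶜ 3.
  φ-assoc₁ : ∀ x y z → ⟦ φ 2 1 ⟧ (⟦ φ 1 1 ⟧ (x ⊗ₑ y) ⊗ₑ z) O₃.≈ᴹ ⟦ φ 1 2 ⟧ (x ⊗ₑ ⟦ φ 1 1 ⟧ (y ⊗ₑ z))
  φ-assoc₁ x y z = O₃.≈ᴹ-trans (O₃.≈ᴹ-sym (hom-id 3 _)) (φ-assoc 1 1 1 x y z)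

  ·-assoc : ∀ x y z → (x · y) · z V.≈ᴹ x · (y · z)
  ·-assoc x y z = begin
    (x · y) · z
      ≈⟨ ⟦⟧-cong (hom μᶜ) (φ-cong V.≈ᴹ-refl (hom-id 1 z)) ⟨
    ⟦ hom μᶜ ⟧ (⟦ φ 1 1 ⟧ ((x · y) ⊗ₑ ⟦ hom (idᶜ 1) ⟧ z))
      ≈⟨ ⟦⟧-cong (hom μᶜ) (φ-natural μᶜ (idᶜ 1) _ z) ⟨
    ⟦ hom μᶜ ⟧ (⟦ hom (μᶜ ⊞ idᶜ 1) ⟧ (⟦ φ 2 1 ⟧ (⟦ φ 1 1 ⟧ (x ⊗ₑ y) ⊗ₑ z)))
      ≈⟨ hom-∘ μᶜ (μᶜ ⊞ idᶜ 1) _ ⟨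
    ⟦ hom (μᶜ ∘ᶜ (μᶜ ⊞ idᶜ 1)) ⟧ (⟦ φ 2 1 ⟧ (⟦ φ 1 1 ⟧ (x ⊗ₑ y) ⊗ₑ z))
      ≈⟨ hom-cong μ-assoc _ ⟩
    ⟦ hom (μᶜ ∘ᶜ (idᶜ 1 ⊞ μᶜ)) ⟧ (⟦ φ 2 1 ⟧ (⟦ φ 1 1 ⟧ (x ⊗ₑ y) ⊗ₑ z))
      ≈⟨ ⟦⟧-cong (hom (μᶜ ∘ᶜ (idᶜ 1 ⊞ μᶜ))) (φ-assoc₁ x y z) ⟩
    ⟦ hom (μᶜ ∘ᶜ (idᶜ 1 ⊞ μᶜ)) ⟧ (⟦ φ 1 2 ⟧ (x ⊗ₑ ⟦ φ 1 1 ⟧ (y ⊗ₑ z)))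
      ≈⟨ hom-∘ μᶜ (idᶜ 1 ⊞ μᶜ) _ ⟩
    ⟦ hom μᶜ ⟧ (⟦ hom (idᶜ 1 ⊞ μᶜ) ⟧ (⟦ φ 1 2 ⟧ (x ⊗ₑ ⟦ φ 1 1 ⟧ (y ⊗ₑ z))))
      ≈⟨ ⟦⟧-cong (hom μᶜ) (φ-natural (idᶜ 1) μᶜ x _) ⟩
    ⟦ hom μᶜ ⟧ (⟦ φ 1 1 ⟧ (⟦ hom (idᶜ 1) ⟧ x ⊗ₑ (y · z)))
      ≈⟨ ⟦⟧-cong (hom μᶜ) (φ-cong (hom-id 1 x) V.≈ᴹ-refl) ⟩
    x · (y · z) ∎
    where open SetoidReasoning V.≈ᴹ-setoid

  ·-comm : ∀ x y → x · y V.≈ᴹ y · x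
  ·-comm x y = begin
    x · y                                                    ≈⟨ hom-cong μ-comm _ ⟨
    ⟦ hom (μᶜ ∘ᶜ σ 1 1) ⟧ (⟦ φ 1 1 ⟧ (x ⊗ₑ y))               ≈⟨ hom-∘ μᶜ (σ 1 1) _ ⟩
    ⟦ hom μᶜ ⟧ (⟦ hom (σ 1 1) ⟧ (⟦ φ 1 1 ⟧ (x ⊗ₑ y)))        ≈⟨ ⟦⟧-cong (hom μᶜ) (φ-σ 1 1 x y) ⟩
    y · x                                                    ∎
    where open SetoidReasoning V.≈ᴹ-setoid

  ·-unitˡ : ∀ x → unit · x V.≈ᴹ x
  ·-unitˡ x = begin
    unit · x
      ≈⟨ ⟦⟧-cong (hom μᶜ) (φ-cong V.≈ᴹ-refl (hom-id 1 x)) ⟨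
    ⟦ hom μᶜ ⟧ (⟦ φ 1 1 ⟧ (unit ⊗ₑ ⟦ hom (idᶜ 1) ⟧ x))
      ≈⟨ ⟦⟧-cong (hom μᶜ) (φ-natural ηᶜ (idᶜ 1) _ x) ⟨
    ⟦ hom μᶜ ⟧ (⟦ hom (ηᶜ ⊞ idᶜ 1) ⟧ (⟦ φ 0 1 ⟧ (⟦ φ₀ ⟧ 1# ⊗ₑ x)))
      ≈⟨ hom-∘ μᶜ (ηᶜ ⊞ idᶜ 1) _ ⟨
    ⟦ hom (μᶜ ∘ᶜ (ηᶜ ⊞ idᶜ 1)) ⟧ (⟦ φ 0 1 ⟧ (⟦ φ₀ ⟧ 1# ⊗ₑ x))
      ≈⟨ hom-cong μ-unit _ ⟩
    ⟦ hom (idᶜ 1) ⟧ (⟦ φ 0 1 ⟧ (⟦ φ₀ ⟧ 1# ⊗ₑ x))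
      ≈⟨ hom-id 1 _ ⟩
    ⟦ φ 0 1 ⟧ (⟦ φ₀ ⟧ 1# ⊗ₑ x)
      ≈⟨ φ-unitˡ 1 1# x ⟩
    1# V.*ₗ x
      ≈⟨ V.*ₗ-identityˡ x ⟩
    x ∎
    where open SetoidReasoning V.≈ᴹ-setoid

  ·-commutativeMonoid : CommutativeMonoid v ℓv
  ·-commutativeMonoid = record
    { Carrier = V.Carrierᴹ
    ; _≈_ = V._≈ᴹ_
    ; _∙_ = _·_
    ; ε = unit
    ; isCommutativeMonoid = record
      { isMonoid = record
        { isSemigroup = record
          { isMagma = record { isEquivalence = V.≈ᴹ-isEquivalence ; ∙-cong = ·-cong }
          ; assoc = ·-assoc }
        ; identity = ·-unitˡ , λ x → V.≈ᴹ-trans (·-comm x unit) (·-unitˡ x) }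
      ; comm = ·-comm } }

  open CommutativeMonoid ·-commutativeMonoid public using () renaming (identityʳ to ·-unitʳ)

  multiply : V.Carrierᴹ → LinearMap V V
  multiply x = μⱽ ∘ᴸ tensorˡ V V x

  m-·ˡ : ∀ x y → ⟦ mⱽ ⟧ x · y V.≈ᴹ ⟦ mⱽ ⟧ (x · y)
  m-·ˡ x y = begin
    ⟦ mⱽ ⟧ x · y
      ≈⟨ ⟦⟧-cong (hom μᶜ) (φ-cong V.≈ᴹ-refl (hom-id 1 y)) ⟨
    ⟦ hom μᶜ ⟧ (⟦ φ 1 1 ⟧ (⟦ mⱽ ⟧ x ⊗ₑ ⟦ hom (idᶜ 1) ⟧ y))
      ≈⟨ ⟦⟧-cong (hom μᶜ) (φ-natural mᶜ (idᶜ 1) x y) ⟨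
    ⟦ hom μᶜ ⟧ (⟦ hom (mᶜ ⊞ idᶜ 1) ⟧ (⟦ φ 1 1 ⟧ (x ⊗ₑ y)))
      ≈⟨ hom-∘ μᶜ (mᶜ ⊞ idᶜ 1) _ ⟨
    ⟦ hom (μᶜ ∘ᶜ (mᶜ ⊞ idᶜ 1)) ⟧ (⟦ φ 1 1 ⟧ (x ⊗ₑ y))
      ≈⟨ hom-cong m-μˡ _ ⟩
    ⟦ hom (mᶜ ∘ᶜ μᶜ) ⟧ (⟦ φ 1 1 ⟧ (x ⊗ₑ y))
      ≈⟨ hom-∘ mᶜ μᶜ _ ⟩
    ⟦ mⱽ ⟧ (x · y) ∎
    where open SetoidReasoning V.≈ᴹ-setoid

  -- By `m-·ˡ` the map `mⱽ` is `V`-linear, hence multiplication by its value at the unit. A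
  -- one-to-one change thus becomes a factor on a circle.
  m-κ : ∀ x → ⟦ mⱽ ⟧ x V.≈ᴹ κ · x
  m-κ x = V.≈ᴹ-sym (V.≈ᴹ-trans (m-·ˡ unit x) (⟦⟧-cong mⱽ (·-unitˡ x)))

  actˡ actʳ : V.Carrierᴹ → LinearMap (V ⊗ V) (V ⊗ V)
  actˡ x = lift (V ⊗ V) (λ (a , b) → (x · a) ⊗ₑ b) λ where
    (⊗-cong p q) → relation (⊗-cong (·-cong V.≈ᴹ-refl p) q)
    (+ˡ a a′ b)  → V⊗V.≈ᴹ-trans (relation (⊗-cong (+ᴹ-homo (multiply x) a a′) V.≈ᴹ-refl)) (relation (+ˡ _ _ _))
    (+ʳ a b b′)  → relation (+ʳ _ _ _)
    (·ˡ r a b)   → V⊗V.≈ᴹ-trans (relation (⊗-cong (*ₗ-homo (multiply x) r a) V.≈ᴹ-refl)) (relation (·ˡ _ _ _))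
    (·ʳ r a b)   → relation (·ʳ _ _ _)
  actʳ y = lift (V ⊗ V) (λ (a , b) → a ⊗ₑ (b · y)) λ where
    (⊗-cong p q) → relation (⊗-cong p (·-cong q V.≈ᴹ-refl))
    (+ˡ a a′ b)  → relation (+ˡ _ _ _)
    (+ʳ a b b′)  → V⊗V.≈ᴹ-trans (relation (⊗-cong V.≈ᴹ-refl (+ᴹ-homo (μⱽ ∘ᴸ tensorʳ V V y) b b′))) (relation (+ʳ _ _ _))
    (·ˡ r a b)   → relation (·ˡ _ _ _)
    (·ʳ r a b)   → V⊗V.≈ᴹ-trans (relation (⊗-cong V.≈ᴹ-refl (*ₗ-homo (μⱽ ∘ᴸ tensorʳ V V y) r b))) (relation (·ʳ _ _ _))

  -- The Frobenius relation, read as linearity of `Δⱽ` over `V` acting on the right factor. Together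
  -- with `Δ-·ˡ` it determines `Δⱽ` by its value at the unit.
  Δ-·ʳ : ∀ x y → ⟦ Δⱽ ⟧ (x · y) V⊗V.≈ᴹ ⟦ actʳ y ⟧ (⟦ Δⱽ ⟧ x)
  Δ-·ʳ x y = V⊗V.≈ᴹ-trans (⟦⟧-cong (φ⁻¹ 1 1) step) (φ⁻¹-φ 1 1 _)
    where
    step : ⟦ hom Δᶜ ⟧ (x · y) O₂.≈ᴹ ⟦ φ 1 1 ⟧ (⟦ actʳ y ⟧ (⟦ Δⱽ ⟧ x))
    step = begin
      ⟦ hom Δᶜ ⟧ (x · y)
        ≈⟨ hom-∘ Δᶜ μᶜ _ ⟨
      ⟦ hom (Δᶜ ∘ᶜ μᶜ) ⟧ (⟦ φ 1 1 ⟧ (x ⊗ₑ y))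
        ≈⟨ hom-cong frobeniusʳ _ ⟨
      ⟦ hom ((idᶜ 1 ⊞ μᶜ) ∘ᶜ (Δᶜ ⊞ idᶜ 1)) ⟧ (⟦ φ 1 1 ⟧ (x ⊗ₑ y))
        ≈⟨ hom-∘ (idᶜ 1 ⊞ μᶜ) (Δᶜ ⊞ idᶜ 1) _ ⟩
      ⟦ hom (idᶜ 1 ⊞ μᶜ) ⟧ (⟦ hom (Δᶜ ⊞ idᶜ 1) ⟧ (⟦ φ 1 1 ⟧ (x ⊗ₑ y)))
        ≈⟨ ⟦⟧-cong (hom (idᶜ 1 ⊞ μᶜ)) (φ-natural Δᶜ (idᶜ 1) x y) ⟩
      ⟦ hom (idᶜ 1 ⊞ μᶜ) ⟧ (⟦ φ 2 1 ⟧ (⟦ hom Δᶜ ⟧ x ⊗ₑ ⟦ hom (idᶜ 1) ⟧ y))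
        ≈⟨ ⟦⟧-cong (hom (idᶜ 1 ⊞ μᶜ)) (φ-cong (φ-φ⁻¹ 1 1 _) (V.≈ᴹ-sym (hom-id 1 y))) ⟨
      ⟦ hom (idᶜ 1 ⊞ μᶜ) ⟧ (⟦ φ 2 1 ⟧ (⟦ φ 1 1 ⟧ (⟦ Δⱽ ⟧ x) ⊗ₑ y))
        -- Both sides are linear in `⟦ Δⱽ ⟧ x`, so it suffices to compare them on pure tensors,
        -- where the coherence axioms apply.
        ≈⟨ lift-ext (obj 2) (hom (idᶜ 1 ⊞ μᶜ) ∘ᴸ φ 2 1 ∘ᴸ tensorʳ (obj 2) V y ∘ᴸ φ 1 1) (φ 1 1 ∘ᴸ actʳ y)
             (λ (a , b) → O₂.≈ᴹ-trans (⟦⟧-cong (hom (idᶜ 1 ⊞ μᶜ)) (φ-assoc₁ a b y))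
               (O₂.≈ᴹ-trans (φ-natural (idᶜ 1) μᶜ a _) (φ-cong (hom-id 1 a) V.≈ᴹ-refl)))
             (⟦ Δⱽ ⟧ x) ⟩
      ⟦ φ 1 1 ⟧ (⟦ actʳ y ⟧ (⟦ Δⱽ ⟧ x)) ∎
      where open SetoidReasoning O₂.≈ᴹ-setoid

  Δ-·ˡ : ∀ x y → ⟦ Δⱽ ⟧ (x · y) V⊗V.≈ᴹ ⟦ actˡ x ⟧ (⟦ Δⱽ ⟧ y)
  Δ-·ˡ x y = V⊗V.≈ᴹ-trans (⟦⟧-cong (φ⁻¹ 1 1) step) (φ⁻¹-φ 1 1 _)
    where
    step : ⟦ hom Δᶜ ⟧ (x · y) O₂.≈ᴹ ⟦ φ 1 1 ⟧ (⟦ actˡ x ⟧ (⟦ Δⱽ ⟧ y))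
    step = begin
      ⟦ hom Δᶜ ⟧ (x · y)
        ≈⟨ hom-∘ Δᶜ μᶜ _ ⟨
      ⟦ hom (Δᶜ ∘ᶜ μᶜ) ⟧ (⟦ φ 1 1 ⟧ (x ⊗ₑ y))
        ≈⟨ hom-cong frobeniusˡ _ ⟨
      ⟦ hom ((μᶜ ⊞ idᶜ 1) ∘ᶜ (idᶜ 1 ⊞ Δᶜ)) ⟧ (⟦ φ 1 1 ⟧ (x ⊗ₑ y))
        ≈⟨ hom-∘ (μᶜ ⊞ idᶜ 1) (idᶜ 1 ⊞ Δᶜ) _ ⟩
      ⟦ hom (μᶜ ⊞ idᶜ 1) ⟧ (⟦ hom (idᶜ 1 ⊞ Δᶜ) ⟧ (⟦ φ 1 1 ⟧ (x ⊗ₑ y)))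
        ≈⟨ ⟦⟧-cong (hom (μᶜ ⊞ idᶜ 1)) (φ-natural (idᶜ 1) Δᶜ x y) ⟩
      ⟦ hom (μᶜ ⊞ idᶜ 1) ⟧ (⟦ φ 1 2 ⟧ (⟦ hom (idᶜ 1) ⟧ x ⊗ₑ ⟦ hom Δᶜ ⟧ y))
        ≈⟨ ⟦⟧-cong (hom (μᶜ ⊞ idᶜ 1)) (φ-cong (V.≈ᴹ-sym (hom-id 1 x)) (φ-φ⁻¹ 1 1 _)) ⟨
      ⟦ hom (μᶜ ⊞ idᶜ 1) ⟧ (⟦ φ 1 2 ⟧ (x ⊗ₑ ⟦ φ 1 1 ⟧ (⟦ Δⱽ ⟧ y)))
        ≈⟨ lift-ext (obj 2) (hom (μᶜ ⊞ idᶜ 1) ∘ᴸ φ 1 2 ∘ᴸ tensorˡ V (obj 2) x ∘ᴸ φ 1 1) (φ 1 1 ∘ᴸ actˡ x)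
             (λ (a , b) → O₂.≈ᴹ-trans (⟦⟧-cong (hom (μᶜ ⊞ idᶜ 1)) (O₃.≈ᴹ-sym (φ-assoc₁ x a b)))
               (O₂.≈ᴹ-trans (φ-natural μᶜ (idᶜ 1) _ b) (φ-cong V.≈ᴹ-refl (hom-id 1 b))))
             (⟦ Δⱽ ⟧ y) ⟩
      ⟦ φ 1 1 ⟧ (⟦ actˡ x ⟧ (⟦ Δⱽ ⟧ y)) ∎
      where open SetoidReasoning O₂.≈ᴹ-setoid

  open FiniteRankFree (free 1) public using (rank; basis)

  private Δ-unit = expand-⊗ V V (free 1) (⟦ Δⱽ ⟧ unit)

  -- The right legs of `Δⱽ` of the unit. By `dual-expansion` they behave as the dual basis of
  -- `basis` for the form `trace (x · y)`.
  dual : Fin rank → V.Carrierᴹ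
  dual = proj₁ Δ-unit

  private
    module ΣV = ModuleSum V
    module Σ⊗ = ModuleSum (V ⊗ V)

  Δ-expansion : ∀ x y → ⟦ Δⱽ ⟧ (x · y) V⊗V.≈ᴹ Σ⊗.sum (λ k → (x · basis k) ⊗ₑ (dual k · y))
  Δ-expansion x y = begin
    ⟦ Δⱽ ⟧ (x · y)
      ≈⟨ Δ-·ʳ x y ⟩
    ⟦ actʳ y ⟧ (⟦ Δⱽ ⟧ x)
      ≈⟨ ⟦⟧-cong (actʳ y) (⟦⟧-cong Δⱽ (·-unitʳ x)) ⟨
    ⟦ actʳ y ⟧ (⟦ Δⱽ ⟧ (x · unit))
      ≈⟨ ⟦⟧-cong (actʳ y) (Δ-·ˡ x unit) ⟩
    ⟦ actʳ y ⟧ (⟦ actˡ x ⟧ (⟦ Δⱽ ⟧ unit))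
      ≈⟨ ⟦⟧-cong (actʳ y ∘ᴸ actˡ x) (proj₂ Δ-unit) ⟩
    ⟦ actʳ y ⟧ (⟦ actˡ x ⟧ (Σ⊗.sum (λ k → basis k ⊗ₑ dual k)))
      ≈⟨ map-sum (actʳ y ∘ᴸ actˡ x) (λ k → basis k ⊗ₑ dual k) ⟩
    Σ⊗.sum (λ k → (x · basis k) ⊗ₑ (dual k · y)) ∎
    where open SetoidReasoning V⊗V.≈ᴹ-setoid

  trace : V.Carrierᴹ → CommutativeRing.Carrier R
  trace x = ⟦ φ₀⁻¹ ⟧ (⟦ hom ϵᶜ ⟧ x)

  -- The left counit axiom applied to the expansion of `Δⱽ` at `x · unit`.
  dual-expansion : ∀ x → x V.≈ᴹ ΣV.sum (λ k → trace (x · basis k) V.*ₗ dual k)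
  dual-expansion x = begin
    x
      ≈⟨ hom-id 1 x ⟨
    ⟦ hom (idᶜ 1) ⟧ x
      ≈⟨ hom-cong Δ-counitˡ x ⟨
    ⟦ hom ((ϵᶜ ⊞ idᶜ 1) ∘ᶜ Δᶜ) ⟧ x
      ≈⟨ hom-∘ (ϵᶜ ⊞ idᶜ 1) Δᶜ x ⟩
    ⟦ hom (ϵᶜ ⊞ idᶜ 1) ⟧ (⟦ hom Δᶜ ⟧ x)
      ≈⟨ ⟦⟧-cong (hom (ϵᶜ ⊞ idᶜ 1)) (φ-φ⁻¹ 1 1 _) ⟨
    ⟦ counit ⟧ (⟦ Δⱽ ⟧ x)
      ≈⟨ ⟦⟧-cong counit (V⊗V.≈ᴹ-trans (⟦⟧-cong Δⱽ (V.≈ᴹ-sym (·-unitʳ x))) (Δ-expansion x unit)) ⟩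
    ⟦ counit ⟧ (Σ⊗.sum (λ k → (x · basis k) ⊗ₑ (dual k · unit)))
      ≈⟨ map-sum counit (λ k → (x · basis k) ⊗ₑ (dual k · unit)) ⟩
    ΣV.sum (λ k → ⟦ counit ⟧ ((x · basis k) ⊗ₑ (dual k · unit)))
      ≈⟨ ΣV.sum-cong rank (λ k → V.≈ᴹ-trans (counit-⊗ _ _) (V.*ₗ-congˡ (·-unitʳ _))) ⟩
    ΣV.sum (λ k → trace (x · basis k) V.*ₗ dual k) ∎
    where
    open SetoidReasoning V.≈ᴹ-setoid
    counit : LinearMap (V ⊗ V) V
    counit = hom (ϵᶜ ⊞ idᶜ 1) ∘ᴸ φ 1 1
    counit-⊗ : ∀ a b → ⟦ counit ⟧ (a ⊗ₑ b) V.≈ᴹ trace a V.*ₗ b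
    counit-⊗ a b = V.≈ᴹ-trans (φ-natural ϵᶜ (idᶜ 1) a b)
      (V.≈ᴹ-trans (φ-cong (O₀.≈ᴹ-sym (φ₀-φ₀⁻¹ _)) (hom-id 1 b)) (φ-unitˡ 1 _ b))

  -- Both sides are ∑ₖ∑ₗ trace (basis k · basis l) (dual l ⊗ dual k), whose
  -- coefficients are symmetric in k and l.
  copairing-symmetric : Σ⊗.sum (λ k → basis k ⊗ₑ dual k) V⊗V.≈ᴹ Σ⊗.sum (λ k → dual k ⊗ₑ basis k)
  copairing-symmetric = begin
    Σ⊗.sum (λ k → basis k ⊗ₑ dual k)
      ≈⟨ Σ⊗.sum-cong rank (λ k → V⊗V.≈ᴹ-trans (⟦⟧-cong (tensorʳ V V (dual k)) (dual-expansion (basis k)))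
           (V⊗V.≈ᴹ-trans (map-sum (tensorʳ V V (dual k)) (λ l → g k l V.*ₗ dual l))
             (Σ⊗.sum-cong rank (λ l → relation (·ˡ (g k l) (dual l) (dual k)))))) ⟩
    Σ⊗.sum (λ k → Σ⊗.sum (λ l → g k l ·ₜ (dual l ⊗ₑ dual k)))
      ≈⟨ Σ⊗.∑-comm (λ k l → g k l ·ₜ (dual l ⊗ₑ dual k)) ⟩
    Σ⊗.sum (λ l → Σ⊗.sum (λ k → g k l ·ₜ (dual l ⊗ₑ dual k)))
      ≈⟨ Σ⊗.sum-cong rank (λ l → Σ⊗.sum-cong rank (λ k → V⊗V.*ₗ-congʳ
           (⟦⟧-cong (φ₀⁻¹ ∘ᴸ hom ϵᶜ) (·-comm (basis k) (basis l))))) ⟩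
    Σ⊗.sum (λ l → Σ⊗.sum (λ k → g l k ·ₜ (dual l ⊗ₑ dual k)))
      ≈⟨ Σ⊗.sum-cong rank (λ l → V⊗V.≈ᴹ-trans (⟦⟧-cong (tensorˡ V V (dual l)) (dual-expansion (basis l)))
           (V⊗V.≈ᴹ-trans (map-sum (tensorˡ V V (dual l)) (λ k → g l k V.*ₗ dual k))
             (Σ⊗.sum-cong rank (λ k → relation (·ʳ (g l k) (dual l) (dual k)))))) ⟨
    Σ⊗.sum (λ l → dual l ⊗ₑ basis l) ∎
    where
    open SetoidReasoning V⊗V.≈ᴹ-setoid
    g : Fin rank → Fin rank → CommutativeRing.Carrier R
    g k l = trace (basis k · basis l)

  -- Both sides are `Δⱽ` of `x`, expanded once from `x · unit` and once from `unit · x`.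
  copairing-moves : ∀ x → Σ⊗.sum (λ k → (x · basis k) ⊗ₑ dual k) V⊗V.≈ᴹ Σ⊗.sum (λ k → basis k ⊗ₑ (x · dual k))
  copairing-moves x = begin
    Σ⊗.sum (λ k → (x · basis k) ⊗ₑ dual k)
      ≈⟨ Σ⊗.sum-cong rank (λ k → relation (⊗-cong V.≈ᴹ-refl (·-unitʳ _))) ⟨
    Σ⊗.sum (λ k → (x · basis k) ⊗ₑ (dual k · unit))  ≈⟨ Δ-expansion x unit ⟨
    ⟦ Δⱽ ⟧ (x · unit)                                ≈⟨ ⟦⟧-cong Δⱽ (·-comm x unit) ⟩
    ⟦ Δⱽ ⟧ (unit · x)                                ≈⟨ Δ-expansion unit x ⟩
    Σ⊗.sum (λ k → (unit · basis k) ⊗ₑ (dual k · x))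
      ≈⟨ Σ⊗.sum-cong rank (λ k → relation (⊗-cong (·-unitˡ _) (·-comm _ _))) ⟩
    Σ⊗.sum (λ k → basis k ⊗ₑ (x · dual k))           ∎
    where open SetoidReasoning V⊗V.≈ᴹ-setoid

  module _ (m²≋μΔ : hom (mᶜ ∘ᶜ mᶜ) ≋ hom (μᶜ ∘ᶜ Δᶜ)) where

    handle : ΣV.sum (λ k → basis k · dual k) V.≈ᴹ κ · κ
    handle = begin
      ΣV.sum (λ k → basis k · dual k)              ≈⟨ map-sum μⱽ (λ k → basis k ⊗ₑ dual k) ⟨
      ⟦ μⱽ ⟧ (Σ⊗.sum (λ k → basis k ⊗ₑ dual k))    ≈⟨ ⟦⟧-cong μⱽ (proj₂ Δ-unit) ⟨
      ⟦ μⱽ ⟧ (⟦ Δⱽ ⟧ unit)                         ≈⟨ ⟦⟧-cong (hom μᶜ) (φ-φ⁻¹ 1 1 _) ⟩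
      ⟦ hom μᶜ ⟧ (⟦ hom Δᶜ ⟧ unit)                 ≈⟨ hom-∘ μᶜ Δᶜ unit ⟨
      ⟦ hom (μᶜ ∘ᶜ Δᶜ) ⟧ unit                      ≈⟨ m²≋μΔ unit ⟨
      ⟦ hom (mᶜ ∘ᶜ mᶜ) ⟧ unit                      ≈⟨ hom-∘ mᶜ mᶜ unit ⟩
      ⟦ mⱽ ⟧ κ                                     ≈⟨ m-κ κ ⟩
      κ · κ                                        ∎
      where open SetoidReasoning V.≈ᴹ-setoid

-- Edge maps on pure tensors

module Decorations {c ℓ v ℓv} (R : CommutativeRing c ℓ) (𝓕 : MTQFT R v ℓv)
                   (Γ : PerfectMatchingGraph) where

  open PerfectMatchingGraph Γ using (∣M∣)
  open LinearAlgebra R hiding (~-sym; ·-cong; ·-assoc)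
  open LinearMap using (⟦⟧-cong; +ᴹ-homo; *ₗ-homo)
  open MTQFT 𝓕 using (V)
  open Frobenius R 𝓕
  open States Γ
  open Ends Γ
  open Cube R 𝓕 Γ using (TupleOn; V^)
  open ListProduct ·-commutativeMonoid
  open CommutativeMonoid ·-commutativeMonoid using (∙-cong; ∙-congˡ; ∙-congʳ; commutativeSemigroup)
  open import Algebra.Properties.CommutativeSemigroup commutativeSemigroup using (xy∙z≈xz∙y)
  open Func

  private
    module V = Module V
    module V⊗V = Module (V ⊗ V)

  infix 4 _~[_]_
  _~[_]_ : End → State ∣M∣ → End → Set
  x ~[ β ] y = β ⊢ x ≈ y

  ~-sym : ∀ {β x y} → x ~[ β ] y → y ~[ β ] x
  ~-sym = EqC.symmetric _

  Decoration : Set v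
  Decoration = End → V.Carrierᴹ

  infixl 8 _[_↦_]
  -- Multiplies the vector at `p` instead of replacing it, so marks commute and accumulate, even at
  -- the same end.
  _[_↦_] : Decoration → End → V.Carrierᴹ → Decoration
  (g [ p ↦ a ]) y = g y · when (does (y ≟ᴱ p)) a

  module _ (β : State ∣M∣) where

    value : Decoration → End → V.Carrierᴹ
    value g x = ∏ ends (λ y → when (does (≈? β y x)) (g y))

    value-resp : ∀ g {x y} → x ~[ β ] y → value g x V.≈ᴹ value g y
    value-resp g {x} {y} p = ∏-cong ends λ z → V.≈ᴹ-reflexive
      (≡.cong (λ b → when b (g z)) (does-⇔ (mk⇔ (_◅◅ p) (_◅◅ ~-sym p)) (≈? β z x) (≈? β z y)))

    tuple : Decoration → TupleOn β
    tuple g = record { to = value g ; cong = value-resp g }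

    π : Decoration → Module.Carrierᴹ (V^ β)
    π g = gen (tuple g)

    infix 4 _≅_
    -- The identification of decorations that have the same vector on every circle of `β`. Being a
    -- record, it lets `g` and `h` be inferred from a proof.
    record _≅_ (g h : Decoration) : Set ℓv where
      constructor pointwise
      field at : ∀ x → value g x V.≈ᴹ value h x

    open _≅_ public

    ≅-setoid : Setoid v ℓv
    ≅-setoid = record
      { Carrier = Decoration
      ; _≈_ = _≅_
      ; isEquivalence = record
        { refl  = pointwise λ x → V.≈ᴹ-refl
        ; sym   = λ p → pointwise λ x → V.≈ᴹ-sym (at p x)
        ; trans = λ p q → pointwise λ x → V.≈ᴹ-trans (at p x) (at q x)
        }
      }

    open Setoid ≅-setoid public using () renaming (refl to ≅-refl; trans to ≅-trans)

    value-mark : ∀ g p a x → value (g [ p ↦ a ]) x V.≈ᴹ value g x · when (does (≈? β p x)) a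
    value-mark g p a x = begin
      value (g [ p ↦ a ]) x
        ≈⟨ ∏-cong ends (λ y → when-∙ (does (≈? β y x)) (g y) _) ⟩
      ∏ ends (λ y → when (does (≈? β y x)) (g y) · when (does (≈? β y x)) (when (does (y ≟ᴱ p)) a))
        ≈⟨ ∏-∙ ends _ _ ⟩
      value g x · ∏ ends (λ y → when (does (≈? β y x)) (when (does (y ≟ᴱ p)) a))
        ≈⟨ ∙-congˡ (∏-cong ends swapped) ⟩
      value g x · ∏ ends (λ y → when (does (y ≟ᴱ p)) (when (does (≈? β p x)) a))
        ≈⟨ ∙-congˡ (∏-single _≟ᴱ_ ends-unique (∈-ends p)) ⟩
      value g x · when (does (≈? β p x)) a ∎
      where
      open SetoidReasoning V.≈ᴹ-setoid
      swapped : ∀ y → when (does (≈? β y x)) (when (does (y ≟ᴱ p)) a) V.≈ᴹ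
                      when (does (y ≟ᴱ p)) (when (does (≈? β p x)) a)
      swapped y with y ≟ᴱ p
      ... | yes refl = V.≈ᴹ-refl
      ... | no _     = when-ε (does (≈? β y x))

    value-mark-on : ∀ g {p a x} → p ~[ β ] x → value (g [ p ↦ a ]) x V.≈ᴹ value g x · a
    value-mark-on g {p} {a} {x} q = V.≈ᴹ-trans (value-mark g p a x) (∙-congˡ (when-yes (≈? β p x) q))

    value-mark-off : ∀ g {p a x} → ¬ p ~[ β ] x → value (g [ p ↦ a ]) x V.≈ᴹ value g x
    value-mark-off g {p} {a} {x} ¬q = V.≈ᴹ-trans (value-mark g p a x)
      (V.≈ᴹ-trans (∙-congˡ (when-no (≈? β p x) ¬q)) (·-unitʳ _))

    mark-cong : ∀ {g h} → g ≅ h → ∀ p {a b} → a V.≈ᴹ b → g [ p ↦ a ] ≅ h [ p ↦ b ]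
    mark-cong {g} {h} g≅h p {a} {b} a≈b = pointwise λ x → V.≈ᴹ-trans (value-mark g p a x)
      (V.≈ᴹ-trans (∙-cong (at g≅h x) (when-cong _ a≈b)) (V.≈ᴹ-sym (value-mark h p b x)))

    mark-congˡ : ∀ {g h} → g ≅ h → ∀ p a → g [ p ↦ a ] ≅ h [ p ↦ a ]
    mark-congˡ g≅h p a = mark-cong g≅h p V.≈ᴹ-refl

    mark-congʳ : ∀ g p {a b} → a V.≈ᴹ b → g [ p ↦ a ] ≅ g [ p ↦ b ]
    mark-congʳ g p = mark-cong (≅-refl {g}) p

    mark-slide : ∀ g {p q} a → p ~[ β ] q → g [ p ↦ a ] ≅ g [ q ↦ a ]
    mark-slide g {p} {q} a p~q = pointwise λ x → V.≈ᴹ-trans (value-mark g p a x)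
      (V.≈ᴹ-trans (∙-congˡ (V.≈ᴹ-reflexive (≡.cong (λ b → when b a)
        (does-⇔ (mk⇔ (~-sym p~q ◅◅_) (p~q ◅◅_)) (≈? β p x) (≈? β q x)))))
        (V.≈ᴹ-sym (value-mark g q a x)))

    mark-comm : ∀ g p a q b → g [ p ↦ a ] [ q ↦ b ] ≅ g [ q ↦ b ] [ p ↦ a ]
    mark-comm g p a q b = pointwise λ x →
      ∏-cong ends (λ y → when-cong (does (≈? β y x)) (xy∙z≈xz∙y _ _ _))

    mark-· : ∀ g p a b → g [ p ↦ a ] [ p ↦ b ] ≅ g [ p ↦ a · b ]
    mark-· g p a b = pointwise λ x → ∏-cong ends (λ y → when-cong (does (≈? β y x))
      (V.≈ᴹ-trans (·-assoc _ _ _) (∙-congˡ (V.≈ᴹ-sym (when-∙ (does (y ≟ᴱ p)) a b)))))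

    mark-merge : ∀ g {p q} → p ~[ β ] q → ∀ a b → g [ p ↦ a ] [ q ↦ b ] ≅ g [ p ↦ a · b ]
    mark-merge g {p} p~q a b = ≅-trans (mark-slide (g [ p ↦ a ]) b (~-sym p~q)) (mark-· g p a b)

    mark-unit : ∀ g p → g [ p ↦ unit ] ≅ g
    mark-unit g p = pointwise λ x → V.≈ᴹ-trans (value-mark g p unit x)
      (V.≈ᴹ-trans (∙-congˡ (when-ε (does (≈? β p x)))) (·-unitʳ _))

    private module W = Module (V^ β)

    π-cong : ∀ {g h} → g ≅ h → π g W.≈ᴹ π h
    π-cong p = relation (⨂-cong (at p))

    π-mark : Decoration → End → LinearMap V (V^ β)
    π-mark g p = linear (λ a → π (g [ p ↦ a ]))
      (λ a≈b → π-cong (mark-congʳ g p a≈b))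
      (λ a b → relation (⨂-+ p (off _ _) (off _ _)
        (V.≈ᴹ-trans (value-mark-on g ε) (V.≈ᴹ-trans (+ᴹ-homo (multiply (value g p)) a b)
          (V.≈ᴹ-sym (V.+ᴹ-cong (value-mark-on g ε) (value-mark-on g ε)))))))
      (λ r a → relation (⨂-· p r (off _ _)
        (V.≈ᴹ-trans (value-mark-on g ε) (V.≈ᴹ-trans (*ₗ-homo (multiply (value g p)) r a)
          (V.≈ᴹ-sym (V.*ₗ-congˡ (value-mark-on g ε)))))))
      where
      off : ∀ a b → SameOff (Circles β) V p (tuple (g [ p ↦ a ])) (tuple (g [ p ↦ b ]))
      off a b x x≁p = V.≈ᴹ-trans (value-mark-off g (x≁p ∘ ~-sym))
        (V.≈ᴹ-sym (value-mark-off g (x≁p ∘ ~-sym)))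

    -- Bilinear even if `p` and `q` lie on one circle: in either variable it is `π-mark` with the
    -- other mark absorbed into the decoration, once `exchange` has brought the variable mark last.
    π-mark₂ : Decoration → End → End → LinearMap (V ⊗ V) (V^ β)
    π-mark₂ g p q = lift (V^ β) (λ (a , b) → π (g [ p ↦ a ] [ q ↦ b ])) λ where
        (⊗-cong a≈ b≈) → π-cong (mark-cong (mark-congʳ g p a≈) q b≈)
        (+ˡ a a′ b) → W.≈ᴹ-trans (exchange _ b) (W.≈ᴹ-trans (+ᴹ-homo (π-mark (g [ q ↦ b ]) p) a a′)
                        (W.+ᴹ-cong (W.≈ᴹ-sym (exchange a b)) (W.≈ᴹ-sym (exchange a′ b))))
        (+ʳ a b b′) → +ᴹ-homo (π-mark (g [ p ↦ a ]) q) b b′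
        (·ˡ r a b)  → W.≈ᴹ-trans (exchange _ b) (W.≈ᴹ-trans (*ₗ-homo (π-mark (g [ q ↦ b ]) p) r a)
                        (W.*ₗ-congˡ (W.≈ᴹ-sym (exchange a b))))
        (·ʳ r a b)  → *ₗ-homo (π-mark (g [ p ↦ a ]) q) r b
      where
      exchange : ∀ a b → π (g [ p ↦ a ] [ q ↦ b ]) W.≈ᴹ π (g [ q ↦ b ] [ p ↦ a ])
      exchange a b = π-cong (mark-comm g p a q b)

  -- The first end of each circle in the list of all ends carries its vector.
  module _ (β : State ∣M∣) (f : TupleOn β) where

    private
      first : End → Maybe End
      first x = head (filter (λ y → ≈? β y x) ends)

      first-cong : ∀ {x y} → x ~[ β ] y → first x ≡ first y
      first-cong p = ≡.cong head (filter-≐ _ _ ((_◅◅ p) , (_◅◅ ~-sym p)) ends)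

      first-∃ : ∀ x → ∃ λ r → first x ≡ just r × r ~[ β ] x
      first-∃ x with filter (λ y → ≈? β y x) ends in eq
      ... | [] with ≡.subst (x ∈_) eq (∈-filter⁺ (λ y → ≈? β y x) (∈-ends x) ε)
      ...   | ()
      first-∃ x | r ∷ _ = r , refl ,
        proj₂ (∈-filter⁻ (λ y → ≈? β y x) {xs = ends} (≡.subst (r ∈_) (≡.sym eq) (here refl)))

      first? : ∀ y → Dec (first y ≡ just y)
      first? y = Maybe-≡-dec _≟ᴱ_ (first y) (just y)

    decoration : Decoration
    decoration y = when (does (first? y)) (to f y)

    value-decoration : ∀ x → value β decoration x V.≈ᴹ to f x
    value-decoration x with first-∃ x
    ... | r , first≡r , r~x = V.≈ᴹ-trans (∏-cong ends term) (∏-single _≟ᴱ_ ends-unique (∈-ends r))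
      where
      term : ∀ y → when (does (≈? β y x)) (when (does (first? y)) (to f y)) V.≈ᴹ
                   when (does (y ≟ᴱ r)) (to f x)
      term y = when-× (≈? β y x) (first? y) (y ≟ᴱ r)
        (λ y~x p → just-injective (≡.trans (≡.sym p) (≡.trans (first-cong y~x) first≡r)))
        (λ { refl → r~x , ≡.trans (first-cong r~x) first≡r })
        (cong f)

  π-surjective : ∀ β (f : TupleOn β) → Module._≈ᴹ_ (V^ β) (gen f) (π β (decoration β f))
  π-surjective β f = relation (⨂-cong (λ x → V.≈ᴹ-sym (value-decoration β f x)))

  -- Stands for the element ∑ₖ left k ⊗ right k of V ⊗ V.
  record Weight : Set v where
    field
      terms       : ℕ
      left right  : Fin terms → V.Carrierᴹ

  open Weight public

  single : V.Carrierᴹ → Weight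
  single a = record { terms = 1 ; left = λ _ → a ; right = λ _ → unit }

  copairing : Weight
  copairing = record { terms = rank ; left = basis ; right = dual }

  module _ (β : State ∣M∣) where

    open ModuleSum (V^ β) using (sum)

    weigh : Weight → End → End → Decoration → Module.Carrierᴹ (V^ β)
    weigh w p q g = sum {terms w} (λ k → π β (g [ p ↦ left w k ] [ q ↦ right w k ]))

    weigh-single : ∀ a p q g → Module._≈ᴹ_ (V^ β) (weigh (single a) p q g) (π β (g [ p ↦ a ]))
    weigh-single a p q g = W.≈ᴹ-trans (W.+ᴹ-identityʳ _) (π-cong β (mark-unit β (g [ p ↦ a ]) q))
      where module W = Module (V^ β)

  -- The change of smoothing at j multiplies by a weight on the ends ↖ and ↗
  -- that depends on whether they are joined before and after.
  kind : Bool → Bool → Weight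
  kind true  true  = single κ
  kind true  false = copairing
  kind false _     = single unit

  Joined : Fin ∣M∣ → State ∣M∣ → Set
  Joined j α = (j , ↖) ~[ α ] (j , ↗)

  joined? : ∀ j α → Dec (Joined j α)
  joined? j α = ≈? α (j , ↖) (j , ↗)

  touches-joined : ∀ {j β x} → Joined j β → Touches β j x → x ~[ β ] (j , ↖)
  touches-joined joined = [ id , _◅◅ ~-sym joined ]

  module _ {j : Fin ∣M∣} {α α′ : State ∣M∣} (agree : AgreeOff j α α′) where

    open Cube R 𝓕 Γ using
      (pick; place; untouched; changeMap; mergeMap; splitMap; oneToOneMap; edgeMap; insert)

    private
      module W = Module (V^ α′)
      u  = (j , ↖)
      u′ = (j , ↗)

    touches-transfer : ∀ {x} → Touches α j x → Touches α′ j x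
    touches-transfer = transfer-touches agree

    touches-transfer⁻ : ∀ {x} → Touches α′ j x → Touches α j x
    touches-transfer⁻ = transfer-touches (agree-sym α α′ agree)

    pick-elim : ∀ {p q} {P : Set p} {Q : Set q} (P? : Dec P) (Q? : Dec Q) {a b d w} →
                (P → a V.≈ᴹ w) → (¬ P → Q → b V.≈ᴹ w) → (¬ P → ¬ Q → d V.≈ᴹ w) →
                pick {j} {α} {α′} agree P? Q? a b d V.≈ᴹ w
    pick-elim (yes p) _       on₁ on₂ off = on₁ p
    pick-elim (no ¬p) (yes q) on₁ on₂ off = on₂ ¬p q
    pick-elim (no ¬p) (no ¬q) on₁ on₂ off = off ¬p ¬q

    place-elim : ∀ {a b} (f : TupleOn α) x {w} →
                 (x ~[ α′ ] u → a V.≈ᴹ w) →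
                 (¬ x ~[ α′ ] u → x ~[ α′ ] u′ → b V.≈ᴹ w) →
                 (¬ Touches α′ j x → to f x V.≈ᴹ w) →
                 to (place agree a b f) x V.≈ᴹ w
    place-elim f x on-↖ on-↗ off =
      pick-elim (≈? α′ x u) (≈? α′ x u′) on-↖ on-↗ (λ ¬p ¬q → off [ ¬p , ¬q ])

    value-off : ∀ g {x} → ¬ Touches α′ j x → value α g x V.≈ᴹ value α′ g x
    value-off g {x} ¬t = ∏-cong ends λ y → V.≈ᴹ-reflexive (≡.cong (λ b → when b (g y))
      (does-⇔ (mk⇔ (~-sym ∘ transfer-≈ agree ¬t ∘ ~-sym) (~-sym ∘ untouched agree ¬t ∘ ~-sym))
              (≈? α y x) (≈? α′ y x)))

    -- If `j` meets a single circle, that circle consists of the ends touching `j`, and touching `j`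
    -- does not depend on the smoothing there. The same remark gives the circles in `value-merge`
    -- and `value-split`.
    value-same : Joined j α → Joined j α′ → ∀ g → value α g u V.≈ᴹ value α′ g u
    value-same before after g = ∏-cong ends λ y → V.≈ᴹ-reflexive (≡.cong (λ b → when b (g y))
      (does-⇔ (mk⇔ (touches-joined after ∘ touches-transfer ∘ inj₁)
                   (touches-joined before ∘ touches-transfer⁻ ∘ inj₁))
              (≈? α y u) (≈? α′ y u)))

    value-merge : ¬ Joined j α → Joined j α′ → ∀ g →
                  value α′ g u V.≈ᴹ value α g u · value α g u′
    value-merge apart joined g = V.≈ᴹ-trans
      (∏-cong ends λ y → when-⊎ (≈? α′ y u) (≈? α y u) (≈? α y u′)
        (touches-transfer⁻ ∘ inj₁)
        (touches-joined joined ∘ touches-transfer ∘ inj₁)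
        (touches-joined joined ∘ touches-transfer ∘ inj₂)
        (λ p q → apart (~-sym p ◅◅ q)) (g y))
      (∏-∙ ends _ _)

    value-split : Joined j α → ¬ Joined j α′ → ∀ g →
                  value α g u V.≈ᴹ value α′ g u · value α′ g u′
    value-split joined apart g = V.≈ᴹ-trans
      (∏-cong ends λ y → when-⊎ (≈? α y u) (≈? α′ y u) (≈? α′ y u′)
        (touches-transfer ∘ inj₁)
        (touches-joined joined ∘ touches-transfer⁻ ∘ inj₁)
        (touches-joined joined ∘ touches-transfer⁻ ∘ inj₂)
        (λ p q → apart (~-sym p ◅◅ q)) (g y))
      (∏-∙ ends _ _)

    merge-π : ∀ apart joined g → ⟦ mergeMap agree apart joined ⟧ (π α g) W.≈ᴹ π α′ g
    merge-π apart joined g = relation (⨂-cong λ x → place-elim (tuple α g) x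
      (λ p → V.≈ᴹ-trans (V.≈ᴹ-sym (value-merge apart joined g)) (value-resp α′ g (~-sym p)))
      (λ ¬p q → ⊥-elim (¬p (q ◅◅ ~-sym joined)))
      (value-off g))

    oneToOne-π : ∀ before after g → ⟦ oneToOneMap agree before after ⟧ (π α g) W.≈ᴹ π α′ (g [ u ↦ κ ])
    oneToOne-π before after g = relation (⨂-cong λ x → place-elim (tuple α g) x
      (λ p → V.≈ᴹ-trans (m-κ _) (V.≈ᴹ-trans (·-comm κ _)
        (V.≈ᴹ-trans (∙-congʳ (V.≈ᴹ-trans (value-same before after g) (value-resp α′ g (~-sym p))))
          (V.≈ᴹ-sym (value-mark-on α′ g (~-sym p))))))
      (λ ¬p q → ⊥-elim (¬p (q ◅◅ ~-sym after)))
      (λ ¬t → V.≈ᴹ-trans (value-off g ¬t) (V.≈ᴹ-sym (value-mark-off α′ g (¬t ∘ inj₁ ∘ ~-sym)))))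

    -- The vector on the circle is the product of the vectors of its two parts, and `Δ-expansion` at
    -- that product leaves each part with its own vector times one leg of the copairing.
    split-π : ∀ joined apart g →
              ⟦ splitMap agree apart joined ⟧ (π α g) W.≈ᴹ weigh α′ copairing u u′ g
    split-π joined apart g = begin
      ⟦ ins ⟧ (⟦ MTQFT.Δⱽ 𝓕 ⟧ (value α g u))
        ≈⟨ ⟦⟧-cong ins (V⊗V.≈ᴹ-trans (⟦⟧-cong (MTQFT.Δⱽ 𝓕) (value-split joined apart g)) (Δ-expansion _ _)) ⟩
      ⟦ ins ⟧ (ModuleSum.sum (V ⊗ V) (λ k → (value α′ g u · basis k) ⊗ₑ (dual k · value α′ g u′)))
        ≈⟨ map-sum ins (λ k → (value α′ g u · basis k) ⊗ₑ (dual k · value α′ g u′)) ⟩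
      sum (λ k → gen (place agree (value α′ g u · basis k) (dual k · value α′ g u′) (tuple α g)))
        ≈⟨ sum-cong rank (λ k → relation (⨂-cong (vector k))) ⟩
      weigh α′ copairing u u′ g ∎
      where
      open SetoidReasoning W.≈ᴹ-setoid
      open ModuleSum (V^ α′) using (sum; sum-cong)
      ins : LinearMap (V ⊗ V) (V^ α′)
      ins = insert agree apart (tuple α g)
      vector : ∀ k x → to (place agree (value α′ g u · basis k) (dual k · value α′ g u′) (tuple α g)) x V.≈ᴹ
                   value α′ (g [ u ↦ basis k ] [ u′ ↦ dual k ]) x
      vector k x = place-elim (tuple α g) x
        (λ p → V.≈ᴹ-sym (V.≈ᴹ-trans (value-mark-off α′ (g [ u ↦ basis k ]) (λ q → apart (~-sym (q ◅◅ p))))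
          (V.≈ᴹ-trans (value-mark-on α′ g (~-sym p)) (∙-congʳ (value-resp α′ g p)))))
        (λ ¬p q → V.≈ᴹ-sym (V.≈ᴹ-trans (value-mark-on α′ (g [ u ↦ basis k ]) (~-sym q))
          (V.≈ᴹ-trans (∙-congʳ (V.≈ᴹ-trans (value-mark-off α′ g (¬p ∘ ~-sym)) (value-resp α′ g q))) (·-comm _ _))))
        (λ ¬t → V.≈ᴹ-trans (value-off g ¬t) (V.≈ᴹ-sym
          (V.≈ᴹ-trans (value-mark-off α′ (g [ u ↦ basis k ]) (¬t ∘ inj₂ ∘ ~-sym))
            (value-mark-off α′ g (¬t ∘ inj₁ ∘ ~-sym)))))

    module _ (join : ¬ Joined j α → ¬ ¬ Joined j α′) where

      -- `join` is what trivalence provides. It excludes the clause in which `changeMap` is zero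
      -- while `kind` is the unit.
      change-π : ∀ (before : Dec (Joined j α)) (after : Dec (Joined j α′)) g →
                 ⟦ changeMap agree before after ⟧ (π α g) W.≈ᴹ
                 weigh α′ (kind (does before) (does after)) u u′ g
      change-π (no p)  (yes q) g = W.≈ᴹ-trans (merge-π p q g)
        (W.≈ᴹ-sym (W.≈ᴹ-trans (weigh-single α′ unit u u′ g) (π-cong α′ (mark-unit α′ g u))))
      change-π (yes p) (no q)  g = split-π p q g
      change-π (yes p) (yes q) g = W.≈ᴹ-trans (oneToOne-π p q g)
        (W.≈ᴹ-sym (weigh-single α′ κ u u′ g))
      change-π (no p)  (no q)  g = ⊥-elim (join p q)

      -- The decisions are arguments, so that an edge can be evaluated with whichever proofs a case
      -- analysis has found.
      edge-π : ∀ (before : Dec (Joined j α)) (after : Dec (Joined j α′)) g →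
               ⟦ edgeMap agree ⟧ (π α g) W.≈ᴹ weigh α′ (kind (does before) (does after)) u u′ g
      edge-π before after g = W.≈ᴹ-trans (change-π (joined? j α) (joined? j α′) g)
        (W.≈ᴹ-reflexive (≡.cong₂ (λ a b → weigh α′ (kind a b) u u′ g)
          (does-≡ (joined? j α) before) (does-≡ (joined? j α′) after)))

-- Commutativity of faces

compare : ∀ {p q x} {P : Set p} {Q : Set q} {X : Set x} (P? : Dec P) (Q? : Dec Q) →
          (¬ P → Q → X) → (P → ¬ Q → X) → (does P? ≡ does Q? → X) → X
compare (yes p) (yes q) gain loss same = same refl
compare (yes p) (no ¬q) gain loss same = loss p ¬q
compare (no ¬p) (yes q) gain loss same = gain ¬p q
compare (no ¬p) (no ¬q) gain loss same = same refl

module Faces {c ℓ v ℓv} (R : CommutativeRing c ℓ) (𝓕 : MTQFT R v ℓv)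
             (m²≋μΔ : LinearAlgebra._≋_ R (MTQFT.hom 𝓕 (mᶜ ∘ᶜ mᶜ)) (MTQFT.hom 𝓕 (μᶜ ∘ᶜ Δᶜ)))
             (Γ : PerfectMatchingGraph) where

  open PerfectMatchingGraph Γ using (∣M∣)
  open LinearAlgebra R hiding (~-sym; ·-cong; ·-assoc)
  open LinearMap using (⟦⟧-cong)
  open MTQFT 𝓕 using (V; μⱽ)
  open Frobenius R 𝓕
  open States Γ
  open Cube R 𝓕 Γ using (V^; edgeMap)
  open Decorations R 𝓕 Γ
  open CommutativeMonoid ·-commutativeMonoid using (∙-cong)

  private
    module V = Module V
    module ΣV = ModuleSum V
    module Σ⊗ = ModuleSum (V ⊗ V)

  total : Weight → V.Carrierᴹ
  total w = ΣV.sum {terms w} (λ k → left w k · right w k)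

  total-single : ∀ a → total (single a) V.≈ᴹ a
  total-single a = V.≈ᴹ-trans (V.+ᴹ-identityʳ _) (·-unitʳ a)

  module _ (β : State ∣M∣) where

    private module W = Module (V^ β)
    open ModuleSum (V^ β)

    weigh₂ : Weight → End → End → Weight → End → End → Decoration → W.Carrierᴹ
    weigh₂ w p q z r s g = sum {terms w} (λ k → weigh β z r s (g [ p ↦ left w k ] [ q ↦ right w k ]))

    weigh₂-comm : ∀ w p q z r s g → weigh₂ w p q z r s g W.≈ᴹ weigh₂ z r s w p q g
    weigh₂-comm w p q z r s g = W.≈ᴹ-trans
      (∑-comm {terms w} {terms z} (λ k l → π β (g [ p ↦ left w k ] [ q ↦ right w k ] [ r ↦ left z l ] [ s ↦ right z l ])))
      (sum-cong (terms z) λ l → sum-cong (terms w) λ k → π-cong β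
        (exchange (left w k) (right w k) (left z l) (right z l)))
      where
      past : ∀ h a b r d → _≅_ β (h [ p ↦ a ] [ q ↦ b ] [ r ↦ d ]) (h [ r ↦ d ] [ p ↦ a ] [ q ↦ b ])
      past h a b r d = ≅-trans β (mark-comm β (h [ p ↦ a ]) q b r d)
        (mark-congˡ β (mark-comm β h p a r d) q b)
      exchange : ∀ a b d e → _≅_ β (g [ p ↦ a ] [ q ↦ b ] [ r ↦ d ] [ s ↦ e ])
                                   (g [ r ↦ d ] [ s ↦ e ] [ p ↦ a ] [ q ↦ b ])
      exchange a b d e = ≅-trans β (mark-congˡ β (past g a b r d) s e) (past (g [ r ↦ d ]) a b s e)

    module _ {u u′ v v′ : End} where

      OneCircle : Set
      OneCircle = u ~[ β ] u′ × u ~[ β ] v × u ~[ β ] v′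

      Matched : Set
      Matched = (u ~[ β ] v × u′ ~[ β ] v′) ⊎ (u ~[ β ] v′ × u′ ~[ β ] v)

      weigh₂-oneCircle : OneCircle → ∀ w z g →
                         weigh₂ w u u′ z v v′ g W.≈ᴹ π β (g [ u ↦ total w · total z ])
      weigh₂-oneCircle (uu′ , uv , uv′) w z g = begin
        weigh₂ w u u′ z v v′ g
          ≈⟨ sum-cong (terms w) (λ k → sum-cong (terms z) (λ l → π-cong β
               (collect (left w k) (right w k) (left z l) (right z l)))) ⟩
        sum {terms w} (λ k → sum {terms z} (λ l → π β (g [ u ↦ x k · y l ])))
          ≈⟨ sum-cong (terms w) (λ k → map-sum (π-mark β g u ∘ᴸ multiply (x k)) y) ⟨
        sum {terms w} (λ k → π β (g [ u ↦ x k · total z ]))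
          ≈⟨ map-sum (π-mark β g u ∘ᴸ μⱽ ∘ᴸ tensorʳ V V (total z)) x ⟨
        π β (g [ u ↦ total w · total z ]) ∎
        where
        open SetoidReasoning W.≈ᴹ-setoid
        x : Fin (terms w) → V.Carrierᴹ
        x k = left w k · right w k
        y : Fin (terms z) → V.Carrierᴹ
        y l = left z l · right z l
        collect : ∀ a b d e → _≅_ β (g [ u ↦ a ] [ u′ ↦ b ] [ v ↦ d ] [ v′ ↦ e ]) (g [ u ↦ (a · b) · (d · e) ])
        collect a b d e = ≅-trans β (mark-merge β (g [ u ↦ a ] [ u′ ↦ b ]) (~-sym uv ◅◅ uv′) d e)
          (≅-trans β (mark-congˡ β (mark-merge β g uu′ a b) v (d · e))
            (mark-merge β g uv (a · b) (d · e)))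

      -- If the corners are matched in parallel, the marks only slide. If they are matched
      -- crosswise, the legs of the copairing have changed places and `x` sits on the other circle:
      -- `copairing-symmetric` repairs the first, `copairing-moves` the second.
      weigh₂-matched : Matched → ∀ x g →
                       weigh₂ (single x) u u′ copairing v v′ g W.≈ᴹ weigh₂ copairing u u′ (single x) v v′ g
      weigh₂-matched matched x g = begin
        weigh₂ (single x) u u′ copairing v v′ g
          ≈⟨ weigh₂-comm (single x) u u′ copairing v v′ g ⟩
        weigh₂ copairing v v′ (single x) u u′ g
          ≈⟨ sum-cong rank (λ k → weigh-single β x u u′ (g [ v ↦ basis k ] [ v′ ↦ dual k ])) ⟩
        sum (λ k → π β (g [ v ↦ basis k ] [ v′ ↦ dual k ] [ u ↦ x ]))
          ≈⟨ go matched ⟩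
        sum (λ k → π β (g [ u ↦ basis k ] [ u′ ↦ dual k ] [ v ↦ x ]))
          ≈⟨ sum-cong rank (λ k → weigh-single β x v v′ (g [ u ↦ basis k ] [ u′ ↦ dual k ])) ⟨
        weigh₂ copairing u u′ (single x) v v′ g ∎
        where
        open SetoidReasoning W.≈ᴹ-setoid

        slide₂ : ∀ {p q r s} → p ~[ β ] r → q ~[ β ] s → ∀ a b →
                 _≅_ β (g [ p ↦ a ] [ q ↦ b ]) (g [ r ↦ a ] [ s ↦ b ])
        slide₂ {q = q} {r} pr qs a b =
          ≅-trans β (mark-congˡ β (mark-slide β g a pr) q b) (mark-slide β (g [ r ↦ a ]) b qs)

        absorb : ∀ {p q r} → r ~[ β ] p → ∀ a b →
                 _≅_ β (g [ p ↦ a ] [ q ↦ b ] [ r ↦ x ]) (g [ p ↦ x · a ] [ q ↦ b ])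
        absorb {p} {q} {r} rp a b = ≅-trans β (mark-comm β (g [ p ↦ a ]) q b r x)
          (mark-congˡ β (≅-trans β (mark-merge β g (~-sym rp) a x) (mark-congʳ β g p (·-comm a x))) q b)

        D : LinearMap (V ⊗ V) (V^ β)
        D = π-mark₂ β g u u′

        go : Matched → sum (λ k → π β (g [ v ↦ basis k ] [ v′ ↦ dual k ] [ u ↦ x ])) W.≈ᴹ
                       sum (λ k → π β (g [ u ↦ basis k ] [ u′ ↦ dual k ] [ v ↦ x ]))
        go (inj₁ (uv , u′v′)) = sum-cong rank λ k → π-cong β
          (≅-trans β (mark-congˡ β (slide₂ (~-sym uv) (~-sym u′v′) (basis k) (dual k)) u x)
            (mark-slide β (g [ u ↦ basis k ] [ u′ ↦ dual k ]) x uv))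
        go (inj₂ (uv′ , u′v)) = begin
          sum (λ k → π β (g [ v ↦ basis k ] [ v′ ↦ dual k ] [ u ↦ x ]))
            ≈⟨ sum-cong rank (λ k → π-cong β (first k)) ⟩
          sum (λ k → ⟦ D ⟧ ((x · dual k) ⊗ₑ basis k))
            ≈⟨ map-sum D (λ k → (x · dual k) ⊗ₑ basis k) ⟨
          ⟦ D ⟧ (Σ⊗.sum (λ k → (x · dual k) ⊗ₑ basis k))
            ≈⟨ ⟦⟧-cong D (map-sum (actˡ x) (λ k → dual k ⊗ₑ basis k)) ⟨
          ⟦ D ⟧ (⟦ actˡ x ⟧ (Σ⊗.sum (λ k → dual k ⊗ₑ basis k)))
            ≈⟨ ⟦⟧-cong (D ∘ᴸ actˡ x) copairing-symmetric ⟨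
          ⟦ D ⟧ (⟦ actˡ x ⟧ (Σ⊗.sum (λ k → basis k ⊗ₑ dual k)))
            ≈⟨ ⟦⟧-cong D (map-sum (actˡ x) (λ k → basis k ⊗ₑ dual k)) ⟩
          ⟦ D ⟧ (Σ⊗.sum (λ k → (x · basis k) ⊗ₑ dual k))
            ≈⟨ ⟦⟧-cong D (copairing-moves x) ⟩
          ⟦ D ⟧ (Σ⊗.sum (λ k → basis k ⊗ₑ (x · dual k)))
            ≈⟨ map-sum D (λ k → basis k ⊗ₑ (x · dual k)) ⟩
          sum (λ k → ⟦ D ⟧ (basis k ⊗ₑ (x · dual k)))
            ≈⟨ sum-cong rank (λ k → π-cong β (second k)) ⟨
          sum (λ k → π β (g [ u ↦ basis k ] [ u′ ↦ dual k ] [ v ↦ x ])) ∎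
          where
          first : ∀ k → _≅_ β (g [ v ↦ basis k ] [ v′ ↦ dual k ] [ u ↦ x ])
                              (g [ u ↦ x · dual k ] [ u′ ↦ basis k ])
          first k = ≅-trans β
            (mark-congˡ β (≅-trans β (mark-comm β g v (basis k) v′ (dual k))
              (slide₂ (~-sym uv′) (~-sym u′v) (dual k) (basis k))) u x)
            (absorb ε (dual k) (basis k))
          second : ∀ k → _≅_ β (g [ u ↦ basis k ] [ u′ ↦ dual k ] [ v ↦ x ])
                               (g [ u ↦ basis k ] [ u′ ↦ x · dual k ])
          second k = ≅-trans β (mark-congˡ β (mark-comm β g u (basis k) u′ (dual k)) v x)
            (≅-trans β (absorb (~-sym u′v) (dual k) (basis k))
              (mark-comm β g u′ (x · dual k) u (basis k)))

  -- Connections before and after one change of smoothing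

  module _ {j : Fin ∣M∣} {α α′ : State ∣M∣} (agree : AgreeOff j α α′) where

    -- Only circles touching `j` are affected, and in `α′` all of their ends lie on the single
    -- circle through `j`.
    coarsen : Joined j α′ → ∀ {x y} → x ~[ α ] y → x ~[ α′ ] y
    coarsen joined {x} {y} x~y with ≈? α′ x (j , ↖)
    ... | yes p = p ◅◅ ~-sym (touches-joined joined
                    (transfer-touches agree (touches-resp (~-sym x~y)
                      (transfer-touches (agree-sym α α′ agree) (inj₁ p)))))
    ... | no ¬p = transfer-≈ agree (¬p ∘ touches-joined joined) x~y

    newly-joined : ∀ {x y} → ¬ x ~[ α ] y → x ~[ α′ ] y → Touches α j x
    newly-joined {x} {y} x≁y x~′y with ≈? α x (j , ↖) | ≈? α x (j , ↗)
    ... | yes p | _     = inj₁ p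
    ... | no _  | yes q = inj₂ q
    ... | no ¬p | no ¬q = ⊥-elim (x≁y (transfer-≈ (agree-sym α α′ agree) [ ¬p , ¬q ] x~′y))

    -- A new connection runs through `j`, so `x` and `y` were each on the circle of ↖ or of ↗ of
    -- `j`, and not on the same one, being apart.
    newly-joined-matched : ∀ {x y} → ¬ x ~[ α ] y → x ~[ α′ ] y →
                           Matched α {x} {y} {j , ↖} {j , ↗}
    newly-joined-matched x≁y x~′y
      with newly-joined x≁y x~′y | newly-joined (x≁y ∘ ~-sym) (~-sym x~′y)
    ... | inj₁ p | inj₁ q = ⊥-elim (x≁y (p ◅◅ ~-sym q))
    ... | inj₁ p | inj₂ q = inj₁ (p , q)
    ... | inj₂ p | inj₁ q = inj₂ (p , q)
    ... | inj₂ p | inj₂ q = ⊥-elim (x≁y (p ◅◅ ~-sym q))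

  edge : ∀ {j} α α′ → AgreeOff j α α′ → LinearMap (V^ α) (V^ α′)
  edge α α′ agree = edgeMap {α = α} {α′ = α′} agree

  -- The four states are arbitrary. This keeps the notion symmetric in `i` and `j`, so that
  -- `transpose` halves the case analysis, and the two orders of raising entries, equal only
  -- propositionally, need not be compared here.
  record Face (i j : Fin ∣M∣) : Set where
    field
      {s₀₀ s₁₀ s₀₁ s₁₁} : State ∣M∣
      i₀ : AgreeOff i s₀₀ s₁₀
      i₁ : AgreeOff i s₀₁ s₁₁
      j₀ : AgreeOff j s₀₀ s₀₁
      j₁ : AgreeOff j s₁₀ s₁₁
      join-i₀ : ¬ Joined i s₀₀ → ¬ ¬ Joined i s₁₀
      join-i₁ : ¬ Joined i s₀₁ → ¬ ¬ Joined i s₁₁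
      join-j₀ : ¬ Joined j s₀₀ → ¬ ¬ Joined j s₀₁
      join-j₁ : ¬ Joined j s₁₀ → ¬ ¬ Joined j s₁₁

  transpose : ∀ {i j} → Face i j → Face j i
  transpose F = record
    { i₀ = j₀ ; i₁ = j₁ ; j₀ = i₀ ; j₁ = i₁
    ; join-i₀ = join-j₀ ; join-i₁ = join-j₁ ; join-j₀ = join-i₀ ; join-j₁ = join-i₁ }
    where open Face F

  Commutes : ∀ {i j} → Face i j → Set _
  Commutes F = ∀ g → ⟦ edge s₁₀ s₁₁ j₁ ⟧ (⟦ edge s₀₀ s₁₀ i₀ ⟧ (π s₀₀ g)) W.≈ᴹ ⟦ edge s₀₁ s₁₁ i₁ ⟧ (⟦ edge s₀₀ s₀₁ j₀ ⟧ (π s₀₀ g))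
    where
    open Face F
    module W = Module (V^ s₁₁)

  module _ {i j : Fin ∣M∣} (F : Face i j) where

    open Face F

    private
      module W = Module (V^ s₁₁)
      u  = (i , ↖)
      u′ = (i , ↗)
      v₀ = (j , ↖)
      v₁ = (j , ↗)

    two-edges : ∀ (a₀₀ : Dec (Joined i s₀₀)) (a₁₀ : Dec (Joined i s₁₀))
                  (b₁₀ : Dec (Joined j s₁₀)) (b₁₁ : Dec (Joined j s₁₁)) g →
                ⟦ edge s₁₀ s₁₁ j₁ ⟧ (⟦ edge s₀₀ s₁₀ i₀ ⟧ (π s₀₀ g)) W.≈ᴹ
                weigh₂ s₁₁ (kind (does a₀₀) (does a₁₀)) u u′ (kind (does b₁₀) (does b₁₁)) v₀ v₁ g
    two-edges a₀₀ a₁₀ b₁₀ b₁₁ g = begin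
      ⟦ edge s₁₀ s₁₁ j₁ ⟧ (⟦ edge s₀₀ s₁₀ i₀ ⟧ (π s₀₀ g))
        ≈⟨ ⟦⟧-cong (edge s₁₀ s₁₁ j₁) (edge-π i₀ join-i₀ a₀₀ a₁₀ g) ⟩
      ⟦ edge s₁₀ s₁₁ j₁ ⟧ (weigh s₁₀ w u u′ g)
        ≈⟨ map-sum (edge s₁₀ s₁₁ j₁) {terms w} (λ k → π s₁₀ (g [ u ↦ left w k ] [ u′ ↦ right w k ])) ⟩
      sum {terms w} (λ k → ⟦ edge s₁₀ s₁₁ j₁ ⟧ (π s₁₀ (g [ u ↦ left w k ] [ u′ ↦ right w k ])))
        ≈⟨ sum-cong (terms w) (λ k → edge-π j₁ join-j₁ b₁₀ b₁₁ (g [ u ↦ left w k ] [ u′ ↦ right w k ])) ⟩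
      weigh₂ s₁₁ w u u′ (kind (does b₁₀) (does b₁₁)) v₀ v₁ g ∎
      where
      open SetoidReasoning W.≈ᴹ-setoid
      open ModuleSum (V^ s₁₁)
      w = kind (does a₀₀) (does a₁₀)

  module _ {i j : Fin ∣M∣} (F : Face i j) where

    open Face F

    private
      module W = Module (V^ s₁₁)
      u  = (i , ↖)
      u′ = (i , ↗)
      v₀ = (j , ↖)
      v₁ = (j , ↗)

      OneCircleAt MatchedAt : State ∣M∣ → Set
      OneCircleAt α = OneCircle α {u} {u′} {v₀} {v₁}
      MatchedAt α = Matched α {u} {u′} {v₀} {v₁}

    -- The weight of `i` comes first on both sides, although the second path changes `j` first;
    -- `weigh₂-comm` restores its order.
    commutes-if : ∀ (a₀₀ : Dec (Joined i s₀₀)) (a₁₀ : Dec (Joined i s₁₀))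
                    (a₀₁ : Dec (Joined i s₀₁)) (a₁₁ : Dec (Joined i s₁₁))
                    (b₀₀ : Dec (Joined j s₀₀)) (b₁₀ : Dec (Joined j s₁₀))
                    (b₀₁ : Dec (Joined j s₀₁)) (b₁₁ : Dec (Joined j s₁₁)) →
                  (∀ g → weigh₂ s₁₁ (kind (does a₀₀) (does a₁₀)) u u′ (kind (does b₁₀) (does b₁₁)) v₀ v₁ g W.≈ᴹ
                         weigh₂ s₁₁ (kind (does a₀₁) (does a₁₁)) u u′ (kind (does b₀₀) (does b₀₁)) v₀ v₁ g) →
                  Commutes F
    commutes-if a₀₀ a₁₀ a₀₁ a₁₁ b₀₀ b₁₀ b₀₁ b₁₁ eq g =
      W.≈ᴹ-trans (two-edges F a₀₀ a₁₀ b₁₀ b₁₁ g) (W.≈ᴹ-trans (eq g)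
        (W.≈ᴹ-trans (weigh₂-comm s₁₁ (kind (does a₀₁) (does a₁₁)) u u′ (kind (does b₀₀) (does b₀₁)) v₀ v₁ g)
          (W.≈ᴹ-sym (two-edges (transpose F) b₀₀ b₀₁ a₀₁ a₁₁ g))))

    by-totals : OneCircleAt s₁₁ → ∀ w z w′ z′ → total w · total z V.≈ᴹ total w′ · total z′ →
                ∀ g → weigh₂ s₁₁ w u u′ z v₀ v₁ g W.≈ᴹ weigh₂ s₁₁ w′ u u′ z′ v₀ v₁ g
    by-totals one w z w′ z′ eq g = W.≈ᴹ-trans (weigh₂-oneCircle s₁₁ one w z g)
      (W.≈ᴹ-trans (⟦⟧-cong (π-mark s₁₁ g u) eq) (W.≈ᴹ-sym (weigh₂-oneCircle s₁₁ one w′ z′ g)))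

    κκ : total (single κ) · total (single κ) V.≈ᴹ total (single unit) · total copairing
    κκ = V.≈ᴹ-trans (∙-cong (total-single κ) (total-single κ)) (V.≈ᴹ-sym
      (V.≈ᴹ-trans (∙-cong (total-single unit) (handle m²≋μΔ)) (·-unitˡ _)))

    matched-joins : ∀ {α} → MatchedAt α → Joined i α → OneCircleAt α
    matched-joins (inj₁ (p , q)) uu′ = uu′ , p , uu′ ◅◅ q
    matched-joins (inj₂ (p , q)) uu′ = uu′ , uu′ ◅◅ q , p

    matched-apart : ∀ {α} → MatchedAt α → ¬ Joined i α → ¬ Joined j α
    matched-apart (inj₁ (p , q)) u≁u′ r = u≁u′ (p ◅◅ r ◅◅ ~-sym q)
    matched-apart (inj₂ (p , q)) u≁u′ r = u≁u′ (p ◅◅ ~-sym r ◅◅ ~-sym q)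

    matched-joins′ : ∀ {α} → MatchedAt α → Joined j α → OneCircleAt α
    matched-joins′ (inj₁ (p , q)) r = p ◅◅ r ◅◅ ~-sym q , p , p ◅◅ r
    matched-joins′ (inj₂ (p , q)) r = p ◅◅ ~-sym r ◅◅ ~-sym q , p ◅◅ ~-sym r , p

    one-joined : ∀ {α} → OneCircleAt α → Joined j α
    one-joined (_ , p , q) = ~-sym p ◅◅ q

    module _ {k : Fin ∣M∣} {α α′ : State ∣M∣} (agree : AgreeOff k α α′) (joined : Joined k α′) where

      coarsen-one : OneCircleAt α → OneCircleAt α′
      coarsen-one (p , q , r) = coarsen agree joined p , coarsen agree joined q , coarsen agree joined r

      coarsen-matched : MatchedAt α → MatchedAt α′
      coarsen-matched (inj₁ (p , q)) = inj₁ (coarsen agree joined p , coarsen agree joined q)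
      coarsen-matched (inj₂ (p , q)) = inj₂ (coarsen agree joined p , coarsen agree joined q)

    force : ∀ {k α α′} → (¬ Joined k α → ¬ ¬ Joined k α′) → ¬ Joined k α → Joined k α′
    force {k} {α} {α′} join apart with joined? k α′
    ... | yes p = p
    ... | no ¬p = ⊥-elim (join apart ¬p)

    force⁻ : ∀ {k α α′} → (¬ Joined k α → ¬ ¬ Joined k α′) → ¬ Joined k α′ → Joined k α
    force⁻ join apart′ = force (λ apart apart″ → join apart″ apart) apart′

    -- The change at j joins (gain) or separates (loss) the corners ↖ and ↗ of i,
    -- with i in its first (₀) or second (₁) smoothing.  Before a gain, or after
    -- a loss, i and j meet the same two circles; otherwise one circle.
    gain₀ : ¬ Joined i s₀₀ → Joined i s₀₁ → Commutes F
    gain₀ ¬a₀₀ a₀₁ = finish (joined? j s₁₁)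
      where
      matched₀₀ : MatchedAt s₀₀
      matched₀₀ = newly-joined-matched j₀ ¬a₀₀ a₀₁
      ¬b₀₀ = matched-apart matched₀₀ ¬a₀₀
      a₁₀ = force join-i₀ ¬a₀₀
      b₀₁ = force join-j₀ ¬b₀₀
      one₁₀ = matched-joins (coarsen-matched i₀ a₁₀ matched₀₀) a₁₀
      one₀₁ = matched-joins (coarsen-matched j₀ b₀₁ matched₀₀) a₀₁
      b₁₀ = one-joined one₁₀
      finish : Dec (Joined j s₁₁) → Commutes F
      finish (yes b₁₁) = commutes-if (no ¬a₀₀) (yes a₁₀) (yes a₀₁) (yes (proj₁ one₁₁))
        (no ¬b₀₀) (yes b₁₀) (yes b₀₁) (yes b₁₁)
        (by-totals one₁₁ (single unit) (single κ) (single κ) (single unit) (·-comm _ _))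
        where one₁₁ = coarsen-one j₁ b₁₁ one₁₀
      -- Each path merges two circles and then splits the result, so the paths differ only in
      -- whether the copairing sits at `j` or at `i`.
      finish (no ¬b₁₁) = commutes-if (no ¬a₀₀) (yes a₁₀) (yes a₀₁) (no ¬a₁₁)
        (no ¬b₀₀) (yes b₁₀) (yes b₀₁) (no ¬b₁₁)
        (weigh₂-matched s₁₁ (newly-joined-matched (agree-sym s₁₀ s₁₁ j₁) ¬a₁₁ a₁₀) unit)
        where
        ¬a₁₁ : ¬ Joined i s₁₁
        ¬a₁₁ a₁₁ = ¬b₁₁ (one-joined (coarsen-one i₁ a₁₁ one₀₁))

    loss₀ : Joined i s₀₀ → ¬ Joined i s₀₁ → Commutes F
    loss₀ a₀₀ ¬a₀₁ = finish (joined? i s₁₀)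
      where
      matched₀₁ : MatchedAt s₀₁
      matched₀₁ = newly-joined-matched (agree-sym s₀₀ s₀₁ j₀) ¬a₀₁ a₀₀
      ¬b₀₁ = matched-apart matched₀₁ ¬a₀₁
      b₀₀ = force⁻ join-j₀ ¬b₀₁
      one₀₀ = matched-joins (coarsen-matched (agree-sym s₀₀ s₀₁ j₀) b₀₀ matched₀₁) a₀₀
      a₁₁ = force join-i₁ ¬a₀₁
      one₁₁ = matched-joins (coarsen-matched i₁ a₁₁ matched₀₁) a₁₁
      b₁₁ = one-joined one₁₁
      finish : Dec (Joined i s₁₀) → Commutes F
      -- Two one-to-one changes on one path against a split and a merge on the other: the hypothesis
      -- on m² enters here and, with the paths exchanged, in `gain₁`.
      finish (yes a₁₀) = commutes-if (yes a₀₀) (yes a₁₀) (no ¬a₀₁) (yes a₁₁)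
        (yes b₀₀) (yes (one-joined (coarsen-one i₀ a₁₀ one₀₀))) (no ¬b₀₁) (yes b₁₁)
        (by-totals one₁₁ (single κ) (single κ) (single unit) copairing κκ)
      finish (no ¬a₁₀) = commutes-if (yes a₀₀) (no ¬a₁₀) (no ¬a₀₁) (yes a₁₁)
        (yes b₀₀) (no ¬b₁₀) (no ¬b₀₁) (yes b₁₁)
        (by-totals one₁₁ copairing (single unit) (single unit) copairing (·-comm _ _))
        where
        ¬b₁₀ : ¬ Joined j s₁₀
        ¬b₁₀ b₁₀ = ¬a₁₀ (coarsen (agree-sym s₁₀ s₁₁ j₁) b₁₀ a₁₁)

    gain₁ : ¬ Joined i s₁₀ → Joined i s₁₁ → Commutes F
    gain₁ ¬a₁₀ a₁₁ = finish (joined? i s₀₁)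
      where
      matched₁₀ : MatchedAt s₁₀
      matched₁₀ = newly-joined-matched j₁ ¬a₁₀ a₁₁
      ¬b₁₀ = matched-apart matched₁₀ ¬a₁₀
      b₁₁ = force join-j₁ ¬b₁₀
      one₁₁ = matched-joins (coarsen-matched j₁ b₁₁ matched₁₀) a₁₁
      a₀₀ = force⁻ join-i₀ ¬a₁₀
      b₀₀ = one-joined (matched-joins (coarsen-matched (agree-sym s₀₀ s₁₀ i₀) a₀₀ matched₁₀) a₀₀)
      finish : Dec (Joined i s₀₁) → Commutes F
      finish (yes a₀₁) = commutes-if (yes a₀₀) (no ¬a₁₀) (yes a₀₁) (yes a₁₁)
        (yes b₀₀) (no ¬b₁₀) (yes (one-joined (coarsen-one (agree-sym s₀₁ s₁₁ i₁) a₀₁ one₁₁))) (yes b₁₁)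
        (by-totals one₁₁ copairing (single unit) (single κ) (single κ)
          (V.≈ᴹ-trans (·-comm _ _) (V.≈ᴹ-sym κκ)))
      finish (no ¬a₀₁) = loss₀ a₀₀ ¬a₀₁

    loss₁ : Joined i s₁₀ → ¬ Joined i s₁₁ → Commutes F
    loss₁ a₁₀ ¬a₁₁ = finish (joined? i s₀₀)
      where
      matched₁₁ : MatchedAt s₁₁
      matched₁₁ = newly-joined-matched (agree-sym s₁₀ s₁₁ j₁) ¬a₁₁ a₁₀
      ¬b₁₁ = matched-apart matched₁₁ ¬a₁₁
      b₁₀ = force⁻ join-j₁ ¬b₁₁
      a₀₁ = force⁻ join-i₁ ¬a₁₁
      one₁₀ = matched-joins′ (coarsen-matched (agree-sym s₁₀ s₁₁ j₁) b₁₀ matched₁₁) b₁₀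
      b₀₁ = one-joined (matched-joins (coarsen-matched (agree-sym s₀₁ s₁₁ i₁) a₀₁ matched₁₁) a₀₁)
      finish : Dec (Joined i s₀₀) → Commutes F
      -- Each path has one one-to-one change and one split, performed at opposite edges, so the
      -- copairing has to pass a factor `κ`.
      finish (yes a₀₀) = commutes-if (yes a₀₀) (yes a₁₀) (yes a₀₁) (no ¬a₁₁)
        (yes (one-joined (coarsen-one (agree-sym s₀₀ s₁₀ i₀) a₀₀ one₁₀))) (yes b₁₀) (yes b₀₁) (no ¬b₁₁)
        (weigh₂-matched s₁₁ matched₁₁ κ)
      finish (no ¬a₀₀) = gain₀ ¬a₀₀ a₀₁

  -- If neither change affects whether the corners of the other edge are joined, both paths have the
  -- same weights. Every exception is one of the four cases above, for `F` or for its transpose.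
  commutes : ∀ {i j} (F : Face i j) → Commutes F
  commutes {i} {j} F =
    compare (joined? i s₀₀) (joined? i s₀₁) (gain₀ F) (loss₀ F) λ a₀ →
    compare (joined? i s₁₀) (joined? i s₁₁) (gain₁ F) (loss₁ F) λ a₁ →
    compare (joined? j s₀₀) (joined? j s₁₀) (λ p q → flip (gain₀ F′ p q)) (λ p q → flip (loss₀ F′ p q)) λ b₀ →
    compare (joined? j s₀₁) (joined? j s₁₁) (λ p q → flip (gain₁ F′ p q)) (λ p q → flip (loss₁ F′ p q)) λ b₁ →
    commutes-if F (joined? i s₀₀) (joined? i s₁₀) (joined? i s₀₁) (joined? i s₁₁)
      (joined? j s₀₀) (joined? j s₁₀) (joined? j s₀₁) (joined? j s₁₁)
      λ g → W.≈ᴹ-reflexive (≡.cong₂ (λ w z → weigh₂ s₁₁ w (i , ↖) (i , ↗) z (j , ↖) (j , ↗) g)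
        (≡.cong₂ kind a₀ a₁) (≡.cong₂ kind (≡.sym b₀) (≡.sym b₁)))
    where
    open Face F
    module W = Module (V^ s₁₁)
    F′ = transpose F
    flip : Commutes F′ → Commutes F
    flip eq g = W.≈ᴹ-sym (eq g)

  face : ∀ {i j} (F : Face i j) → let open Face F in
         edge s₁₀ s₁₁ j₁ ∘ᴸ edge s₀₀ s₁₀ i₀ ≋ edge s₀₁ s₁₁ i₁ ∘ᴸ edge s₀₀ s₀₁ j₀
  face F = lift-ext (V^ s₁₁) (edge s₁₀ s₁₁ j₁ ∘ᴸ edge s₀₀ s₁₀ i₀) (edge s₀₁ s₁₁ i₁ ∘ᴸ edge s₀₀ s₀₁ j₀) λ f →
    W.≈ᴹ-trans (⟦⟧-cong (edge s₁₀ s₁₁ j₁ ∘ᴸ edge s₀₀ s₁₀ i₀) (π-surjective s₀₀ f))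
      (W.≈ᴹ-trans (commutes F (decoration s₀₀ f))
        (W.≈ᴹ-sym (⟦⟧-cong (edge s₀₁ s₁₁ i₁ ∘ᴸ edge s₀₀ s₀₁ j₀) (π-surjective s₀₀ f))))
    where
    open Face F
    module W = Module (V^ s₁₁)

-- Signs

open Decidable⇒UIP ℤ._≟_ using () renaming (≡-irrelevant to ℤ-irrelevant)

module _ {c ℓ m ℓm} {R : CommutativeRing c ℓ} (M : Module R m ℓm) where

  open Module M
  open ModuleSum M
  open import Algebra.Properties.CommutativeSemigroup
    (CommutativeMonoid.commutativeSemigroup +ᴹ-commutativeMonoid) using (interchange)

  sum-zero : ∀ n {f : Fin n → Carrierᴹ} → (∀ k → f k ≈ᴹ 0ᴹ) → sum f ≈ᴹ 0ᴹ
  sum-zero n f≈0 = ≈ᴹ-trans (sum-cong n f≈0) (sum-replicate-zero n)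

  -- The first row cancels the first column, and the rest is a smaller instance. The diagonal needs
  -- its own hypothesis, as antisymmetry only makes twice its entries zero.
  sum-antisymmetric : ∀ n (T : Fin n → Fin n → Carrierᴹ) → (∀ j → T j j ≈ᴹ 0ᴹ) →
                      (∀ j k → T j k +ᴹ T k j ≈ᴹ 0ᴹ) → sum (λ j → sum (T j)) ≈ᴹ 0ᴹ
  sum-antisymmetric ℕ.zero    T diagonal antisym = ≈ᴹ-refl
  sum-antisymmetric (ℕ.suc n) T diagonal antisym = begin
    (T zero zero +ᴹ sum row) +ᴹ sum (λ j → T (suc j) zero +ᴹ sum (T (suc j) ∘ suc))
      ≈⟨ +ᴹ-cong (≈ᴹ-trans (+ᴹ-congʳ (diagonal zero)) (+ᴹ-identityˡ _)) (∑-distrib-+ column (λ j → sum (T (suc j) ∘ suc))) ⟩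
    sum row +ᴹ (sum column +ᴹ sum (λ j → sum (T (suc j) ∘ suc)))
      ≈⟨ +ᴹ-assoc _ _ _ ⟨
    (sum row +ᴹ sum column) +ᴹ sum (λ j → sum (T (suc j) ∘ suc))
      ≈⟨ +ᴹ-cong (≈ᴹ-trans (≈ᴹ-sym (∑-distrib-+ row column)) (sum-zero n (λ k → antisym zero (suc k))))
                 (sum-antisymmetric n (λ j → T (suc j) ∘ suc) (diagonal ∘ suc) (λ j k → antisym (suc j) (suc k))) ⟩
    0ᴹ +ᴹ 0ᴹ
      ≈⟨ +ᴹ-identityˡ _ ⟩
    0ᴹ ∎
    where
    open SetoidReasoning ≈ᴹ-setoid
    row column : Fin n → Carrierᴹ
    row k    = T zero (suc k)
    column j = T (suc j) zero

module _ {c ℓ m ℓm n ℓn} {R : CommutativeRing c ℓ} {M : Module R m ℓm} {N : Module R n ℓn} where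

  open LinearAlgebra R
  open Module N
  open ModuleSum N

  ∑ᴸ-sum : ∀ {k} (f : Fin k → LinearMap M N) x → ⟦ ∑ᴸ f ⟧ x ≈ᴹ sum (λ j → ⟦ f j ⟧ x)
  ∑ᴸ-sum {ℕ.zero}  f x = ≈ᴹ-refl
  ∑ᴸ-sum {ℕ.suc k} f x = +ᴹ-congˡ (∑ᴸ-sum (f ∘ suc) x)

-- Cancellation in the square of the differential

module Differential {c ℓ v ℓv} (R : CommutativeRing c ℓ) (𝓕 : MTQFT R v ℓv)
                    (m²≋μΔ : LinearAlgebra._≋_ R (MTQFT.hom 𝓕 (mᶜ ∘ᶜ mᶜ)) (MTQFT.hom 𝓕 (μᶜ ∘ᶜ Δᶜ)))
                    (Γ : PerfectMatchingGraph) (trivalent : PerfectMatchingGraph.Trivalent Γ) where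

  open PerfectMatchingGraph Γ using (∣M∣)
  open CommutativeRing R using (1#; -_; _*_; _+_; 0#; _≈_; semiring; setoid; ring)
    renaming (refl to ≈-refl; trans to ≈-trans; sym to ≈-sym)
  module K = CommutativeRing R
  open Exp semiring using (_^_)
  open LinearAlgebra R hiding (~-sym; ·-cong; ·-assoc; comm; assoc)
  open LinearMap using (⟦⟧-cong; 0ᴹ-homo)
  open States Γ
  open Cube R 𝓕 Γ
  open Faces R 𝓕 m²≋μΔ Γ
  open TrivalentEnds Γ trivalent

  sign : State ∣M∣ → Fin ∣M∣ → K.Carrier
  sign α j = (- 1#) ^ onesBefore α j

  onesBefore-after : ∀ {n} (α : State n) {j k} → j Fin.< k → lookup α j ≡ false →
                     onesBefore (α [ j ]≔ true) k ≡ ℕ.suc (onesBefore α k)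
  onesBefore-after (false ∷ α) {zero}  {suc k} _           _ = refl
  onesBefore-after (true ∷ α)  {suc j} {suc k} (ℕ.s≤s j<k) e = ≡.cong ℕ.suc (onesBefore-after α j<k e)
  onesBefore-after (false ∷ α) {suc j} {suc k} (ℕ.s≤s j<k) e = onesBefore-after α j<k e

  onesBefore-before : ∀ {n} (α : State n) {j k} → j Fin.< k →
                      onesBefore (α [ k ]≔ true) j ≡ onesBefore α j
  onesBefore-before (b ∷ α)     {zero}  {suc k} _           = refl
  onesBefore-before (true ∷ α)  {suc j} {suc k} (ℕ.s≤s j<k) = ≡.cong ℕ.suc (onesBefore-before α j<k)
  onesBefore-before (false ∷ α) {suc j} {suc k} (ℕ.s≤s j<k) = onesBefore-before α j<k

  -- Raising `j` puts one more 1 to the left of `k`, whereas raising `k` changes nothing to the left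
  -- of `j`.
  sign-< : ∀ α {j k} → j Fin.< k → lookup α j ≡ false →
           sign α j * sign (raise α j) k + sign α k * sign (raise α k) j ≈ 0#
  sign-< α {j} {k} j<k e rewrite onesBefore-after α j<k e | onesBefore-before α j<k = begin
    x * (- 1# * y) + y * x    ≈⟨ K.+-congʳ (K.*-congˡ (-1*x≈-x y)) ⟩
    x * (- y) + y * x         ≈⟨ K.+-cong (≈-sym (-‿distribʳ-* x y)) (K.*-comm y x) ⟩
    - (x * y) + x * y         ≈⟨ K.-‿inverseˡ _ ⟩
    0#                        ∎
    where
    open SetoidReasoning setoid
    open RingProperties ring
    x = sign α j
    y = sign α k

  sign-≢ : ∀ α {j k} → j ≢ k → lookup α j ≡ false → lookup α k ≡ false →
           sign α j * sign (raise α j) k + sign α k * sign (raise α k) j ≈ 0#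
  sign-≢ α {j} {k} j≢k e e′ with Fin.<-cmp j k
  ... | tri< j<k _ _ = sign-< α j<k e
  ... | tri≈ _ j≡k _ = ⊥-elim (j≢k j≡k)
  ... | tri> _ _ k<j = ≈-trans (K.+-comm _ _) (sign-< α k<j e′)

  square : ∀ α {j k} → j ≢ k → lookup α j ≡ false → lookup α k ≡ false →
           AgreeOff j (raise α k) (raise (raise α j) k) → Face j k
  square α {j} {k} j≢k e e′ agree = record
    { s₀₀ = α
    ; s₁₀ = raise α j
    ; s₀₁ = raise α k
    ; s₁₁ = raise (raise α j) k
    ; i₀ = raise-agree α j
    ; i₁ = agree
    ; j₀ = raise-agree α k
    ; j₁ = raise-agree (raise α j) k
    ; join-i₀ = λ p q → joined-before-or-after {j} {α} {raise α j} (raise-agree α j) e (lookup∘update j α true) p q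
    ; join-i₁ = λ p q → joined-before-or-after {j} {raise α k} {raise (raise α j) k} agree
                  (trans (lookup∘update′ j≢k α true) e)
                  (trans (lookup∘update′ j≢k (raise α j) true) (lookup∘update j α true)) p q
    ; join-j₀ = λ p q → joined-before-or-after {k} {α} {raise α k} (raise-agree α k) e′ (lookup∘update k α true) p q
    ; join-j₁ = λ p q → joined-before-or-after {k} {raise α j} {raise (raise α j) k} (raise-agree (raise α j) k)
                  (trans (lookup∘update′ (j≢k ∘ sym) α true) e′) (lookup∘update k (raise α j) true) p q
    }

  module _ {i : ℤ} where

    private module C′ = Module (C (ℤ.suc i))

    -- Replaces the internal proof that the entry is 0 by a given one. The resulting proofs of the
    -- weight agree because equality of integers is proof-irrelevant.
    component-0 : ∀ (s : StatesOfWeight i) j b eq (e : lookup (proj₁ s) j ≡ false) y →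
                  ⟦ component s j b eq ⟧ y C′.≈ᴹ
                  sign (proj₁ s) j C′.*ₗ gen (raise-weight s j e , ⟦ edge (proj₁ s) (raise (proj₁ s) j) (raise-agree (proj₁ s) j) ⟧ y)
    component-0 s j true  eq e y with trans (sym eq) e
    ... | ()
    component-0 (α , p) j false eq e y = C′.*ₗ-congˡ (C′.≈ᴹ-reflexive (≡.cong
      (λ q → gen ((raise α j , q) , ⟦ edge α (raise α j) (raise-agree α j) ⟧ y)) (ℤ-irrelevant _ _)))

    component-1 : ∀ (s : StatesOfWeight i) j b eq → lookup (proj₁ s) j ≡ true → ∀ y →
                  ⟦ component s j b eq ⟧ y C′.≈ᴹ C′.0ᴹ
    component-1 s j true  eq e y = C′.≈ᴹ-refl
    component-1 s j false eq e y with trans (sym eq) e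
    ... | ()

  module _ {i : ℤ} (s : StatesOfWeight i) (x : Module.Carrierᴹ (V^ (proj₁ s))) where

    private
      α = proj₁ s
      module C″ = Module (C (ℤ.suc (ℤ.suc i)))
      open ModuleSum (C (ℤ.suc (ℤ.suc i)))

    -- The term of the squared differential that raises `j` and then `k`, zero if either entry is
    -- already 1. The bit `b` stands for `lookup α j` so that it can be matched on.
    corner : ∀ j b → lookup α j ≡ b → Fin ∣M∣ → C″.Carrierᴹ
    corner j true  e k = C″.0ᴹ
    corner j false e k = sign α j C″.*ₗ ⟦ component (raise-weight s j e) k (lookup (raise α j) k) refl ⟧
                                          (⟦ edge α (raise α j) (raise-agree α j) ⟧ x)

    ∂-component : ∀ j b e → ⟦ ∂ (ℤ.suc i) ⟧ (⟦ component s j b e ⟧ x) C″.≈ᴹ sum (corner j b e)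
    ∂-component j true  e = C″.≈ᴹ-trans (0ᴹ-homo (∂ (ℤ.suc i))) (C″.≈ᴹ-sym (sum-replicate-zero ∣M∣))
    ∂-component j false e = C″.≈ᴹ-trans
      (C″.*ₗ-congˡ (∑ᴸ-sum (λ k → component (raise-weight s j e) k (lookup (raise α j) k) refl) y))
      (map-sum scale (λ k → ⟦ component (raise-weight s j e) k (lookup (raise α j) k) refl ⟧ y))
      where
      y = ⟦ edge α (raise α j) (raise-agree α j) ⟧ x
      scale : LinearMap (C (ℤ.suc (ℤ.suc i))) (C (ℤ.suc (ℤ.suc i)))
      scale = sign α j ·ᴸ linear id id (λ _ _ → C″.≈ᴹ-refl) (λ _ _ → C″.≈ᴹ-refl)

    corner-diagonal : ∀ j b e → corner j b e j C″.≈ᴹ C″.0ᴹ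
    corner-diagonal j true  e = C″.≈ᴹ-refl
    corner-diagonal j false e = C″.≈ᴹ-trans
      (C″.*ₗ-congˡ (component-1 (raise-weight s j e) j _ refl (lookup∘update j α true) _))
      (C″.*ₗ-zeroʳ _)

    corner-twice : ∀ j e k e″ → corner j false e k C″.≈ᴹ
                   (sign α j * sign (raise α j) k) C″.*ₗ gen (raise-weight (raise-weight s j e) k e″ ,
                     ⟦ edge (raise α j) (raise (raise α j) k) (raise-agree (raise α j) k) ⟧ (⟦ edge α (raise α j) (raise-agree α j) ⟧ x))
    corner-twice j e k e″ = C″.≈ᴹ-trans
      (C″.*ₗ-congˡ (component-0 (raise-weight s j e) k _ refl e″ _)) (C″.≈ᴹ-sym (C″.*ₗ-assoc _ _ _))

    corner-antisymmetric : ∀ j b e k b′ e′ → corner j b e k C″.+ᴹ corner k b′ e′ j C″.≈ᴹ C″.0ᴹ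
    corner-antisymmetric j true e k true e′ = C″.+ᴹ-identityˡ _
    corner-antisymmetric j true e k false e′ = C″.≈ᴹ-trans (C″.+ᴹ-identityˡ _)
      (C″.≈ᴹ-trans (C″.*ₗ-congˡ (component-1 (raise-weight s k e′) j _ refl still _)) (C″.*ₗ-zeroʳ _))
      where
      still : lookup (raise α k) j ≡ true
      still with j Fin.≟ k
      ... | yes refl = lookup∘update j α true
      ... | no j≢k   = trans (lookup∘update′ j≢k α true) e
    corner-antisymmetric j false e k true e′ = C″.≈ᴹ-trans (C″.+ᴹ-comm _ _)
      (corner-antisymmetric k true e′ j false e)
    corner-antisymmetric j false e k false e′ with j Fin.≟ k
    ... | yes refl = C″.≈ᴹ-trans (C″.+ᴹ-cong (corner-diagonal j false e) (corner-diagonal j false e′))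
                       (C″.+ᴹ-identityˡ _)
    ... | no j≢k = begin
      corner j false e k C″.+ᴹ corner k false e′ j
        ≈⟨ C″.+ᴹ-cong (corner-twice j e k k-0) (corner-twice k e′ j j-0) ⟩
      (sign α j * sign (raise α j) k) C″.*ₗ gen (_ , _) C″.+ᴹ (sign α k * sign (raise α k) j) C″.*ₗ gen (_ , _)
        ≈⟨ C″.+ᴹ-congˡ (C″.*ₗ-congˡ (C″.≈ᴹ-sym (same-corner ([]≔-commutes α j k j≢k) (raise-agree (raise α k) j) _ _))) ⟩
      (sign α j * sign (raise α j) k) C″.*ₗ gen (_ , _) C″.+ᴹ (sign α k * sign (raise α k) j) C″.*ₗ gen (_ , _)
        ≈⟨ C″.*ₗ-distribʳ _ _ _ ⟨
      (sign α j * sign (raise α j) k + sign α k * sign (raise α k) j) C″.*ₗ gen (_ , _)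
        ≈⟨ C″.*ₗ-congʳ (sign-≢ α j≢k e e′) ⟩
      0# C″.*ₗ gen (_ , _)
        ≈⟨ C″.*ₗ-zeroˡ _ ⟩
      C″.0ᴹ ∎
      where
      open SetoidReasoning C″.≈ᴹ-setoid
      k-0 = trans (lookup∘update′ (j≢k ∘ sym) α true) e′
      j-0 = trans (lookup∘update′ j≢k α true) e
      -- The last state of the other path is a variable `γ`, so that the commutation of the two
      -- updates can be matched with `refl`.
      same-corner : ∀ {γ} → raise (raise α j) k ≡ γ → (agree : AgreeOff j (raise α k) γ) → ∀ p q →
                    gen ((raise (raise α j) k , p) , ⟦ edge (raise α j) (raise (raise α j) k) (raise-agree (raise α j) k) ⟧ (⟦ edge α (raise α j) (raise-agree α j) ⟧ x))
                    C″.≈ᴹ gen ((γ , q) , ⟦ edge (raise α k) γ agree ⟧ (⟦ edge α (raise α k) (raise-agree α k) ⟧ x))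
      same-corner refl agree p q rewrite ℤ-irrelevant p q =
        relation (⨁-cong (raise (raise α j) k , q) (face (square α j≢k e e′ agree) x))

  ∂-∂ : ∀ i → ∂ (ℤ.suc i) ∘ᴸ ∂ i ≋ zeroᴸ
  ∂-∂ i = lift-ext (C (ℤ.suc (ℤ.suc i))) (∂ (ℤ.suc i) ∘ᴸ ∂ i) zeroᴸ λ (s , x) →
    let open Module (C (ℤ.suc (ℤ.suc i)))
        α = proj₁ s
        T = λ j → corner s x j (lookup α j) refl in
    ≈ᴹ-trans (⟦⟧-cong (∂ (ℤ.suc i)) (∑ᴸ-sum (λ j → component s j (lookup α j) refl) x))
      (≈ᴹ-trans (map-sum (∂ (ℤ.suc i)) (λ j → ⟦ component s j (lookup α j) refl ⟧ x))
        (≈ᴹ-trans (ModuleSum.sum-cong (C (ℤ.suc (ℤ.suc i))) ∣M∣ (λ j → ∂-component s x j (lookup α j) refl))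
          (sum-antisymmetric (C (ℤ.suc (ℤ.suc i))) ∣M∣ T
            (λ j → corner-diagonal s x j (lookup α j) refl)
            (λ j k → corner-antisymmetric s x j (lookup α j) refl k (lookup α k) refl))))

theorem3p3p14 : ∀ {c ℓ v ℓv a ℓa p} (R : CommutativeRing c ℓ) (𝓕 : MTQFT R v ℓv) →
    LinearAlgebra._≋_ R (MTQFT.hom 𝓕 (mᶜ ∘ᶜ mᶜ)) (MTQFT.hom 𝓕 (μᶜ ∘ᶜ Δᶜ)) →
    (𝒢 : FinGenAbelianGroup a ℓa)
    (G : Graded.Components R 𝒢 (MTQFT.V 𝓕) p) → Graded.IsGrading R 𝒢 G →
    (s : Fin (FinGenAbelianGroup.rank 𝒢) → ℤ)
    (Γ : PerfectMatchingGraph) → PerfectMatchingGraph.Trivalent Γ →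
    LinearAlgebra.IsChainComplex R
    (λ i → Graded.GradedModule.module′ (Cube.C-graded R 𝓕 Γ 𝒢 G s i))
    (Cube.∂ R 𝓕 Γ)
theorem3p3p14 R 𝓕 m²≋μΔ _ _ _ _ Γ trivalent = Differential.∂-∂ R 𝓕 m²≋μΔ Γ trivalent
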